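{- Let $G=(V,E)$ be a multigraph with $m$ edges (loops counted). Then $$h^\ast(\mathcal C_G;z)=\sum_{H}(2z)^{|H|}(1+z)^{m-|H|},$$ where the sum ranges over all subsets $H\subseteq E$ such that the graph $(V,H)$ is acyclic (contains no cycle; in particular no loop).
   Context: For a finite undirected multigraph $G=(V,E)$ (loops, parallel edges and isolated nodes allowed) with $n=|V|$, $m=|E|$, work in $\mathbb{R}^V\times\mathbb{R}^E\cong\mathbb{R}^{n+m}$ with standard basis vectors $e_u$, $e_f$. For each edge $f$ with endpoints $u,v$ ($u=v$ for a loop) set $\widetilde e_f=e_u+e_v-e_f$, $\overleftarrow e_f=e_u-e_v+e_f$, $\overrightarrow e_f=-e_u+e_v+e_f$. The cosmological polytope $\mathcal C_G$ is the convex hull of $\{e_f,\widetilde e_f,\overleftarrow e_f,\overrightarrow e_f: f\in E\}\cup\{e_u: u\in V\}$, a lattice polytope of dimension $n+m-1$. For a $d$-dimensional lattice polytope $P\subseteq\mathbb{R}^N$, the $h^\ast$-polynomial is defined by $\sum_{j\ge0}|jP\cap\mathbb{Z}^N|z^j=h^\ast(P;z)/(1-z)^{d+1}$. -}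

module Defs where

open import Level using (Level; 0ℓ; _⊔_) renaming (suc to lsuc)
open import Algebra.Bundles using (CommutativeRing)
open import Data.Nat.Base as ℕ using (ℕ; zero; suc; _∸_; z≤n; s≤s)
import Data.Nat.Properties as ℕ
open import Data.Integer.Base as ℤ using (ℤ; 0ℤ; 1ℤ; +_; -[1+_])
import Data.Integer.Properties as ℤ
open import Data.Fin.Base using (Fin; toℕ; _↑ˡ_; _↑ʳ_)
open import Data.Fin.Properties using (_≟_; any?; injective⇒≤)
open import Data.Fin.Subset as Subset using (Subset; inside; outside)
open import Data.Fin.Subset.Properties using (_∈?_)
open import Data.Vec.Base as Vec using (Vec)
open import Data.List.Base using (List; []; _∷_; _++_; map; filter; foldr; length; lookup)
open import Data.List.Properties using (length-map)
open import Data.List.Membership.Propositional using (_∈_)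
open import Data.List.Membership.Propositional.Properties using (∈-lookup)
open import Data.List.Relation.Unary.All as All using (All; _∷_)
open import Data.List.Relation.Unary.AllPairs using (_∷_)
open import Data.List.Relation.Unary.Unique.Propositional using (Unique)
open import Data.List.Relation.Unary.Unique.DecPropositional using (unique?)
open import Data.Product.Base using (Σ-syntax; ∃-syntax; ∃; _×_; _,_; proj₁; proj₂)
open import Data.Product.Properties using (≡-dec)
open import Data.Sum.Base using (_⊎_; inj₁; inj₂)
open import Function.Base using (_∘_)
open import Function.Bundles using (_⇔_)
open import Relation.Binary.Core using (Rel)
open import Relation.Binary.PropositionalEquality.Core using (_≡_; refl; cong; sym; subst)
open import Relation.Binary.Structures using (IsTotalOrder)
open import Relation.Nullary.Decidable using (Dec; yes; no; does; map′; ¬?; _×-dec_; _⊎-dec_)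
open import Relation.Nullary.Negation using (¬_; contradiction)
open import Relation.Unary using (Pred; Decidable)
open import Data.Bool.Base using (if_then_else_)

------------------------------------------------------------------------
-- Multigraphs

-- V = Fin n and E = Fin m.  Edges are undirected: the order in which the two
-- endpoints of an edge are listed is an arbitrary choice.

record Multigraph (n m : ℕ) : Set where
  field
    endpoints : Fin m → Fin n × Fin n

module Cycles {n m : ℕ} (G : Multigraph n m) where
  open Multigraph G

  Joins : Fin m → Fin n → Fin n → Set
  Joins f u v = endpoints f ≡ (u , v) ⊎ endpoints f ≡ (v , u)

  -- A step traverses an edge and records the node it arrives at.
  Step : Set
  Step = Fin m × Fin n

  IsWalk : Subset m → Fin n → List Step → Fin n → Set
  IsWalk H u []            w = u ≡ w
  IsWalk H u ((f , v) ∷ s) w = f Subset.∈ H × Joins f u v × IsWalk H v s w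

  -- A loop is a cycle of length 1 and two parallel edges form a cycle of
  -- length 2.  Distinctness of the edges excludes going back along one edge.
  IsCycle : Subset m → Fin n → List Step → Set
  IsCycle H u s = ¬ s ≡ [] × IsWalk H u s u × Unique (map proj₁ s) × Unique (map proj₂ s)

  Acyclic : Subset m → Set
  Acyclic H = ¬ (∃[ u ] ∃[ s ] IsCycle H u s)

  -- Acyclicity is decidable because a cycle has at most m steps.
  private
    joins? : ∀ f u v → Dec (Joins f u v)
    joins? f u v = ≡-dec _≟_ _≟_ (endpoints f) (u , v) ⊎-dec ≡-dec _≟_ _≟_ (endpoints f) (v , u)

    isWalk? : ∀ H u s w → Dec (IsWalk H u s w)
    isWalk? H u []            w = u ≟ w
    isWalk? H u ((f , v) ∷ s) w = f ∈? H ×-dec joins? f u v ×-dec isWalk? H v s w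

    ≡[]? : (s : List Step) → Dec (s ≡ [])
    ≡[]? []      = yes refl
    ≡[]? (_ ∷ _) = no λ ()

    isCycle? : ∀ H u s → Dec (IsCycle H u s)
    isCycle? H u s = ¬? (≡[]? s) ×-dec isWalk? H u s u
                     ×-dec unique? _≟_ (map proj₁ s) ×-dec unique? _≟_ (map proj₂ s)

    boundedSearch : ∀ k {P : Pred (List Step) 0ℓ} → Decidable P →
                    Dec (∃[ s ] length s ℕ.≤ k × P s)
    boundedSearch zero P? =
      map′ (λ p → [] , z≤n , p) (λ { ([] , _ , p) → p }) (P? [])
    boundedSearch (suc k) P? =
      map′ (λ { (inj₁ p) → [] , z≤n , p
              ; (inj₂ (f , v , s , le , p)) → (f , v) ∷ s , s≤s le , p })
           (λ { ([] , _ , p) → inj₁ p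
              ; ((f , v) ∷ s , s≤s le , p) → inj₂ (f , v , s , le , p) })
           (P? [] ⊎-dec any? λ f → any? λ v → boundedSearch k (λ s → P? ((f , v) ∷ s)))

    lookup-injective : ∀ {a} {A : Set a} {xs : List A} → Unique xs →
                       ∀ {i j} → lookup xs i ≡ lookup xs j → i ≡ j
    lookup-injective (_  ∷ _)  {Fin.zero}  {Fin.zero}  _  = refl
    lookup-injective (px ∷ _)  {Fin.zero}  {Fin.suc j} eq = contradiction eq (All.lookup px (∈-lookup j))
    lookup-injective (px ∷ _)  {Fin.suc i} {Fin.zero}  eq = contradiction (sym eq) (All.lookup px (∈-lookup i))
    lookup-injective (_  ∷ us) {Fin.suc i} {Fin.suc j} eq = cong Fin.suc (lookup-injective us eq)

    cycle-length≤m : ∀ {H u s} → IsCycle H u s → length s ℕ.≤ m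
    cycle-length≤m {s = s} (_ , _ , ue , _) =
      subst (ℕ._≤ m) (length-map proj₁ s) (injective⇒≤ (lookup-injective ue))

  acyclic? : Decidable Acyclic
  acyclic? H = ¬? (any? λ u → map′ (λ { (s , _ , c) → s , c })
                                   (λ { (s , c) → s , cycle-length≤m {s = s} c , c })
                                   (boundedSearch m (isCycle? H u)))

subsets : ∀ m → List (Subset m)
subsets zero    = Vec.[] ∷ []
subsets (suc m) = map (outside Vec.∷_) (subsets m) ++ map (inside Vec.∷_) (subsets m)

acyclicSubsets : ∀ {n m} → Multigraph n m → List (Subset m)
acyclicSubsets {m = m} G = filter (Cycles.acyclic? G) (subsets m)

------------------------------------------------------------------------
-- Formal power series over ℤ, as coefficient sequences

module PowerSeries where
  open import Algebra.Properties.Monoid.Sum ℤ.+-0-monoid using (sum⁺-syntax)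

  Series : Set
  Series = ℕ → ℤ

  infixl 6 _⊕_ _⊖_
  infixl 7 _⊛_
  infixr 8 _^_
  infix  4 _≐_

  _≐_ : Series → Series → Set
  a ≐ b = ∀ k → a k ≡ b k

  const : ℤ → Series
  const c zero    = c
  const c (suc _) = 0ℤ

  z : Series
  z 1 = 1ℤ
  z _ = 0ℤ

  _⊕_ _⊖_ _⊛_ : Series → Series → Series
  (a ⊕ b) k = a k ℤ.+ b k
  (a ⊖ b) k = a k ℤ.- b k
  (a ⊛ b) k = ∑[ i ≤ k ] (a (toℕ i) ℤ.* b (k ∸ toℕ i))

  _^_ : Series → ℕ → Series
  a ^ zero  = const 1ℤ
  a ^ suc k = a ⊛ a ^ k

  sumOver : ∀ {a} {A : Set a} → List A → (A → Series) → Series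
  sumOver xs f = foldr (λ x s → f x ⊕ s) (const 0ℤ) xs

  infix 5 sumOver
  syntax sumOver xs (λ x → s) = ∑[ x ∈ xs ] s

------------------------------------------------------------------------
-- Ordered fields

record OrderedField c ℓ₁ ℓ₂ : Set (lsuc (c ⊔ ℓ₁ ⊔ ℓ₂)) where
  field
    commutativeRing : CommutativeRing c ℓ₁
  open CommutativeRing commutativeRing public
  infix 4 _≤_
  field
    _≤_          : Rel Carrier ℓ₂
    isTotalOrder : IsTotalOrder _≈_ _≤_
    +-monoˡ-≤    : ∀ x {y z} → y ≤ z → y + x ≤ z + x
    *-nonNeg     : ∀ {x y} → 0# ≤ x → 0# ≤ y → 0# ≤ x * y
    0≉1          : ¬ 0# ≈ 1#
    inverse      : ∀ x → ¬ x ≈ 0# → ∃[ y ] x * y ≈ 1#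

------------------------------------------------------------------------
-- Polytopes and Ehrhart theory in Kᴺ, for an ordered field K such as ℝ

module Polytopes {c ℓ₁ ℓ₂} (K : OrderedField c ℓ₁ ℓ₂) where
  open OrderedField K hiding (refl; sym)
  open import Algebra.Properties.Monoid.Sum +-monoid using (sum; sum-syntax)
  open import Algebra.Properties.Monoid.Mult +-monoid using () renaming (_×_ to _·_)

  Point : ℕ → Set c
  Point N = Fin N → Carrier

  infix 4 _≋_
  _≋_ : ∀ {N} → Point N → Point N → Set ℓ₁
  x ≋ y = ∀ i → x i ≈ y i

  fromℤ : ℤ → Carrier
  fromℤ (+ a)    = a · 1#
  fromℤ -[1+ a ] = - (suc a · 1#)

  combination : ∀ {N k} → (Fin k → Carrier) → (Fin k → Point N) → Point N
  combination {k = k} w p i = ∑[ a < k ] (w a * p a i)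

  ConvexHull : ∀ {N} {I : Set} → (I → Point N) → Pred (Point N) (c ⊔ ℓ₁ ⊔ ℓ₂)
  ConvexHull {I = I} v x =
    ∃[ k ] Σ[ a ∈ (Fin k → I) ] Σ[ w ∈ (Fin k → Carrier) ]
      (∀ i → 0# ≤ w i) × sum w ≈ 1# × x ≋ combination w (v ∘ a)

  AffineHull : ∀ {N k} → (Fin k → Point N) → Pred (Point N) (c ⊔ ℓ₁)
  AffineHull {k = k} p x =
    Σ[ w ∈ (Fin k → Carrier) ] sum w ≈ 1# × x ≋ combination w p

  AffinelyIndependent : ∀ {N k} → (Fin k → Point N) → Set (c ⊔ ℓ₁)
  AffinelyIndependent {k = k} p =
    (w : Fin k → Carrier) → sum w ≈ 0# → combination w p ≋ (λ _ → 0#) → ∀ i → w i ≈ 0#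

  -- The affine hull of P has an affine basis of d + 1 points of P.
  HasDimension : ∀ {N ℓ} → Pred (Point N) ℓ → ℕ → Set (c ⊔ ℓ₁ ⊔ ℓ)
  HasDimension {N} P d =
    Σ[ p ∈ (Fin (suc d) → Point N) ]
      (∀ i → P (p i)) × AffinelyIndependent p × (∀ x → P x → AffineHull p x)

  Dilate : ∀ {N ℓ} → ℕ → Pred (Point N) ℓ → Pred (Point N) (c ⊔ ℓ₁ ⊔ ℓ)
  Dilate j P x = ∃[ p ] P p × x ≋ (λ i → (j · 1#) * p i)

  LatticePoints : ∀ {N ℓ} → Pred (Point N) ℓ → Pred (Vec ℤ N) ℓ
  LatticePoints P x = P (λ i → fromℤ (Vec.lookup x i))

  HasCardinality : ∀ {a ℓ} {A : Set a} → Pred A ℓ → ℕ → Set (a ⊔ ℓ)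
  HasCardinality {A = A} Q k =
    Σ[ xs ∈ List A ] Unique xs × (∀ x → x ∈ xs ⇔ Q x) × length xs ≡ k

  open PowerSeries

  -- The defining identity Σⱼ |jP ∩ ℤᴺ| zʲ = h(z) / (1 - z)ᵈ⁺¹ with d = dim P,
  -- cleared of the denominator, which is invertible in ℤ[[z]].
  IsHStarPolynomial : ∀ {N ℓ} → Pred (Point N) ℓ → Series → Set (c ⊔ ℓ₁ ⊔ ℓ)
  IsHStarPolynomial P h =
    ∃[ d ] HasDimension P d ×
    Σ[ L ∈ (ℕ → ℕ) ] (∀ j → HasCardinality (LatticePoints (Dilate j P)) (L j)) ×
      (λ j → + L j) ⊛ (const 1ℤ ⊖ z) ^ suc d ≐ h

  δ : ∀ {N} → Fin N → Point N
  δ i j = if does (i ≟ j) then 1# else 0#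

  module _ {n m : ℕ} (G : Multigraph n m) where
    open Multigraph G

    data Generator : Set where
      node                  : Fin n → Generator
      edge tilde left right : Fin m → Generator

    -- Kⱽ × Kᴱ is Kⁿ⁺ᵐ with the node coordinates first.
    generator : Generator → Point (n ℕ.+ m)
    generator (node u)  = δ (u ↑ˡ m)
    generator (edge f)  = δ (n ↑ʳ f)
    generator (tilde f) i = let (u , v) = endpoints f in
      δ (u ↑ˡ m) i + δ (v ↑ˡ m) i - δ (n ↑ʳ f) i
    generator (left f)  i = let (u , v) = endpoints f in
      δ (u ↑ˡ m) i - δ (v ↑ˡ m) i + δ (n ↑ʳ f) i
    generator (right f) i = let (u , v) = endpoints f in
      - δ (u ↑ˡ m) i + δ (v ↑ˡ m) i + δ (n ↑ʳ f) i

    CosmologicalPolytope : Pred (Point (n ℕ.+ m)) (c ⊔ ℓ₁ ⊔ ℓ₂)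
    CosmologicalPolytope = ConvexHull generator

{-# OPTIONS --safe #-}
-- Fix the edge coordinates t of an integer point (y , t) of j C_G.  An edge f = uv
-- with |t_f| = k lets y vary along e_u - e_v over 2k + 1 values if t_f = k, and
-- forces a contribution k (e_u + e_v) if t_f = -k; the degree j drops by k.  That
-- every integer point arises in this way by integer steps follows from the
-- inequalities Σ_{w ∈ S} y_w + cut_S(t) ≥ 0, S ⊆ V: for fixed signs of t each is given
-- by a linear functional that is nonnegative on the generators, and when the edge f is
-- eliminated their submodularity makes all lower bounds on the integer step compatible
-- with all upper ones.
--
-- The points met on lines parallel to e_u - e_v form intervals, and their projections
-- along these lines are the points of the contraction G/f.  So thickening A by c steps
-- gives |A| + c |A/f| points, and summing over t_f yields
--   Ehr_G = (1 + z)/(1 - z) Ehr_{G - f} + 2z/(1 - z)² Ehr_{G/f}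
-- (only the first term for a loop), hence h*_G = (1 + z) h*_{G - f} + 2z h*_{G/f}.  The
-- sum over acyclic H satisfies the same recursion, by whether f ∈ H.
module Submission where

open import Defs
open import Algebra.Bundles using (CommutativeRing)
open import Data.Bool.Base using (_∨_; _∧_)
open import Data.Bool.Properties using () renaming (_≟_ to _≟ᵇ_)
open import Data.Empty using (⊥; ⊥-elim)
open import Data.Fin.Base as Fin using (Fin; punchIn; punchOut; splitAt; join; _↑ˡ_; _↑ʳ_)
open import Data.Fin.Properties using (_≟_; join-splitAt; punchOut-cong; punchOut-injective; suc-injective)
open import Data.Fin.Subset as Subset using (Subset; Side; inside; outside; _∪_; _∩_; ⁅_⁆; ∣_∣) renaming (⊤ to full; ⊥ to none)
open import Data.Fin.Subset.Properties using (drop-there; ∣p∣≤n)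
open import Data.Integer.Base as ℤ using (ℤ; 0ℤ; 1ℤ; -1ℤ; +_; -[1+_])
import Data.Integer.Properties as ℤ
open import Data.Integer.Tactic.RingSolver using (solve-∀)
open import Algebra.Properties.CommutativeSemigroup ℤ.+-commutativeSemigroup using () renaming (interchange to +-interchange)
open import Data.List.Base as List using (List; []; _∷_; filter)
import Data.List.Extrema ℤ.≤-totalOrder as Extrema
open import Data.List.Membership.Propositional using (_∈_)
open import Data.List.Membership.Propositional.Properties using (∈-map⁺; ∈-map⁻; ∈-++⁺ˡ; ∈-++⁺ʳ; ∈-++⁻; ∈-filter⁺; ∈-filter⁻)
open import Data.List.Membership.Propositional.Properties.WithK using (unique∧set⇒bag)
open import Data.List.Properties using (length-map; length-++; filter-++; filter-none; filter-all; ++-identityʳ)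
open import Data.List.Relation.Binary.BagAndSetEquality using (∼bag⇒↭)
open import Data.List.Relation.Binary.Permutation.Propositional.Properties using (↭-length)
open import Data.List.Relation.Unary.All as All using (All; []; _∷_)
open import Data.List.Relation.Unary.All.Properties using (¬Any⇒All¬) renaming (map⁺ to All-map⁺)
open import Data.List.Relation.Unary.AllPairs using ([]; _∷_)
open import Data.List.Relation.Unary.Any using (here; there)
open import Data.List.Relation.Unary.Unique.Propositional using (Unique)
open import Data.List.Relation.Unary.Unique.Propositional.Properties using (++⁺; filter⁺)
open import Data.Nat.Base as ℕ using (ℕ; zero; suc; z≤n; s≤s; NonZero; _∸_)
import Data.Nat.Properties as ℕ
open import Data.Product.Base using (Σ-syntax; ∃-syntax; ∃; _×_; _,_; proj₁; proj₂)
import Data.Product.Properties as Product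
open import Data.Sum.Base using (_⊎_; inj₁; inj₂; [_,_]′)
open import Data.Vec.Base as Vec using (Vec; []; _∷_; lookup; replicate; insertAt; removeAt; _++_)
open import Data.Vec.Properties as Vec using (lookup-replicate; lookup-zipWith; lookup-++ˡ; lookup-++ʳ; lookup-map; lookup∘updateAt; lookup∘updateAt′; updateAt-updateAt-local; updateAt-commutes; updateAt-id-local; insertAt-lookup; insertAt-punchIn; removeAt-insertAt; insertAt-removeAt; removeAt-punchOut)
open import Function.Base using (_∘_)
open import Function.Bundles using (_⇔_; mk⇔; Equivalence)
open import Level using (Level; 0ℓ)
open import Relation.Binary.Definitions using (DecidableEquality)
open import Relation.Binary.PropositionalEquality as ≡ using (_≡_; _≢_; cong; cong₂; subst; subst₂)
open import Relation.Binary.Structures using (IsTotalOrder)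
open import Relation.Nullary.Decidable using (Dec; yes; no; map′; ¬?; _×-dec_)
open import Relation.Nullary.Negation using (¬_; contradiction)
open import Relation.Unary using (Pred; Decidable)

-- The integer points of a dilate are described in four ways, since no single description shows
-- everything: the polytope gives the statement, the inequalities `CutInequalities` show convexity
-- along lines, the recursion `InDilate` over the edges shows the count and its behaviour under
-- contraction, and `Generated` (sums of generators) leads back to the polytope. The implications
-- form a circle, so each is needed in one direction only.
--
-- Convexity is the obstacle: it is hidden in `InDilate`, where the integer steps of different edges
-- interact. The count along lines therefore borrows it from the inequalities.
--
-- A contraction leaves the edge coordinates alone and adds up two node coordinates. All edge moves
-- commute with this, so only the edgeless case of the comparison has content.
--
-- The numerators arise as follows. The two values t_f = k and t_f = -k give 2 copies of the points
-- of G - f when k > 0 and 1 when k = 0; the 2k extra steps for t_f = k give 2k copies of the points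
-- of G/f. The denominators fit because |V| + |E| drops by one under deletion and by two under
-- contraction.

-- The commutative ring of formal power series.

module SeriesAlgebra where
  open PowerSeries
  open ≡ using (refl; sym; trans; module ≡-Reasoning)
  open ≡-Reasoning

  tail : Series → Series
  tail a k = a (suc k)

  infixr 7 _⊙_
  _⊙_ : ℤ → Series → Series
  (c ⊙ a) k = c ℤ.* a k

  ⊛-cong : ∀ {a b c d} → a ≐ b → c ≐ d → a ⊛ c ≐ b ⊛ d
  ⊛-cong a≐b c≐d zero    = cong (ℤ._+ 0ℤ) (cong₂ ℤ._*_ (a≐b 0) (c≐d 0))
  ⊛-cong a≐b c≐d (suc k) = cong₂ ℤ._+_ (cong₂ ℤ._*_ (a≐b 0) (c≐d (suc k)))
                                       (⊛-cong (λ i → a≐b (suc i)) c≐d k)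

  ⊛-distribʳ : ∀ a b c → (a ⊕ b) ⊛ c ≐ a ⊛ c ⊕ b ⊛ c
  ⊛-distribʳ a b c zero    = lemma (a 0) (b 0) (c 0)
    where
    lemma : ∀ x y w → (x ℤ.+ y) ℤ.* w ℤ.+ 0ℤ ≡ (x ℤ.* w ℤ.+ 0ℤ) ℤ.+ (y ℤ.* w ℤ.+ 0ℤ)
    lemma = solve-∀
  ⊛-distribʳ a b c (suc k) =
    trans (cong (ℤ._+_ ((a 0 ℤ.+ b 0) ℤ.* c (suc k))) (⊛-distribʳ (tail a) (tail b) c k))
          (lemma (a 0) (b 0) (c (suc k)) ((tail a ⊛ c) k) ((tail b ⊛ c) k))
    where
    lemma : ∀ x y w p q → (x ℤ.+ y) ℤ.* w ℤ.+ (p ℤ.+ q) ≡ (x ℤ.* w ℤ.+ p) ℤ.+ (y ℤ.* w ℤ.+ q)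
    lemma = solve-∀

  ⊙-⊛ : ∀ x a b → (x ⊙ a) ⊛ b ≐ x ⊙ (a ⊛ b)
  ⊙-⊛ x a b zero    = lemma x (a 0) (b 0)
    where
    lemma : ∀ x y w → (x ℤ.* y) ℤ.* w ℤ.+ 0ℤ ≡ x ℤ.* (y ℤ.* w ℤ.+ 0ℤ)
    lemma = solve-∀
  ⊙-⊛ x a b (suc k) =
    trans (cong (ℤ._+_ ((x ℤ.* a 0) ℤ.* b (suc k))) (⊙-⊛ x (tail a) b k))
          (lemma x (a 0) (b (suc k)) ((tail a ⊛ b) k))
    where
    lemma : ∀ x y w p → (x ℤ.* y) ℤ.* w ℤ.+ x ℤ.* p ≡ x ℤ.* (y ℤ.* w ℤ.+ p)
    lemma = solve-∀

  -- The product unfolds along its left factor only. Swapping at `suc k` and then at `k` peels both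
  -- factors, which leaves a symmetric expression; hence the two base cases.
  ⊛-comm : ∀ a b → a ⊛ b ≐ b ⊛ a
  ⊛-comm a b zero          = cong (ℤ._+ 0ℤ) (ℤ.*-comm (a 0) (b 0))
  ⊛-comm a b (suc zero)    = lemma (a 0) (a 1) (b 0) (b 1)
    where
    lemma : ∀ x x₁ y y₁ → x ℤ.* y₁ ℤ.+ (x₁ ℤ.* y ℤ.+ 0ℤ) ≡ y ℤ.* x₁ ℤ.+ (y₁ ℤ.* x ℤ.+ 0ℤ)
    lemma = solve-∀
  ⊛-comm a b (suc (suc k)) = begin
    a 0 ℤ.* b (2 ℕ.+ k) ℤ.+ (tail a ⊛ b) (suc k)
      ≡⟨ cong (ℤ._+_ (a 0 ℤ.* b (2 ℕ.+ k))) (⊛-comm (tail a) b (suc k)) ⟩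
    a 0 ℤ.* b (2 ℕ.+ k) ℤ.+ (b 0 ℤ.* a (2 ℕ.+ k) ℤ.+ (tail b ⊛ tail a) k)
      ≡⟨ cong (λ s → a 0 ℤ.* b (2 ℕ.+ k) ℤ.+ (b 0 ℤ.* a (2 ℕ.+ k) ℤ.+ s)) (⊛-comm (tail b) (tail a) k) ⟩
    a 0 ℤ.* b (2 ℕ.+ k) ℤ.+ (b 0 ℤ.* a (2 ℕ.+ k) ℤ.+ (tail a ⊛ tail b) k)
      ≡⟨ lemma (a 0 ℤ.* b (2 ℕ.+ k)) (b 0 ℤ.* a (2 ℕ.+ k)) _ ⟩
    b 0 ℤ.* a (2 ℕ.+ k) ℤ.+ (a ⊛ tail b) (suc k)
      ≡⟨ cong (ℤ._+_ (b 0 ℤ.* a (2 ℕ.+ k))) (⊛-comm a (tail b) (suc k)) ⟩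
    (b ⊛ a) (2 ℕ.+ k) ∎
    where
    lemma : ∀ x y p → x ℤ.+ (y ℤ.+ p) ≡ y ℤ.+ (x ℤ.+ p)
    lemma = solve-∀

  -- `tail (a ⊛ b)` computes to `a 0 ⊙ tail b ⊕ tail a ⊛ b`, so distributivity and the case of
  -- `tail a` give the induction step.
  ⊛-assoc : ∀ a b c → (a ⊛ b) ⊛ c ≐ a ⊛ (b ⊛ c)
  ⊛-assoc a b c zero    = lemma (a 0) (b 0) (c 0)
    where
    lemma : ∀ x y w → (x ℤ.* y ℤ.+ 0ℤ) ℤ.* w ℤ.+ 0ℤ ≡ x ℤ.* (y ℤ.* w ℤ.+ 0ℤ) ℤ.+ 0ℤ
    lemma = solve-∀
  ⊛-assoc a b c (suc k) = begin
    (a 0 ℤ.* b 0 ℤ.+ 0ℤ) ℤ.* c (suc k) ℤ.+ ((a 0 ⊙ tail b ⊕ tail a ⊛ b) ⊛ c) k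
      ≡⟨ cong (ℤ._+_ ((a 0 ℤ.* b 0 ℤ.+ 0ℤ) ℤ.* c (suc k)))
           (trans (⊛-distribʳ (a 0 ⊙ tail b) (tail a ⊛ b) c k)
                  (cong₂ ℤ._+_ (⊙-⊛ (a 0) (tail b) c k) (⊛-assoc (tail a) b c k))) ⟩
    (a 0 ℤ.* b 0 ℤ.+ 0ℤ) ℤ.* c (suc k) ℤ.+ (a 0 ℤ.* (tail b ⊛ c) k ℤ.+ (tail a ⊛ (b ⊛ c)) k)
      ≡⟨ lemma (a 0) (b 0) (c (suc k)) ((tail b ⊛ c) k) _ ⟩
    a 0 ℤ.* (b 0 ℤ.* c (suc k) ℤ.+ (tail b ⊛ c) k) ℤ.+ (tail a ⊛ (b ⊛ c)) k ∎
    where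
    lemma : ∀ x y w p q → (x ℤ.* y ℤ.+ 0ℤ) ℤ.* w ℤ.+ (x ℤ.* p ℤ.+ q) ≡ x ℤ.* (y ℤ.* w ℤ.+ p) ℤ.+ q
    lemma = solve-∀

  ⊛-zeroˡ : ∀ a → const 0ℤ ⊛ a ≐ const 0ℤ
  ⊛-zeroˡ a zero    = refl
  ⊛-zeroˡ a (suc k) = trans (ℤ.+-identityˡ _) (trans (⊛-cong {d = a} tail-0 (λ _ → refl) k)
                      (trans (⊛-zeroˡ a k) (tail-0⁻ k)))
    where
    tail-0 : tail (const 0ℤ) ≐ const 0ℤ
    tail-0 zero    = refl
    tail-0 (suc _) = refl
    tail-0⁻ : const 0ℤ ≐ tail (const 0ℤ)
    tail-0⁻ zero    = refl
    tail-0⁻ (suc _) = refl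

  const-⊛ : ∀ x a → const x ⊛ a ≐ x ⊙ a
  const-⊛ x a zero    = ℤ.+-identityʳ _
  const-⊛ x a (suc k) = trans (cong (ℤ._+_ (x ℤ.* a (suc k)))
    (trans (⊛-cong {d = a} tail-const (λ _ → refl) k) (trans (⊛-zeroˡ a k) (const-0 k)))) (ℤ.+-identityʳ _)
    where
    tail-const : tail (const x) ≐ const 0ℤ
    tail-const zero    = refl
    tail-const (suc _) = refl
    const-0 : const 0ℤ ≐ λ _ → 0ℤ
    const-0 zero    = refl
    const-0 (suc _) = refl

  seriesCommutativeRing : CommutativeRing 0ℓ 0ℓ
  seriesCommutativeRing = record
    { Carrier = Series
    ; _≈_ = _≐_
    ; _+_ = _⊕_
    ; _*_ = _⊛_
    ; -_  = λ a k → ℤ.- a k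
    -- Not `const 0ℤ`, which is stuck on a variable index: with the constant function the additive
    -- laws are those of ℤ at each coefficient.
    ; 0#  = λ _ → 0ℤ
    ; 1#  = const 1ℤ
    ; isCommutativeRing = record
      { isRing = record
        { +-isAbelianGroup = record
          { isGroup = record
            { isMonoid = record
              { isSemigroup = record
                { isMagma = record
                  { isEquivalence = record
                    { refl  = λ _ → refl
                    ; sym   = λ p k → sym (p k)
                    ; trans = λ p q k → trans (p k) (q k) }
                  ; ∙-cong = λ p q k → cong₂ ℤ._+_ (p k) (q k) }
                ; assoc = λ a b c k → ℤ.+-assoc (a k) (b k) (c k) }
              ; identity = (λ a k → ℤ.+-identityˡ (a k)) , (λ a k → ℤ.+-identityʳ (a k)) }
            ; inverse = (λ a k → ℤ.+-inverseˡ (a k)) , (λ a k → ℤ.+-inverseʳ (a k))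
            ; ⁻¹-cong = λ p k → cong ℤ.-_ (p k) }
          ; comm = λ a b k → ℤ.+-comm (a k) (b k) }
        ; *-cong = ⊛-cong
        ; *-assoc = ⊛-assoc
        ; *-identity = ⊛-identityˡ , (λ a k → trans (⊛-comm a (const 1ℤ) k) (⊛-identityˡ a k))
        ; distrib = (λ a b c k → trans (⊛-comm a (b ⊕ c) k)
                      (trans (⊛-distribʳ b c a k) (cong₂ ℤ._+_ (⊛-comm b a k) (⊛-comm c a k))))
                  , (λ a b c → ⊛-distribʳ b c a) }
      ; *-comm = ⊛-comm } }
    where
    ⊛-identityˡ : ∀ a → const 1ℤ ⊛ a ≐ a
    ⊛-identityˡ a k = trans (const-⊛ 1ℤ a k) (ℤ.*-identityˡ (a k))

-- The recursion follows the unfolding of `⊛`, so that a sum over k + l = j turns into a product of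
-- series by a plain induction.
antidiagonalSum : (ℕ → ℕ → ℕ) → ℕ → ℕ
antidiagonalSum c zero    = c 0 0
antidiagonalSum c (suc j) = c 0 (suc j) ℕ.+ antidiagonalSum (c ∘ suc) j

-- Counting finite sets.

module Cardinality {c ℓ₁ ℓ₂} (K : OrderedField c ℓ₁ ℓ₂) where
  open Polytopes K using (HasCardinality)
  open ≡ using (refl; sym; trans)
  open Equivalence using (to; from)

  private
    variable
      a b p q : Level
      A : Set a
      B : Set b

  card-cong : ∀ {P : Pred A p} {Q : Pred A q} {k} → (∀ x → P x → Q x) → (∀ x → Q x → P x) →
              HasCardinality P k → HasCardinality Q k
  card-cong f g (xs , uniq , mem , len) =
    xs , uniq , (λ x → mk⇔ (f x ∘ to (mem x)) (from (mem x) ∘ g x)) , len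

  card-∅ : ∀ {P : Pred A p} → (∀ x → ¬ P x) → HasCardinality P 0
  card-∅ ¬p = [] , [] , (λ x → mk⇔ (λ ()) (⊥-elim ∘ ¬p x)) , refl

  card-singleton : (x : A) → HasCardinality (_≡ x) 1
  card-singleton x = x ∷ [] , [] ∷ [] , (λ y → mk⇔ (λ { (here e) → e ; (there ()) }) here) , refl

  card-⊎ : ∀ {P : Pred A p} {Q : Pred A q} {k l} → (∀ x → P x → Q x → ⊥) →
           HasCardinality P k → HasCardinality Q l → HasCardinality (λ x → P x ⊎ Q x) (k ℕ.+ l)
  card-⊎ disj (xs , ux , mx , lx) (ys , uy , my , ly) =
    xs List.++ ys , ++⁺ ux uy (λ { (i , j) → disj _ (to (mx _) i) (to (my _) j) }) ,
    (λ x → mk⇔ ([ inj₁ ∘ to (mx x) , inj₂ ∘ to (my x) ]′ ∘ ∈-++⁻ xs)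
               [ ∈-++⁺ˡ ∘ from (mx x) , ∈-++⁺ʳ xs ∘ from (my x) ]′) ,
    trans (length-++ xs) (cong₂ ℕ._+_ lx ly)

  -- Duplicate-free lists with the same members are permutations of each other.
  card-unique : ∀ {P : Pred A p} {k l} → HasCardinality P k → HasCardinality P l → k ≡ l
  card-unique (xs , ux , mx , refl) (ys , uy , my , refl) = ↭-length (∼bag⇒↭ (unique∧set⇒bag ux uy λ {x} →
    mk⇔ (from (my x) ∘ to (mx x)) (from (mx x) ∘ to (my x))))

  -- Injectivity is asked on `P` only: the projection along lines, to which this is applied, is
  -- injective merely on the top points.
  card-image : ∀ {P : Pred A p} {Q : Pred B q} {k} (f : A → B) →
                           (∀ {x y} → P x → P y → f x ≡ f y → x ≡ y) →
                           (∀ x → P x → Q (f x)) → (∀ y → Q y → ∃[ x ] P x × y ≡ f x) →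
                           HasCardinality P k → HasCardinality Q k
  card-image {A = A} {P = P} {Q = Q} f inj f⁺ f⁻ (xs , u , m , l) =
    List.map f xs , unique-map u (λ {x} → to (m x)) ,
    (λ y → mk⇔ (λ i → let (x , x∈ , e) = ∈-map⁻ f i in subst Q (sym e) (f⁺ x (to (m x) x∈)))
               (λ qy → let (x , px , e) = f⁻ y qy in subst (_∈ List.map f xs) (sym e) (∈-map⁺ f (from (m x) px)))) ,
    trans (length-map f xs) l
    where
    unique-map : ∀ {xs} → Unique xs → (∀ {x} → x ∈ xs → P x) → Unique (List.map f xs)
    unique-map []       _   = []
    unique-map (x∉ ∷ u) all =
      All.tabulate (λ i e → let (y , y∈ , e′) = ∈-map⁻ f i in
        All.lookup x∉ y∈ (inj (all (here refl)) (all (there y∈)) (trans e e′)))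
      ∷ unique-map u (all ∘ there)

  membership? : ∀ {P : Pred A p} {k} → DecidableEquality A → HasCardinality P k → Decidable P
  membership? _≟_ (xs , _ , m , _) x = map′ (to (m x)) (from (m x)) (x ∈? xs)
    where open import Data.List.Membership.DecPropositional _≟_ using (_∈?_)

  card-filter : ∀ {P : Pred A p} {Q : Pred A q} {k} → Decidable Q → HasCardinality P k →
                ∃[ l ] HasCardinality (λ x → P x × Q x) l
  card-filter Q? (xs , u , m , _) =
    _ , filter Q? xs , filter⁺ Q? u ,
    (λ x → mk⇔ (λ i → let (x∈ , qx) = ∈-filter⁻ Q? i in to (m x) x∈ , qx)
               (λ { (px , qx) → ∈-filter⁺ Q? (from (m x) px) qx })) , refl

  -- Disjointness in the first index suffices, because `k + l = j` determines the second.
  card-antidiagonal : ∀ {Q : ℕ → ℕ → Pred A q} {c : ℕ → ℕ → ℕ} →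
    (∀ {k l k′ l′} x → Q k l x → Q k′ l′ x → k ≡ k′) → (∀ k l → HasCardinality (Q k l) (c k l)) →
    ∀ j → HasCardinality (λ x → ∃[ k ] ∃[ l ] k ℕ.+ l ≡ j × Q k l x) (antidiagonalSum c j)
  card-antidiagonal disj card zero = card-cong
    (λ x h → 0 , 0 , refl , h) (λ { x (zero , zero , refl , h) → h }) (card 0 0)
  card-antidiagonal disj card (suc j) = card-cong
    (λ { x (inj₁ h) → 0 , suc j , refl , h ; x (inj₂ (k , l , e , h)) → suc k , l , cong suc e , h })
    (λ { x (zero , l , refl , h) → inj₁ h ; x (suc k , l , e , h) → inj₂ (k , l , ℕ.suc-injective e , h) })
    (card-⊎ (λ { x h (k , l , _ , h′) → contradiction (disj x h h′) λ () }) (card 0 (suc j))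
      (card-antidiagonal (λ x h h′ → ℕ.suc-injective (disj x h h′)) (λ k l → card (suc k) l) j))

-- Thickening a finite set along the lines of a ℤ-action.

module Lines {c ℓ₁ ℓ₂} (K : OrderedField c ℓ₁ ℓ₂) {X Y : Set}
  (_≟X_ : DecidableEquality X) (_≟Y_ : DecidableEquality Y)
  -- The lines are the orbits of `shift`, which are the fibres of `project`; `height` is a
  -- coordinate on each line and makes the action free.
  (shift : ℤ → X → X) (project : X → Y) (height : X → ℤ)
  (shift-0 : ∀ x → shift 0ℤ x ≡ x)
  (shift-+ : ∀ a b x → shift a (shift b x) ≡ shift (a ℤ.+ b) x)
  (height-shift : ∀ a x → height (shift a x) ≡ height x ℤ.+ a)
  (project-shift : ∀ a x → project (shift a x) ≡ project x)
  (same-line : ∀ x y → project x ≡ project y → ∃[ a ] y ≡ shift a x)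
  where
  open Polytopes K using (HasCardinality)
  open ≡ using (refl; sym; trans; module ≡-Reasoning)
  open Equivalence using (to; from)
  open Cardinality K

  -- A + {0, d, …, k d}, where shift a translates by a d.
  Thicken : ℕ → Pred X 0ℓ → Pred X 0ℓ
  Thicken k A x = ∃[ i ] i ℕ.≤ k × A (shift (ℤ.- + i) x)

  LineConvex : Pred X 0ℓ → Set
  LineConvex A = ∀ {x} {i k} → i ℕ.≤ k → A x → A (shift (+ k) x) → A (shift (+ i) x)

  Top : Pred X 0ℓ → Pred X 0ℓ
  Top A x = A x × ¬ A (shift 1ℤ x)

  shift-inverse : ∀ a x → shift (ℤ.- a) (shift a x) ≡ x
  shift-inverse a x = trans (shift-+ (ℤ.- a) a x) (trans (cong (λ b → shift b x) (ℤ.+-inverseˡ a)) (shift-0 x))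

  shift-inverse′ : ∀ a x → shift a (shift (ℤ.- a) x) ≡ x
  shift-inverse′ a x = trans (shift-+ a (ℤ.- a) x) (trans (cong (λ b → shift b x) (ℤ.+-inverseʳ a)) (shift-0 x))

  shift-injective : ∀ a {x y} → shift a x ≡ shift a y → x ≡ y
  shift-injective a {x} {y} e =
    trans (sym (shift-inverse a x)) (trans (cong (shift (ℤ.- a)) e) (shift-inverse a y))

  module _ {A : Pred X 0ℓ} {a : ℕ} (cardA : HasCardinality A a) (convex : LineConvex A) where

    -- Convexity would put the next point, `shift 1ℤ x`, between the two and hence into `A`.
    top-maximal : ∀ {x} i → Top A x → ¬ A (shift (+ suc i) x)
    top-maximal i (ax , top) a′ = top (convex (s≤s z≤n) ax a′)

    module _ {B : Pred Y 0ℓ} {b : ℕ} (cardB : HasCardinality B b)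
             (lift : ∀ y → B y → ∃[ x ] A x × project x ≡ y)
             (B-project : ∀ x → A x → B (project x)) where

      private
        exists-top : ∀ y → B y → ∃[ x ] Top A x × y ≡ project x
        exists-top y by =
          let (x , ax , e) = lift y by
              xs = filter (λ x → project x ≟Y y) (proj₁ cardA)
              mem = proj₁ (proj₂ (proj₂ cardA))
              x∈ : ∀ {x} → A x → project x ≡ y → x ∈ xs
              x∈ = λ {x} ax e → ∈-filter⁺ (λ x → project x ≟Y y) (from (mem x) ax) e
              -- The default `x` lies in `A` and on the line over `y`, so the maximum belongs to
              -- `xs` even when it is the default.
              m = Extrema.argmax height x xs
              m∈ : m ∈ xs
              m∈ = [ (λ e′ → subst (_∈ xs) (sym e′) (x∈ ax e)) , (λ i → i) ]′ (Extrema.argmax-sel height x xs)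
              (m∈A , em) = ∈-filter⁻ (λ x → project x ≟Y y) m∈
              higher : height m ℤ.< height (shift 1ℤ m)
              higher = subst₂ ℤ._<_ (ℤ.+-identityʳ (height m)) (sym (height-shift 1ℤ m))
                         (ℤ.+-monoʳ-< (height m) (ℤ.+<+ (s≤s z≤n)))
          in m , (to (mem m) m∈A , λ a′ → ℤ.<⇒≱ higher
                     (All.lookup (Extrema.f[xs]≤f[argmax] {f = height} x xs) (x∈ a′ (trans (project-shift 1ℤ m) em))))
             , sym em

        -- Two tops on one line differ by a shift, and if it is not zero then the higher one
        -- contradicts `top-maximal` for the lower.
        top-unique : ∀ {x y} → Top A x → Top A y → project x ≡ project y → x ≡ y
        top-unique {x} {y} tx ty e with same-line x y e
        ... | + zero   , refl = sym (shift-0 x)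
        ... | + suc i  , refl = contradiction (proj₁ ty) (top-maximal i tx)
        ... | -[1+ i ] , refl = contradiction (subst A (sym (shift-inverse′ (+ suc i) x)) (proj₁ tx)) (top-maximal i ty)

        -- Filtering `A` shows only that the tops are finite in number. As `project` is a bijection
        -- from the tops to `B`, this number is `b`.
        card-top : HasCardinality (Top A) b
        card-top =
          let (t , card) = card-filter (λ x → ¬? (membership? _≟X_ cardA (shift 1ℤ x))) cardA
              card′ = card-image project top-unique (λ x → B-project x ∘ proj₁) exists-top card
          in subst (HasCardinality (Top A)) (card-unique card′ cardB) card

        card-shifted-top : ∀ k → HasCardinality (λ x → Top A (shift (ℤ.- + k) x)) b
        card-shifted-top k = card-image (shift (+ k)) (λ _ _ → shift-injective (+ k))
          (λ x → subst (Top A) (sym (shift-inverse (+ k) x)))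
          (λ x t → shift (ℤ.- + k) x , t , sym (shift-inverse′ (+ k) x)) card-top

        shift-difference : ∀ {i k} x → i ℕ.≤ k → shift (+ (k ℕ.∸ i)) (shift (ℤ.- + k) x) ≡ shift (ℤ.- + i) x
        shift-difference {i} {k} x i≤k = trans (shift-+ _ _ x) (cong (λ a → shift a x) (begin
          + (k ℕ.∸ i) ℤ.- + k               ≡⟨ cong (λ l → + (k ℕ.∸ i) ℤ.- + l) (ℕ.m∸n+n≡m i≤k) ⟨
          + (k ℕ.∸ i) ℤ.- + (k ℕ.∸ i ℕ.+ i) ≡⟨ cong (λ s → + (k ℕ.∸ i) ℤ.- s) (ℤ.pos-+ (k ℕ.∸ i) i) ⟩
          + (k ℕ.∸ i) ℤ.- (+ (k ℕ.∸ i) ℤ.+ + i) ≡⟨ cancel (+ (k ℕ.∸ i)) (+ i) ⟩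
          ℤ.- + i ∎))
          where
          open ≡-Reasoning
          cancel : ∀ x y → x ℤ.- (x ℤ.+ y) ≡ ℤ.- y
          cancel = solve-∀

      -- Each of the b lines that meet A gains k points beyond its top.
      card-thicken : ∀ k → HasCardinality (Thicken k A) (a ℕ.+ k ℕ.* b)
      card-thicken zero = subst (HasCardinality _) (sym (ℕ.+-identityʳ a)) (card-cong
        (λ x ax → 0 , z≤n , subst A (sym (shift-0 x)) ax)
        (λ { x (zero , _ , ax) → subst A (shift-0 x) ax }) cardA)
      card-thicken (suc k) = subst (HasCardinality _)
        (trans (ℕ.+-assoc a (k ℕ.* b) b) (cong (a ℕ.+_) (ℕ.+-comm (k ℕ.* b) b)))
        (card-cong grow split (card-⊎ disjoint (card-thicken k) (card-shifted-top (suc k))))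
        where
        -- The point of `A` that puts `x` into `Thicken k A` lies `suc (k - i)` steps above the
        -- alleged top on the same line.
        disjoint : ∀ x → Thicken k A x → Top A (shift (ℤ.- + suc k) x) → _
        disjoint x (i , i≤k , ax) top = top-maximal (k ℕ.∸ i) top
          (subst A (trans (sym (shift-difference x (ℕ.m≤n⇒m≤1+n i≤k)))
                          (cong (λ l → shift (+ l) (shift (ℤ.- + suc k) x)) (ℕ.+-∸-assoc 1 i≤k))) ax)
        grow : ∀ x → Thicken k A x ⊎ Top A (shift (ℤ.- + suc k) x) → Thicken (suc k) A x
        grow x (inj₁ (i , i≤k , ax)) = i , ℕ.m≤n⇒m≤1+n i≤k , ax
        grow x (inj₂ (ax , _))       = suc k , ℕ.≤-refl , ax
        split : ∀ x → Thicken (suc k) A x → Thicken k A x ⊎ Top A (shift (ℤ.- + suc k) x)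
        split x (i , i≤1+k , ax) with ℕ.m≤n⇒m<n∨m≡n i≤1+k
        ... | inj₁ (s≤s i≤k) = inj₁ (i , i≤k , ax)
        ... | inj₂ refl with membership? _≟X_ cardA (shift 1ℤ (shift (ℤ.- + suc k) x))
        ...   | no ¬a = inj₂ (ax , ¬a)
        -- If the point `suc k` steps below `x` is not a top, then its successor, `k` steps below
        -- `x`, is in `A` too.
        ...   | yes a′ = inj₁ (k , ℕ.≤-refl , subst A
                  (trans (cong (λ l → shift (+ l) (shift (ℤ.- + suc k) x)) (sym (ℕ.m+n∸n≡m 1 k))) (shift-difference x (ℕ.n≤1+n k))) a′)

-- Acyclic edge sets under deletion and contraction.

module GraphContraction where
  open ≡ using (refl; sym; trans)
  open Multigraph
  open Cycles using (Acyclic; IsCycle; IsWalk; Joins; Step)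

  module Walks {n m : ℕ} (G : Multigraph n m) where

    data Reach (P : Fin m → Set) : Fin n → Fin n → Set where
      stop : ∀ {u} → Reach P u u
      step : ∀ {u v w f} → P f → Joins G f u v → Reach P v w → Reach P u w

    append : ∀ {P u v w} → Reach P u v → Reach P v w → Reach P u w
    append stop          r = r
    append (step p j r′) r = step p j (append r′ r)

    -- Cycles, closed trails and redundant edges exist together.  A closed trail
    -- stays one when edges are contracted; a redundant edge stays one when a
    -- contraction is undone.
    ClosedTrail : Subset m → Set
    ClosedTrail H = ∃[ u ] ∃[ s ] s ≢ [] × IsWalk G H u s u × Unique (List.map proj₁ s)

    Redundant : Subset m → Fin m → Set
    Redundant H f = f Subset.∈ H ×
      Reach (λ g → g Subset.∈ H × g ≢ f) (proj₁ (endpoints G f)) (proj₂ (endpoints G f))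

    joins-sym : ∀ {f u v} → Joins G f u v → Joins G f v u
    joins-sym (inj₁ e) = inj₂ e
    joins-sym (inj₂ e) = inj₁ e

    reverse : ∀ {P u v} → Reach P u v → Reach P v u
    reverse stop         = stop
    reverse (step p j r) = append (reverse r) (step p (joins-sym j) stop)

    -- The first edge is redundant: the rest of the trail joins its endpoints and, the edges being
    -- distinct, avoids it.
    closedTrail⇒redundant : ∀ {H} → ClosedTrail H → ∃ (Redundant H)
    closedTrail⇒redundant (u , [] , ne , _) = contradiction refl ne
    closedTrail⇒redundant {H} (u , (f , v) ∷ s , _ , (f∈ , j , walk) , f∉ ∷ _) =
      f , f∈ , orient j (reach s walk f∉)
      where
      reach : ∀ {v w} s → IsWalk G H v s w → All (f ≢_) (List.map proj₁ s) →
              Reach (λ g → g Subset.∈ H × g ≢ f) v w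
      reach []      refl           _        = stop
      reach (_ ∷ s) (g∈ , j , walk) (ne ∷ nes) = step (g∈ , ne ∘ sym) j (reach s walk nes)
      orient : ∀ {P u v} → Joins G f u v → Reach P v u → Reach P (proj₁ (endpoints G f)) (proj₂ (endpoints G f))
      orient (inj₁ refl) r = reverse r
      orient (inj₂ refl) r = r

    record Path (H : Subset m) (P : Fin m → Set) (u w : Fin n) : Set where
      constructor path
      field
        steps        : List (Step G)
        walk         : IsWalk G H u steps w
        edges        : All P (List.map proj₁ steps)
        nodes-unique : Unique (u ∷ List.map proj₂ steps)
        edges-unique : Unique (List.map proj₁ steps)

    private
      open import Data.List.Membership.DecPropositional (_≟_ {n}) using (_∈?_)

      suffix : ∀ {H P u w x} → (p : Path H P u w) → x ∈ u ∷ List.map proj₂ (Path.steps p) → Path H P x w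
      suffix p (here refl) = p
      suffix (path [] _ _ _ _) (there ())
      suffix (path (_ ∷ s) (_ , _ , walk) (_ ∷ es) (_ ∷ un) (_ ∷ ue)) (there i) =
        suffix (path s walk es un ue) i

      -- For `loopErase`: a path that has not visited `u` cannot have used an edge at `u`, so
      -- extending it at a new node keeps the edges distinct.
      endpoint-visited : ∀ {H f a b v w} s → Joins G f a b → IsWalk G H v s w →
                         f ∈ List.map proj₁ s → a ∈ v ∷ List.map proj₂ s
      endpoint-visited (_ ∷ _) (inj₁ refl) (_ , inj₁ refl , _) (here refl) = here refl
      endpoint-visited (_ ∷ _) (inj₁ refl) (_ , inj₂ refl , _) (here refl) = there (here refl)
      endpoint-visited (_ ∷ _) (inj₂ refl) (_ , inj₁ refl , _) (here refl) = there (here refl)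
      endpoint-visited (_ ∷ _) (inj₂ refl) (_ , inj₂ refl , _) (here refl) = here refl
      endpoint-visited (_ ∷ s) j (_ , _ , walk) (there i) = there (endpoint-visited s j walk i)

    -- Built from the far end: if `u` is already visited, the path is cut back to that visit,
    -- otherwise it is extended by the step.
    loopErase : ∀ {H P u w} → Reach (λ g → g Subset.∈ H × P g) u w → Path H P u w
    loopErase stop = path [] refl [] ([] ∷ []) []
    loopErase (step {u} {v} {f = f} (f∈ , pf) j r) with loopErase r
    ... | p@(path s walk es un ue) with u ∈? (v ∷ List.map proj₂ s)
    ...   | yes i = suffix p i
    ...   | no ¬i = path ((f , v) ∷ s) (f∈ , j , walk) (pf ∷ es) (¬Any⇒All¬ _ ¬i ∷ un)
                         (¬Any⇒All¬ _ (¬i ∘ endpoint-visited s j walk) ∷ ue)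

    redundant⇒cycle : ∀ {H f} → Redundant H f → ∃[ u ] ∃[ s ] IsCycle G H u s
    redundant⇒cycle {f = f} (f∈ , r) with loopErase r
    ... | path s walk es un ue =
      -- The cycle starts at the second endpoint of `f`. The nodes it arrives at are then exactly
      -- the nodes of the path, each once.
      _ , (f , _) ∷ s , (λ ()) , (f∈ , inj₂ refl , walk) , All.map (_∘ sym) es ∷ ue , un

    closedTrail⇒cycle : ∀ {H} → ClosedTrail H → ∃[ u ] ∃[ s ] IsCycle G H u s
    closedTrail⇒cycle t = redundant⇒cycle (proj₂ (closedTrail⇒redundant t))

    cycle⇒closedTrail : ∀ {H} → ∃[ u ] ∃[ s ] IsCycle G H u s → ClosedTrail H
    cycle⇒closedTrail (u , s , ne , walk , ue , _) = u , s , ne , walk , ue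

  deleteFirst : ∀ {n m} → Multigraph n (suc m) → Multigraph n m
  endpoints (deleteFirst G) f = endpoints G (Fin.suc f)

  mapNodes : ∀ {n n′ m} → (Fin n → Fin n′) → Multigraph n m → Multigraph n′ m
  endpoints (mapNodes φ G) f = φ (proj₁ (endpoints G f)) , φ (proj₂ (endpoints G f))

  -- The quotient map that identifies `v` with `u`, with `v` removed from the node set. `ℕ.pred`
  -- allows the type for every `n`; that `n` is a successor follows from the presence of a node.
  merge : ∀ {n} {u v : Fin n} → u ≢ v → Fin n → Fin (ℕ.pred n)
  merge {suc n} {u} {v} u≢v w with v ≟ w
  ... | yes _  = punchOut (u≢v ∘ sym)
  ... | no v≢w = punchOut v≢w

  merge-kernel : ∀ {n} {u v : Fin n} (u≢v : u ≢ v) {x y} → merge u≢v x ≡ merge u≢v y →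
                 x ≡ y ⊎ (x ≡ u × y ≡ v) ⊎ (x ≡ v × y ≡ u)
  merge-kernel {suc n} {u} {v} u≢v {x} {y} e with v ≟ x | v ≟ y
  ... | yes refl | yes refl = inj₁ refl
  ... | yes refl | no v≢y   = inj₂ (inj₂ (refl , sym (punchOut-injective (u≢v ∘ sym) v≢y e)))
  ... | no v≢x   | yes refl = inj₂ (inj₁ (punchOut-injective v≢x (u≢v ∘ sym) e , refl))
  ... | no v≢x   | no v≢y   = inj₁ (punchOut-injective v≢x v≢y e)

  merge-identifies : ∀ {n} {u v : Fin n} (u≢v : u ≢ v) → merge u≢v u ≡ merge u≢v v
  merge-identifies {suc n} {u} {v} u≢v with v ≟ u | v ≟ v
  ... | yes v≡u | _       = contradiction (sym v≡u) u≢v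
  ... | no v≢u  | yes _   = punchOut-cong v refl
  ... | no _    | no v≢v  = contradiction refl v≢v

  contractFirst : ∀ {n m} (G : Multigraph n (suc m)) →
    proj₁ (endpoints G Fin.zero) ≢ proj₂ (endpoints G Fin.zero) → Multigraph (ℕ.pred n) m
  contractFirst G u≢v = mapNodes (merge u≢v) (deleteFirst G)

  -- Deletion and contraction are treated together: `φ` is the identity for the former and `merge`
  -- for the latter.
  module _ {n n′ m} (G : Multigraph n (suc m)) (φ : Fin n → Fin n′) where

    private
      u₀ = proj₁ (endpoints G Fin.zero)
      v₀ = proj₂ (endpoints G Fin.zero)
      G′ = mapNodes φ (deleteFirst G)

      project : List (Step G) → List (Step G′)
      project []                    = []
      project ((Fin.zero  , v) ∷ s) = project s
      project ((Fin.suc f , v) ∷ s) = (f , φ v) ∷ project s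

      joins-project : ∀ {f u v} → Joins G (Fin.suc f) u v → Joins G′ f (φ u) (φ v)
      joins-project (inj₁ refl) = inj₁ refl
      joins-project (inj₂ refl) = inj₂ refl

      walk-project : ∀ {b H u w} s → (Fin.zero Subset.∈ (b ∷ H) → φ u₀ ≡ φ v₀) →
                     IsWalk G (b ∷ H) u s w → IsWalk G′ H (φ u) (project s) (φ w)
      walk-project [] _ refl = refl
      walk-project {H = H} {w = w} ((Fin.zero , v) ∷ s) c (0∈ , inj₁ refl , walk) =
        subst (λ x → IsWalk G′ H x (project s) (φ w)) (sym (c 0∈)) (walk-project s c walk)
      walk-project {H = H} {w = w} ((Fin.zero , v) ∷ s) c (0∈ , inj₂ refl , walk) =
        subst (λ x → IsWalk G′ H x (project s) (φ w)) (c 0∈) (walk-project s c walk)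
      walk-project ((Fin.suc f , v) ∷ s) c (f∈ , j , walk) =
        drop-there f∈ , joins-project j , walk-project s c walk

      project-∉ : ∀ {f} s → All (Fin.suc f ≢_) (List.map proj₁ s) → All (f ≢_) (List.map proj₁ (project s))
      project-∉ []                    _          = []
      project-∉ ((Fin.zero  , v) ∷ s) (_ ∷ f∉)   = project-∉ s f∉
      project-∉ ((Fin.suc g , v) ∷ s) (ne ∷ f∉)  = ne ∘ cong Fin.suc ∷ project-∉ s f∉

      project-unique : ∀ s → Unique (List.map proj₁ s) → Unique (List.map proj₁ (project s))
      project-unique []                    _        = []
      project-unique ((Fin.zero  , v) ∷ s) (_ ∷ u)  = project-unique s u
      project-unique ((Fin.suc f , v) ∷ s) (f∉ ∷ u) = project-∉ s f∉ ∷ project-unique s u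

      project-empty : ∀ s → Unique (List.map proj₁ s) → project s ≡ [] → s ≡ [] ⊎ ∃[ v ] s ≡ (Fin.zero , v) ∷ []
      project-empty [] _ _ = inj₁ refl
      project-empty ((Fin.zero , v) ∷ []) _ _ = inj₂ (v , refl)
      project-empty ((Fin.zero , v) ∷ (Fin.zero , _) ∷ s) ((ne ∷ _) ∷ _) _ = contradiction refl ne

    closedTrail-project : ∀ {b H} → (Fin.zero Subset.∈ (b ∷ H) → φ u₀ ≡ φ v₀) →
                          ¬ (Fin.zero Subset.∈ (b ∷ H) × u₀ ≡ v₀) →
                          Walks.ClosedTrail G (b ∷ H) → Walks.ClosedTrail G′ H
    closedTrail-project {b} {H} c noLoop (u , s , s≢[] , walk , ue) =
      φ u , project s , nonempty walk , walk-project s c walk , project-unique s ue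
      where
      -- The projection is empty only if the trail consists of the first edge alone, which is then a
      -- loop.
      nonempty : IsWalk G (b ∷ H) u s u → project s ≢ []
      nonempty walk e with project-empty s ue e
      ... | inj₁ s≡[] = s≢[] s≡[]
      nonempty (0∈ , inj₁ ends , refl) e | inj₂ (v , refl) = noLoop (0∈ , trans (cong proj₁ ends) (sym (cong proj₂ ends)))
      nonempty (0∈ , inj₂ ends , refl) e | inj₂ (v , refl) = noLoop (0∈ , trans (cong proj₁ ends) (sym (cong proj₂ ends)))

    module _ {b : Side} {H : Subset m} (connect : ∀ {P : Fin (suc m) → Set} {x y} → (Fin.zero Subset.∈ (b ∷ H) → P Fin.zero) →
                              φ x ≡ φ y → Walks.Reach G P x y) where
      open Walks
      open Subset using () renaming (_∈_ to _∈ₛ_)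

      private
        reach-lift : ∀ {P : Fin (suc m) → Set} {x y x′ y′} → (Fin.zero ∈ₛ (b ∷ H) → P Fin.zero) →
                     φ x ≡ x′ → φ y ≡ y′ → Reach G′ (P ∘ Fin.suc) x′ y′ → Reach G P x y
        reach-lift p0 refl e stop = connect p0 (sym e)
        reach-lift p0 refl e (step pf (inj₁ ends) r) =
          append G (connect p0 (sym (cong proj₁ ends)))
                   (step pf (inj₁ refl) (reach-lift p0 (cong proj₂ ends) e r))
        reach-lift p0 refl e (step pf (inj₂ ends) r) =
          append G (connect p0 (sym (cong proj₂ ends)))
                   (step pf (inj₂ refl) (reach-lift p0 (cong proj₁ ends) e r))

        weaken : ∀ {n m} {G : Multigraph n m} {P Q : Fin m → Set} → (∀ {f} → P f → Q f) →
                 ∀ {x y} → Reach G P x y → Reach G Q x y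
        weaken h stop         = stop
        weaken h (step p j r) = step (h p) j (weaken h r)

      -- Where two steps meet only after `φ`, the gap is bridged by `connect`. It uses at most the
      -- first edge, which differs from `suc f`, so `suc f` remains avoided.
      redundant-lift : ∀ {f} → Redundant G′ H f → Redundant G (b ∷ H) (Fin.suc f)
      redundant-lift (f∈ , r) = Vec.there f∈ ,
        reach-lift (λ 0∈ → 0∈ , λ ()) refl refl
          (weaken (λ { (g∈ , ne) → Vec.there g∈ , ne ∘ suc-injective }) r)

    acyclic-transfer : ∀ {b H} → (Fin.zero Subset.∈ (b ∷ H) → φ u₀ ≡ φ v₀) →
      ¬ (Fin.zero Subset.∈ (b ∷ H) × u₀ ≡ v₀) → Acyclic G′ H → Acyclic G (b ∷ H)
    acyclic-transfer c noLoop acyclic cyc = acyclic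
      (Walks.closedTrail⇒cycle G′ (closedTrail-project c noLoop (Walks.cycle⇒closedTrail G cyc)))

  module _ {n m} (G : Multigraph n (suc m)) {H : Subset m} where
    private
      u₀ = proj₁ (endpoints G Fin.zero)
      v₀ = proj₂ (endpoints G Fin.zero)

    acyclic-outside⁺ : Acyclic (deleteFirst G) H → Acyclic G (outside ∷ H)
    acyclic-outside⁺ = acyclic-transfer G (λ x → x) (λ ()) (λ { (() , _) })

    acyclic-outside⁻ : Acyclic G (outside ∷ H) → Acyclic (deleteFirst G) H
    acyclic-outside⁻ acyclic cyc = acyclic (Walks.redundant⇒cycle G (redundant-lift G (λ x → x)
      (λ { _ refl → Walks.stop })
      (proj₂ (Walks.closedTrail⇒redundant (deleteFirst G) (Walks.cycle⇒closedTrail (deleteFirst G) cyc)))))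

    -- A loop is redundant by way of the empty walk.
    acyclic-loop : u₀ ≡ v₀ → ¬ Acyclic G (inside ∷ H)
    acyclic-loop e acyclic = acyclic (Walks.redundant⇒cycle G
      (Vec.here , subst (Walks.Reach G _ u₀) e Walks.stop))

    module _ (u≢v : u₀ ≢ v₀) where

      acyclic-inside⁺ : Acyclic (contractFirst G u≢v) H → Acyclic G (inside ∷ H)
      acyclic-inside⁺ = acyclic-transfer G (merge u≢v) (λ _ → merge-identifies u≢v) (λ { (_ , e) → u≢v e })

      acyclic-inside⁻ : Acyclic G (inside ∷ H) → Acyclic (contractFirst G u≢v) H
      acyclic-inside⁻ acyclic cyc = acyclic (Walks.redundant⇒cycle G (redundant-lift G (merge u≢v) connect
        (proj₂ (Walks.closedTrail⇒redundant (contractFirst G u≢v)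
          (Walks.cycle⇒closedTrail (contractFirst G u≢v) cyc)))))
        where
        connect : ∀ {P x y} → (Fin.zero Subset.∈ (inside ∷ H) → P Fin.zero) →
                  merge u≢v x ≡ merge u≢v y → Walks.Reach G P x y
        connect p0 e with merge-kernel u≢v e
        ... | inj₁ refl                   = Walks.stop
        ... | inj₂ (inj₁ (refl , refl)) = Walks.step (p0 Vec.here) (inj₁ refl) Walks.stop
        ... | inj₂ (inj₂ (refl , refl)) = Walks.step (p0 Vec.here) (inj₂ refl) Walks.stop

-- Deletion and contraction for the sum over acyclic sets and for the generating series.

module EhrhartSeries where
  open ≡ using (refl; sym; trans)
  open Multigraph
  open Cycles using (Acyclic; acyclic?)
  open PowerSeries
  open SeriesAlgebra
  open GraphContraction
  open CommutativeRing seriesCommutativeRing using (+-cong; *-cong; *-comm; *-assoc; distribˡ; +-assoc)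
    renaming (refl to ≐-refl; sym to ≐-sym; trans to ≐-trans; commutativeSemiring to seriesSemiring;
              zeroʳ to ⊛-zeroʳ; *-identityʳ to ⊛-identityʳ)
  open import Algebra.Solver.Ring.NaturalCoefficients.Default seriesSemiring using (solve; _:+_; _:*_; _:=_)

  1-z 1+z 2z : Series
  1-z = const 1ℤ ⊖ z
  1+z = const (+ 1) ⊕ z
  2z  = const (+ 2) ⊛ z

  term : ∀ {m} → Subset m → Series
  term {m} H = 2z ^ ∣ H ∣ ⊛ 1+z ^ (m ∸ ∣ H ∣)

  hStar : ∀ {n m} → Multigraph n m → Series
  hStar G = ∑[ H ∈ acyclicSubsets G ] term H

  module _ {A : Set} where

    sumOver-++ : ∀ (xs ys : List A) (f : A → Series) → sumOver (xs List.++ ys) f ≐ sumOver xs f ⊕ sumOver ys f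
    sumOver-++ []       ys f k = sym (trans (cong (ℤ._+ sumOver ys f k) (const-0 k)) (ℤ.+-identityˡ _))
      where
      const-0 : const 0ℤ ≐ λ _ → 0ℤ
      const-0 zero    = refl
      const-0 (suc _) = refl
    sumOver-++ (x ∷ xs) ys f = ≐-trans (+-cong (≐-refl {f x}) (sumOver-++ xs ys f))
                                       (≐-sym (+-assoc (f x) (sumOver xs f) (sumOver ys f)))

    sumOver-scale : ∀ {B : Set} (xs : List A) (g : A → B) {f : B → Series} {f′ : A → Series} c → (∀ x → f (g x) ≐ c ⊛ f′ x) →
                    sumOver (List.map g xs) f ≐ c ⊛ sumOver xs f′
    sumOver-scale []       g c e = ≐-sym (≐-trans (*-comm c (const 0ℤ)) (⊛-zeroˡ c))
    sumOver-scale (x ∷ xs) g {f = f} {f′ = f′} c e = ≐-trans (+-cong (e x) (sumOver-scale xs g {f = f} c e))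
      (≐-sym (distribˡ c (f′ x) (sumOver xs f′)))

  filter-map : ∀ {A B : Set} {P : Pred B 0ℓ} {Q : Pred A 0ℓ} (P? : Decidable P) (Q? : Decidable Q) (g : A → B) →
    (∀ {x} → P (g x) → Q x) → (∀ {x} → Q x → P (g x)) → ∀ xs → filter P? (List.map g xs) ≡ List.map g (filter Q? xs)
  filter-map P? Q? g to from [] = refl
  filter-map P? Q? g to from (x ∷ xs) with P? (g x) | Q? x
  ... | yes _  | yes _  = cong (g x ∷_) (filter-map P? Q? g to from xs)
  ... | no _   | no _   = filter-map P? Q? g to from xs
  ... | yes px | no ¬qx = contradiction (to px) ¬qx
  ... | no ¬px | yes qx = contradiction (from qx) ¬px

  -- The truncated difference gains one only because `H` has at most `m` elements. In `term-inside`
  -- both of its arguments grow and it computes to the old value.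
  term-outside : ∀ {m} (H : Subset m) → term (outside ∷ H) ≐ 1+z ⊛ term H
  term-outside {m} H = ≐-trans (λ k → cong (λ e → (2z ^ ∣ H ∣ ⊛ 1+z ^ e) k) (ℕ.+-∸-assoc 1 (∣p∣≤n H)))
    (solve 3 (λ a b c → a :* (b :* c) := b :* (a :* c)) ≐-refl (2z ^ ∣ H ∣) 1+z (1+z ^ (m ∸ ∣ H ∣)))

  term-inside : ∀ {m} (H : Subset m) → term (inside ∷ H) ≐ 2z ⊛ term H
  term-inside {m} H = *-assoc 2z (2z ^ ∣ H ∣) (1+z ^ (m ∸ ∣ H ∣))

  module _ {n m} (G : Multigraph n (suc m)) where

    private
      u₀ = proj₁ (endpoints G Fin.zero)
      v₀ = proj₂ (endpoints G Fin.zero)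
      G₁ = deleteFirst G

      acyclicSubsets-split : acyclicSubsets G ≡ List.map (outside ∷_) (acyclicSubsets G₁) List.++
                               filter (acyclic? G) (List.map (inside ∷_) (subsets m))
      acyclicSubsets-split = trans (filter-++ (acyclic? G) (List.map (outside ∷_) (subsets m)) insides)
        (cong (List._++ filter (acyclic? G) insides) (filter-map (acyclic? G) (acyclic? G₁) (outside ∷_)
          (acyclic-outside⁻ G) (acyclic-outside⁺ G) (subsets m)))
        where insides = List.map (inside ∷_) (subsets m)

    hStar-loop : u₀ ≡ v₀ → hStar G ≐ 1+z ⊛ hStar G₁
    hStar-loop e k = trans (cong (λ Hs → sumOver Hs term k) acyclicSubsets≡)
      (sumOver-scale (acyclicSubsets G₁) (outside ∷_) {f = term} {f′ = term} 1+z term-outside k)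
      where
      filter-inside : ∀ Hs → filter (acyclic? G) (List.map (inside ∷_) Hs) ≡ []
      filter-inside Hs = filter-none (acyclic? G) (All-map⁺ (All.universal (λ _ → acyclic-loop G e) Hs))
      acyclicSubsets≡ : acyclicSubsets G ≡ List.map (outside ∷_) (acyclicSubsets G₁)
      acyclicSubsets≡ = trans acyclicSubsets-split
        (trans (cong (List.map (outside ∷_) (acyclicSubsets G₁) List.++_) (filter-inside (subsets m)))
          (++-identityʳ (List.map (outside ∷_) (acyclicSubsets G₁))))

    hStar-nonloop : (u≢v : u₀ ≢ v₀) → hStar G ≐ 1+z ⊛ hStar G₁ ⊕ 2z ⊛ hStar (contractFirst G u≢v)
    hStar-nonloop u≢v k = trans (cong (λ Hs → sumOver Hs term k)
        (trans acyclicSubsets-split (cong (List.map (outside ∷_) (acyclicSubsets G₁) List.++_)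
          (filter-map (acyclic? G) (acyclic? G₂) (inside ∷_) (acyclic-inside⁻ G u≢v) (acyclic-inside⁺ G u≢v) (subsets m)))))
      (trans (sumOver-++ (List.map (outside ∷_) (acyclicSubsets G₁)) (List.map (inside ∷_) (acyclicSubsets G₂)) term k)
        (cong₂ ℤ._+_ (sumOver-scale (acyclicSubsets G₁) (outside ∷_) {f = term} {f′ = term} 1+z term-outside k)
                     (sumOver-scale (acyclicSubsets G₂) (inside ∷_) {f = term} {f′ = term} 2z term-inside k)))
      where G₂ = contractFirst G u≢v

  hStar-edgeless : ∀ {n} (G : Multigraph n 0) → hStar G ≐ const 1ℤ
  hStar-edgeless G k = trans
    (cong (λ Hs → sumOver Hs term k) (filter-all (acyclic? G) (edgeless-acyclic ∷ [])))
    (≐-trans {k = const 1ℤ} (+-cong (⊛-identityʳ (const 1ℤ)) (≐-refl {const 0ℤ})) (λ { zero → refl ; (suc _) → refl }) k)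
    where
    edgeless-acyclic : Acyclic G []
    edgeless-acyclic (_ , [] , ne , _) = ne refl

  -- The coefficients of (1 + z)/(1 - z), 2z/(1 - z)² and 1/(1 - z).
  deletionWeight contractionWeight ones : ℕ → ℕ
  deletionWeight zero    = 1
  deletionWeight (suc _) = 2
  contractionWeight k    = 2 ℕ.* k
  ones _                 = 1

  toSeries : (ℕ → ℕ) → Series
  toSeries a k = + a k

  difference : ∀ a k → (a ⊛ 1-z) (suc k) ≡ a (suc k) ℤ.- a k
  difference a k = trans (⊛-comm a 1-z (suc k)) (trans (cong₂ ℤ._+_ (ℤ.*-identityˡ (a (suc k))) (rest k)) refl)
    where
    rest : ∀ k → (tail 1-z ⊛ a) k ≡ ℤ.- a k
    rest k = trans (⊛-cong {a = tail 1-z} {b = const (ℤ.- 1ℤ)} {c = a} {d = a} (λ { zero → refl ; (suc _) → refl }) (λ _ → refl) k)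
                   (trans (const-⊛ (ℤ.- 1ℤ) a k) (ℤ.-1*i≡-i (a k)))

  ones-1-z : toSeries ones ⊛ 1-z ≐ const 1ℤ
  ones-1-z zero    = refl
  ones-1-z (suc k) = difference (toSeries ones) k

  deletionWeight-1-z : toSeries deletionWeight ⊛ 1-z ≐ 1+z
  deletionWeight-1-z zero          = refl
  deletionWeight-1-z (suc zero)    = difference (toSeries deletionWeight) 0
  deletionWeight-1-z (suc (suc k)) = difference (toSeries deletionWeight) (suc k)

  contractionWeight-1-z : toSeries contractionWeight ⊛ 1-z ⊛ 1-z ≐ 2z
  contractionWeight-1-z zero    = refl
  contractionWeight-1-z (suc k) = trans (difference (toSeries contractionWeight ⊛ 1-z) k) (second k)
    where
    first : ∀ k → (toSeries contractionWeight ⊛ 1-z) (suc k) ≡ + 2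
    first k = trans (difference (toSeries contractionWeight) k)
      (trans (cong (λ w → + w ℤ.- + (2 ℕ.* k)) (ℕ.*-suc 2 k)) (trans (cong (ℤ._- + (2 ℕ.* k)) (ℤ.pos-+ 2 (2 ℕ.* k))) (cancel (+ 2) (+ (2 ℕ.* k)))))
      where
      cancel : ∀ x y → (x ℤ.+ y) ℤ.- y ≡ x
      cancel = solve-∀
    second : ∀ k → (toSeries contractionWeight ⊛ 1-z) (suc k) ℤ.- (toSeries contractionWeight ⊛ 1-z) k ≡ 2z (suc k)
    second zero    = refl
    second (suc k) = trans (cong₂ ℤ._-_ (first (suc k)) (first k)) (sym (const-⊛ (+ 2) z (2 ℕ.+ k)))

  antidiagonalSum-⊛ : ∀ ω ω′ a b → toSeries (antidiagonalSum (λ k l → ω k ℕ.* a l ℕ.+ ω′ k ℕ.* b l)) ≐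
                      toSeries ω ⊛ toSeries a ⊕ toSeries ω′ ⊛ toSeries b
  antidiagonalSum-⊛ ω ω′ a b zero = trans (split 0 0) (lemma (+ ω 0 ℤ.* + a 0) (+ ω′ 0 ℤ.* + b 0))
    where
    split : ∀ k l → + (ω k ℕ.* a l ℕ.+ ω′ k ℕ.* b l) ≡ + ω k ℤ.* + a l ℤ.+ + ω′ k ℤ.* + b l
    split k l = trans (ℤ.pos-+ (ω k ℕ.* a l) (ω′ k ℕ.* b l)) (cong₂ ℤ._+_ (ℤ.pos-* (ω k) (a l)) (ℤ.pos-* (ω′ k) (b l)))
    lemma : ∀ x y → x ℤ.+ y ≡ (x ℤ.+ 0ℤ) ℤ.+ (y ℤ.+ 0ℤ)
    lemma = solve-∀
  antidiagonalSum-⊛ ω ω′ a b (suc j) =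
    trans (ℤ.pos-+ (ω 0 ℕ.* a (suc j) ℕ.+ ω′ 0 ℕ.* b (suc j)) _)
    (trans (cong₂ ℤ._+_ (split 0 (suc j)) (antidiagonalSum-⊛ (ω ∘ suc) (ω′ ∘ suc) a b j))
      (lemma (+ ω 0 ℤ.* + a (suc j)) (+ ω′ 0 ℤ.* + b (suc j)) ((toSeries (ω ∘ suc) ⊛ toSeries a) j)
             ((toSeries (ω′ ∘ suc) ⊛ toSeries b) j)))
    where
    split : ∀ k l → + (ω k ℕ.* a l ℕ.+ ω′ k ℕ.* b l) ≡ + ω k ℤ.* + a l ℤ.+ + ω′ k ℤ.* + b l
    split k l = trans (ℤ.pos-+ (ω k ℕ.* a l) (ω′ k ℕ.* b l)) (cong₂ ℤ._+_ (ℤ.pos-* (ω k) (a l)) (ℤ.pos-* (ω′ k) (b l)))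
    lemma : ∀ x y p q → (x ℤ.+ y) ℤ.+ (p ℤ.+ q) ≡ (x ℤ.+ p) ℤ.+ (y ℤ.+ q)
    lemma = solve-∀

  -- The summand 0 * 0, here and below, makes this an instance of antidiagonalSum-⊛.
  compositions : ℕ → ℕ → ℕ
  compositions zero    zero    = 1
  compositions zero    (suc _) = 0
  compositions (suc n) = antidiagonalSum (λ k l → ones k ℕ.* compositions n l ℕ.+ 0 ℕ.* 0)

  mutual
    latticeCount : ∀ {n m} → Multigraph n m → ℕ → ℕ
    latticeCount {n} {zero}  G = compositions n
    latticeCount {n} {suc m} G = latticeCount-step G (proj₁ (endpoints G Fin.zero) ≟ proj₂ (endpoints G Fin.zero))

    -- The decision is an argument so that the proofs about the count can split on it without
    -- unfolding the comparison of the endpoints.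
    latticeCount-step : ∀ {n m} (G : Multigraph n (suc m)) →
                        Dec (proj₁ (endpoints G Fin.zero) ≡ proj₂ (endpoints G Fin.zero)) → ℕ → ℕ
    latticeCount-step G (yes _)  =
      antidiagonalSum (λ k l → deletionWeight k ℕ.* latticeCount (deleteFirst G) l ℕ.+ 0 ℕ.* 0)
    latticeCount-step G (no u≢v) =
      antidiagonalSum (λ k l → deletionWeight k ℕ.* latticeCount (deleteFirst G) l
                               ℕ.+ contractionWeight k ℕ.* latticeCount (contractFirst G u≢v) l)

  antidiagonalSum-⊛₁ : ∀ ω a → toSeries (antidiagonalSum (λ k l → ω k ℕ.* a l ℕ.+ 0 ℕ.* 0)) ≐ toSeries ω ⊛ toSeries a
  antidiagonalSum-⊛₁ ω a k = trans (antidiagonalSum-⊛ ω (λ _ → 0) a (λ _ → 0) k)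
    (trans (cong (ℤ._+_ ((toSeries ω ⊛ toSeries a) k)) (⊛-zeroʳ (λ _ → + 0) k)) (ℤ.+-identityʳ _))

  private
    interchange : ∀ a o c d p {o′ c′} → a ≐ o ⊛ c → o ⊛ d ≐ o′ → c ⊛ p ≐ c′ → a ⊛ (d ⊛ p) ≐ o′ ⊛ c′
    interchange a o c d p a≐ o≐ c≐ =
      ≐-trans (*-cong a≐ (≐-refl {d ⊛ p}))
      (≐-trans (solve 4 (λ o c d p → (o :* c) :* (d :* p) := (o :* d) :* (c :* p)) ≐-refl o c d p)
      (*-cong o≐ c≐))

    -- Here `d` is 1 - z. Of the two extra factors `d`, the deletion term spends one on its weight
    -- and leaves the other to the power belonging to the deletion; the contraction term spends both
    -- on its weight.
    interchange₂ : ∀ a o c w e d p {o′ c′ w′ e′} → a ≐ o ⊛ c ⊕ w ⊛ e → o ⊛ d ≐ o′ → c ⊛ (d ⊛ p) ≐ c′ →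
                   w ⊛ d ⊛ d ≐ w′ → e ⊛ p ≐ e′ → a ⊛ (d ⊛ (d ⊛ p)) ≐ o′ ⊛ c′ ⊕ w′ ⊛ e′
    interchange₂ a o c w e d p a≐ o≐ c≐ w≐ e≐ =
      ≐-trans (*-cong a≐ (≐-refl {d ⊛ (d ⊛ p)}))
      (≐-trans (solve 6 (λ o c w e d p → (o :* c :+ w :* e) :* (d :* (d :* p)) :=
                           (o :* d) :* (c :* (d :* p)) :+ ((w :* d) :* d) :* (e :* p)) ≐-refl o c w e d p)
      (+-cong (*-cong o≐ c≐) (*-cong w≐ e≐)))

    power-cong : ∀ a {i j} → i ≡ j → a ^ i ≐ a ^ j
    power-cong a refl = ≐-refl

  compositions-1-z : ∀ n → toSeries (compositions n) ⊛ 1-z ^ n ≐ const 1ℤ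
  compositions-1-z zero    = ≐-trans (⊛-identityʳ (toSeries (compositions 0))) λ { zero → refl ; (suc _) → refl }
  compositions-1-z (suc n) = ≐-trans
    (interchange (toSeries (compositions (suc n))) (toSeries ones) (toSeries (compositions n)) 1-z (1-z ^ n)
      (antidiagonalSum-⊛₁ ones (compositions n)) ones-1-z (compositions-1-z n))
    (⊛-identityʳ (const 1ℤ))

  mutual
    latticeCount-1-z : ∀ {n m} (G : Multigraph n m) → toSeries (latticeCount G) ⊛ 1-z ^ (n ℕ.+ m) ≐ hStar G
    latticeCount-1-z {n} {zero} G =
      ≐-trans (*-cong (≐-refl {toSeries (compositions n)}) (power-cong 1-z (ℕ.+-identityʳ n)))
      (≐-trans (compositions-1-z n) (≐-sym (hStar-edgeless G)))
    latticeCount-1-z {n} {suc m} G =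
      latticeCount-step-1-z G (proj₁ (endpoints G Fin.zero) ≟ proj₂ (endpoints G Fin.zero))

    latticeCount-step-1-z : ∀ {n m} (G : Multigraph n (suc m)) dec →
      toSeries (latticeCount-step G dec) ⊛ 1-z ^ (n ℕ.+ suc m) ≐ hStar G
    latticeCount-step-1-z {n} {m} G dec@(yes e) =
      ≐-trans (*-cong (≐-refl {toSeries (latticeCount-step G dec)}) (power-cong 1-z (ℕ.+-suc n m)))
      (≐-trans (interchange (toSeries (latticeCount-step G dec)) (toSeries deletionWeight) (toSeries (latticeCount (deleteFirst G)))
                  1-z (1-z ^ (n ℕ.+ m))
                  (antidiagonalSum-⊛₁ deletionWeight (latticeCount (deleteFirst G))) deletionWeight-1-z (latticeCount-1-z (deleteFirst G)))
      (≐-sym (hStar-loop G e)))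
    latticeCount-step-1-z {zero}  {m} G dec = contradiction (proj₁ (endpoints G Fin.zero)) λ ()
    latticeCount-step-1-z {suc n} {m} G dec@(no u≢v) =
      ≐-trans (*-cong (≐-refl {toSeries (latticeCount-step G dec)}) (power-cong 1-z (cong suc (ℕ.+-suc n m))))
      (≐-trans (interchange₂ (toSeries (latticeCount-step G dec)) (toSeries deletionWeight) (toSeries (latticeCount (deleteFirst G)))
                  (toSeries contractionWeight) (toSeries (latticeCount (contractFirst G u≢v))) 1-z (1-z ^ (n ℕ.+ m))
                  (antidiagonalSum-⊛ deletionWeight contractionWeight (latticeCount (deleteFirst G)) (latticeCount (contractFirst G u≢v)))
                  deletionWeight-1-z (latticeCount-1-z (deleteFirst G)) contractionWeight-1-z (latticeCount-1-z (contractFirst G u≢v)))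
      (≐-sym (hStar-nonloop G u≢v)))

-- Integers in an ordered field, and linear functionals.

module FieldArithmetic {c ℓ₁ ℓ₂} (K : OrderedField c ℓ₁ ℓ₂) where
  open OrderedField K
  open Polytopes K using (fromℤ; Point; combination; δ; _≋_)
  open IsTotalOrder isTotalOrder using (total; antisym; ≤-respˡ-≈; ≤-respʳ-≈)
    renaming (refl to ≤-refl; trans to ≤-trans; reflexive to ≤-reflexive)
  open import Algebra.Properties.Semiring.Sum semiring
  open import Algebra.Properties.Monoid.Mult +-monoid using (×-homo-+) renaming (_×_ to _·_)
  open import Algebra.Properties.Ring ring using (-‿distribʳ-*; -1*x≈-x; -‿involutive; -‿+-comm) renaming (-0#≈0# to -0≈0)
  open import Algebra.Properties.CommutativeSemigroup +-commutativeSemigroup using (interchange)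
  open import Relation.Binary.Reasoning.Setoid setoid

  nonneg-+ : ∀ {x y} → 0# ≤ x → 0# ≤ y → 0# ≤ x + y
  nonneg-+ {x} {y} p q = ≤-trans q (≤-respˡ-≈ (+-identityˡ y) (+-monoˡ-≤ y p))

  nonneg-neg : ∀ {x} → x ≤ 0# → 0# ≤ - x
  nonneg-neg {x} p = ≤-respˡ-≈ (-‿inverseʳ x) (≤-respʳ-≈ (+-identityˡ (- x)) (+-monoˡ-≤ (- x) p))

  -- If `1# ≤ 0#`, then `1#` is the square of the nonnegative element `- 1#`.
  0≤1 : 0# ≤ 1#
  0≤1 with total 0# 1#
  ... | inj₁ p = p
  ... | inj₂ p = ≤-respʳ-≈ (trans (-1*x≈-x (- 1#)) (-‿involutive 1#)) (*-nonNeg (nonneg-neg p) (nonneg-neg p))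

  ·1-nonneg : ∀ k → 0# ≤ k · 1#
  ·1-nonneg zero    = ≤-refl
  ·1-nonneg (suc k) = nonneg-+ 0≤1 (·1-nonneg k)

  -- Otherwise `suc k · 1#`, which is at least `1#`, would be at most `0#`, and with `0≤1` this
  -- forces zero and one to agree. Characteristic zero follows.
  -‿·1-negative : ∀ k → ¬ 0# ≤ - (suc k · 1#)
  -‿·1-negative k p = 0≉1 (antisym 0≤1 (≤-respˡ-≈ (+-identityʳ 1#) (≤-respʳ-≈ (-‿inverseʳ (suc k · 1#))
    (≤-trans (≤-respˡ-≈ (+-comm 0# 1#) (≤-respʳ-≈ (+-comm (k · 1#) 1#) (+-monoˡ-≤ 1# (·1-nonneg k))))
             (≤-respˡ-≈ (+-identityˡ _) (≤-respʳ-≈ (+-comm _ (suc k · 1#)) (+-monoˡ-≤ (suc k · 1#) p)))))))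

  ·1-nonzero : ∀ k → ¬ suc k · 1# ≈ 0#
  ·1-nonzero k e = -‿·1-negative k (≤-reflexive (trans (sym -0≈0) (-‿cong (sym e))))

  reciprocal : ∀ k → ∃[ r ] (suc k · 1#) * r ≈ 1# × 0# ≤ r
  reciprocal k with inverse (suc k · 1#) (·1-nonzero k)
  ... | r , e with total 0# r
  ...   | inj₁ p = r , e , p
  ...   | inj₂ p = contradiction
    (≤-respʳ-≈ (trans (sym (-‿distribʳ-* (suc k · 1#) r)) (-‿cong (trans e (sym (+-identityʳ 1#)))))
      (*-nonNeg (·1-nonneg (suc k)) (nonneg-neg p)))
    (-‿·1-negative 0)

  fromℤ-⊖ : ∀ m n → fromℤ (m ℤ.⊖ n) ≈ m · 1# + - (n · 1#)
  fromℤ-⊖ m       zero    = sym (trans (+-congˡ -0≈0) (+-identityʳ _))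
  fromℤ-⊖ zero    (suc n) = sym (+-identityˡ _)
  fromℤ-⊖ (suc m) (suc n) = begin
    fromℤ (suc m ℤ.⊖ suc n)                    ≡⟨ ≡.cong fromℤ (ℤ.[1+m]⊖[1+n]≡m⊖n m n) ⟩
    fromℤ (m ℤ.⊖ n)                            ≈⟨ fromℤ-⊖ m n ⟩
    m · 1# + - (n · 1#)                        ≈⟨ +-identityˡ _ ⟨
    0# + (m · 1# + - (n · 1#))                 ≈⟨ +-congʳ (-‿inverseʳ 1#) ⟨
    1# + - 1# + (m · 1# + - (n · 1#))          ≈⟨ interchange 1# (- 1#) (m · 1#) (- (n · 1#)) ⟩
    1# + m · 1# + (- 1# + - (n · 1#))          ≈⟨ +-congˡ (-‿+-comm 1# (n · 1#)) ⟩
    suc m · 1# + - (suc n · 1#)                ∎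

  fromℤ-+ : ∀ a b → fromℤ (a ℤ.+ b) ≈ fromℤ a + fromℤ b
  fromℤ-+ (+ m)    (+ n)    = ×-homo-+ 1# m n
  fromℤ-+ (+ m)    -[1+ n ] = fromℤ-⊖ m (suc n)
  fromℤ-+ -[1+ m ] (+ n)    = trans (fromℤ-⊖ n (suc m)) (+-comm _ _)
  fromℤ-+ -[1+ m ] -[1+ n ] = begin
    - (suc (suc (m ℕ.+ n)) · 1#)      ≡⟨ ≡.cong (λ k → - (suc k · 1#)) (ℕ.+-suc m n) ⟨
    - ((suc m ℕ.+ suc n) · 1#)        ≈⟨ -‿cong (×-homo-+ 1# (suc m) (suc n)) ⟩
    - (suc m · 1# + suc n · 1#)       ≈⟨ -‿+-comm _ _ ⟨
    - (suc m · 1#) + - (suc n · 1#)   ∎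

  fromℤ-neg : ∀ a → fromℤ (ℤ.- a) ≈ - fromℤ a
  fromℤ-neg (+ zero)  = sym -0≈0
  fromℤ-neg (+ suc _) = refl
  fromℤ-neg -[1+ _ ]  = sym (-‿involutive _)

  fromℤ-nonneg⁺ : ∀ {a} → 0ℤ ℤ.≤ a → 0# ≤ fromℤ a
  fromℤ-nonneg⁺ {+ k}     _  = ·1-nonneg k
  fromℤ-nonneg⁺ { -[1+ k ]} ()

  -- The way back from `K` to the integers: inequalities directly, and equations through
  -- `fromℤ-injective`.
  fromℤ-nonneg⁻ : ∀ {a} → 0# ≤ fromℤ a → 0ℤ ℤ.≤ a
  fromℤ-nonneg⁻ {+ k}       _ = ℤ.+≤+ z≤n
  fromℤ-nonneg⁻ { -[1+ k ]} p = contradiction p (-‿·1-negative k)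

  fromℤ-≤ : ∀ {a b} → fromℤ a ≈ fromℤ b → a ℤ.≤ b
  fromℤ-≤ {a} {b} e = ℤ.0≤i-j⇒j≤i (fromℤ-nonneg⁻ (≤-reflexive (sym (begin
    fromℤ (b ℤ.- a)      ≈⟨ fromℤ-+ b (ℤ.- a) ⟩
    fromℤ b + fromℤ (ℤ.- a) ≈⟨ +-cong (sym e) (fromℤ-neg a) ⟩
    fromℤ a + - fromℤ a  ≈⟨ -‿inverseʳ _ ⟩
    0#                   ∎))))

  fromℤ-injective : ∀ {a b} → fromℤ a ≈ fromℤ b → a ≡ b
  fromℤ-injective e = ℤ.≤-antisym (fromℤ-≤ e) (fromℤ-≤ (sym e))

  fromℤ-· : ∀ k a → fromℤ (+ k ℤ.* a) ≈ (k · 1#) * fromℤ a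
  fromℤ-· zero    a = sym (zeroˡ _)
  fromℤ-· (suc k) a = begin
    fromℤ (+ suc k ℤ.* a)                ≡⟨ ≡.cong fromℤ (ℤ.suc-* (+ k) a) ⟩
    fromℤ (a ℤ.+ + k ℤ.* a)              ≈⟨ fromℤ-+ a _ ⟩
    fromℤ a + fromℤ (+ k ℤ.* a)          ≈⟨ +-cong (sym (*-identityˡ _)) (fromℤ-· k a) ⟩
    1# * fromℤ a + (k · 1#) * fromℤ a    ≈⟨ distribʳ (fromℤ a) 1# (k · 1#) ⟨
    (suc k · 1#) * fromℤ a               ∎

  infix 8 ⟨_,_⟩
  ⟨_,_⟩ : ∀ {N} → Point N → Point N → Carrier
  ⟨ a , x ⟩ = sum (λ i → a i * x i)

  ⟨⟩-cong : ∀ {N} (a : Point N) {x y} → x ≋ y → ⟨ a , x ⟩ ≈ ⟨ a , y ⟩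
  ⟨⟩-cong a e = sum-cong-≋ (λ i → *-congˡ (e i))

  ⟨⟩-+ : ∀ {N} (a x y : Point N) → ⟨ a , (λ i → x i + y i) ⟩ ≈ ⟨ a , x ⟩ + ⟨ a , y ⟩
  ⟨⟩-+ a x y = trans (sum-cong-≋ (λ i → distribˡ (a i) (x i) (y i))) (∑-distrib-+ (λ i → a i * x i) (λ i → a i * y i))

  ⟨⟩-scale : ∀ {N} r (a x : Point N) → ⟨ a , (λ i → r * x i) ⟩ ≈ r * ⟨ a , x ⟩
  ⟨⟩-scale r a x = trans (sum-cong-≋ (λ i → x∙yz≈y∙xz (a i) r (x i))) (sym (*-distribˡ-sum r (λ i → a i * x i)))
    where open import Algebra.Properties.CommutativeSemigroup *-commutativeSemigroup using (x∙yz≈y∙xz)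

  ⟨⟩-neg : ∀ {N} (a x : Point N) → ⟨ a , (λ i → - x i) ⟩ ≈ - ⟨ a , x ⟩
  ⟨⟩-neg a x = trans (⟨⟩-cong a (λ i → sym (-1*x≈-x (x i)))) (trans (⟨⟩-scale (- 1#) a x) (-1*x≈-x _))

  ⟨⟩-combination : ∀ {N k} (a : Point N) w (p : Fin k → Point N) →
                   ⟨ a , combination w p ⟩ ≈ sum (λ b → w b * ⟨ a , p b ⟩)
  ⟨⟩-combination a w p = begin
    sum (λ i → a i * sum (λ b → w b * p b i))       ≈⟨ sum-cong-≋ (λ i → *-distribˡ-sum (a i) (λ b → w b * p b i)) ⟩
    sum (λ i → sum (λ b → a i * (w b * p b i)))     ≈⟨ ∑-comm (λ i b → a i * (w b * p b i)) ⟩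
    sum (λ b → sum (λ i → a i * (w b * p b i)))     ≈⟨ sum-cong-≋ (λ b → ⟨⟩-scale (w b) a (p b)) ⟩
    sum (λ b → w b * ⟨ a , p b ⟩)                   ∎

  ⟨⟩-δ : ∀ {N} (a : Point N) i → ⟨ a , δ i ⟩ ≈ a i
  ⟨⟩-δ {suc N} a Fin.zero = begin
    a Fin.zero * 1# + sum (λ j → a (Fin.suc j) * 0#) ≈⟨ +-cong (*-identityʳ _) (sum-cong-≋ (λ j → zeroʳ (a (Fin.suc j)))) ⟩
    a Fin.zero + sum {N} (λ _ → 0#)                  ≈⟨ +-congˡ (sum-replicate-zero N) ⟩
    a Fin.zero + 0#                                  ≈⟨ +-identityʳ _ ⟩
    a Fin.zero                                       ∎
  ⟨⟩-δ {suc N} a (Fin.suc i) = begin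
    a Fin.zero * 0# + ⟨ a ∘ Fin.suc , δ i ⟩          ≈⟨ +-cong (zeroʳ _) (⟨⟩-δ (a ∘ Fin.suc) i) ⟩
    0# + a (Fin.suc i)                               ≈⟨ +-identityˡ _ ⟩
    a (Fin.suc i)                                    ∎

  sum-nonneg : ∀ {k} (x : Fin k → Carrier) → (∀ i → 0# ≤ x i) → 0# ≤ sum x
  sum-nonneg {zero}  x p = ≤-refl
  sum-nonneg {suc k} x p = nonneg-+ (p Fin.zero) (sum-nonneg (x ∘ Fin.suc) (p ∘ Fin.suc))

-- Integer vectors and changes of one or two coordinates.

module LatticeCombinatorics where
  open ≡ using (refl; sym; trans; module ≡-Reasoning)
  open Multigraph
  open GraphContraction

  bump : ∀ {n} → Fin n → ℤ → Vec ℤ n → Vec ℤ n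
  bump w a y = Vec.updateAt y w (ℤ._+ a)

  bump-bump : ∀ {n} (w : Fin n) a b y → bump w a (bump w b y) ≡ bump w (a ℤ.+ b) y
  bump-bump w a b y = updateAt-updateAt-local w y (lemma (lookup y w) a b)
    where
    lemma : ∀ x a b → x ℤ.+ b ℤ.+ a ≡ x ℤ.+ (a ℤ.+ b)
    lemma = solve-∀

  bump-0 : ∀ {n} (w : Fin n) y → bump w 0ℤ y ≡ y
  bump-0 w y = updateAt-id-local w y (ℤ.+-identityʳ _)

  bump-comm : ∀ {n} (w x : Fin n) a b y → bump w a (bump x b y) ≡ bump x b (bump w a y)
  bump-comm w x a b y with w ≟ x
  ... | yes refl = trans (bump-bump w a b y) (trans (cong (λ c → bump w c y) (ℤ.+-comm a b)) (sym (bump-bump w b a y)))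
  ... | no w≢x   = sym (updateAt-commutes x w (w≢x ∘ sym) y)

  -- If `u` and `v` coincide the two changes add up, just as in the generators of a loop, so loops
  -- need no separate case.
  bump₂ : ∀ {n} → Fin n → Fin n → ℤ → ℤ → Vec ℤ n → Vec ℤ n
  bump₂ u v a b y = bump u a (bump v b y)

  bump₂-bump₂ : ∀ {n} (u v : Fin n) a b a′ b′ y →
                bump₂ u v a b (bump₂ u v a′ b′ y) ≡ bump₂ u v (a ℤ.+ a′) (b ℤ.+ b′) y
  bump₂-bump₂ u v a b a′ b′ y = begin
    bump u a (bump v b (bump u a′ (bump v b′ y))) ≡⟨ cong (bump u a) (bump-comm v u b a′ _) ⟩
    bump u a (bump u a′ (bump v b (bump v b′ y))) ≡⟨ bump-bump u a a′ _ ⟩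
    bump u (a ℤ.+ a′) (bump v b (bump v b′ y))    ≡⟨ cong (bump u (a ℤ.+ a′)) (bump-bump v b b′ y) ⟩
    bump₂ u v (a ℤ.+ a′) (b ℤ.+ b′) y             ∎
    where open ≡-Reasoning

  bump₂-0 : ∀ {n} (u v : Fin n) y → bump₂ u v 0ℤ 0ℤ y ≡ y
  bump₂-0 u v y = trans (cong (bump u 0ℤ) (bump-0 v y)) (bump-0 u y)

  bump₂-inverse : ∀ {n} (u v : Fin n) a b y → bump₂ u v a b (bump₂ u v (ℤ.- a) (ℤ.- b) y) ≡ y
  bump₂-inverse u v a b y = trans (bump₂-bump₂ u v a b _ _ y)
    (trans (cong₂ (λ c d → bump₂ u v c d y) (ℤ.+-inverseʳ a) (ℤ.+-inverseʳ b)) (bump₂-0 u v y))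

  bump₂-inverse′ : ∀ {n} (u v : Fin n) a b y → bump₂ u v (ℤ.- a) (ℤ.- b) (bump₂ u v a b y) ≡ y
  bump₂-inverse′ u v a b y = trans (bump₂-bump₂ u v _ _ a b y)
    (trans (cong₂ (λ c d → bump₂ u v c d y) (ℤ.+-inverseˡ a) (ℤ.+-inverseˡ b)) (bump₂-0 u v y))

  -- Cut inequalities, submodularity and elimination of edges.

  weight : Side → ℤ → ℤ
  weight inside  a = a
  weight outside a = 0ℤ

  sumOn : ∀ {n} → Subset n → Vec ℤ n → ℤ
  sumOn []      []      = 0ℤ
  sumOn (s ∷ S) (x ∷ y) = weight s x ℤ.+ sumOn S y

  total : ∀ {n} → Vec ℤ n → ℤ
  total = sumOn full

  sumOn-bump : ∀ {n} (S : Subset n) w a y → sumOn S (bump w a y) ≡ sumOn S y ℤ.+ weight (lookup S w) a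
  sumOn-bump (inside ∷ S)  Fin.zero a (x ∷ y) = lemma x a (sumOn S y)
    where
    lemma : ∀ x a s → x ℤ.+ a ℤ.+ s ≡ x ℤ.+ s ℤ.+ a
    lemma = solve-∀
  sumOn-bump (outside ∷ S) Fin.zero a (x ∷ y) = sym (ℤ.+-identityʳ _)
  sumOn-bump (s ∷ S) (Fin.suc w) a (x ∷ y) =
    trans (cong (ℤ._+_ (weight s x)) (sumOn-bump S w a y)) (sym (ℤ.+-assoc (weight s x) (sumOn S y) _))

  sumOn-bump₂ : ∀ {n} (S : Subset n) u v a b y →
    sumOn S (bump₂ u v a b y) ≡ sumOn S y ℤ.+ weight (lookup S v) b ℤ.+ weight (lookup S u) a
  sumOn-bump₂ S u v a b y = trans (sumOn-bump S u a (bump v b y)) (cong (ℤ._+ weight (lookup S u) a) (sumOn-bump S v b y))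

  total-bump : ∀ {n} w a (y : Vec ℤ n) → total (bump w a y) ≡ total y ℤ.+ a
  total-bump w a y = trans (sumOn-bump full w a y) (cong (λ s → total y ℤ.+ weight s a) (lookup-replicate w inside))

  total-bump₂ : ∀ {n} (u v : Fin n) a b y → total (bump₂ u v a b y) ≡ total y ℤ.+ (a ℤ.+ b)
  total-bump₂ u v a b y = trans (total-bump u a (bump v b y)) (trans (cong (ℤ._+ a) (total-bump v b y)) (lemma (total y) a b))
    where
    lemma : ∀ x a b → x ℤ.+ b ℤ.+ a ≡ x ℤ.+ (a ℤ.+ b)
    lemma = solve-∀

  total-nonneg : ∀ {n} (y : Vec ℤ n) → (∀ w → 0ℤ ℤ.≤ lookup y w) → 0ℤ ℤ.≤ total y
  total-nonneg []      _  = ℤ.≤-refl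
  total-nonneg (x ∷ y) nn = ℤ.+-mono-≤ (nn Fin.zero) (total-nonneg y (nn ∘ Fin.suc))

  sumOn-none : ∀ {n} (y : Vec ℤ n) → sumOn none y ≡ 0ℤ
  sumOn-none []      = refl
  sumOn-none (x ∷ y) = trans (ℤ.+-identityˡ _) (sumOn-none y)

  sumOn-singleton : ∀ {n} (w : Fin n) y → sumOn ⁅ w ⁆ y ≡ lookup y w
  sumOn-singleton Fin.zero    (x ∷ y) = trans (cong (ℤ._+_ x) (sumOn-none y)) (ℤ.+-identityʳ x)
  sumOn-singleton (Fin.suc w) (x ∷ y) = trans (ℤ.+-identityˡ _) (sumOn-singleton w y)

  sumOn-modular : ∀ {n} (S T : Subset n) y → sumOn (S ∪ T) y ℤ.+ sumOn (S ∩ T) y ≡ sumOn S y ℤ.+ sumOn T y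
  sumOn-modular []      []      []      = refl
  sumOn-modular (s ∷ S) (t ∷ T) (x ∷ y) =
    trans (+-interchange (weight (s ∨ t) x) (sumOn (S ∪ T) y) (weight (s ∧ t) x) (sumOn (S ∩ T) y))
    (trans (cong₂ ℤ._+_ (sides s t) (sumOn-modular S T y))
           (+-interchange (weight s x) (weight t x) (sumOn S y) (sumOn T y)))
    where
    sides : ∀ s t → weight (s ∨ t) x ℤ.+ weight (s ∧ t) x ≡ weight s x ℤ.+ weight t x
    sides inside  inside  = refl
    sides inside  outside = refl
    sides outside inside  = ℤ.+-comm x 0ℤ
    sides outside outside = refl

  -- min (0 , 2 t) when both endpoints are inside, so that this one term stands
  -- for two facet functionals.
  cutTerm : Side → Side → ℤ → ℤ
  cutTerm outside outside t        = 0ℤ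
  cutTerm outside inside  t        = t
  cutTerm inside  outside t        = t
  cutTerm inside  inside  (+ k)    = 0ℤ
  cutTerm inside  inside  -[1+ k ] = -[1+ k ] ℤ.+ -[1+ k ]

  cut : ∀ {n m} → Multigraph n m → Subset n → Vec ℤ m → ℤ
  cut G S []      = 0ℤ
  cut G S (x ∷ t) = cutTerm (lookup S (proj₁ (endpoints G Fin.zero))) (lookup S (proj₂ (endpoints G Fin.zero))) x
                    ℤ.+ cut (deleteFirst G) S t

  -- The degree does not occur: the system is that of the cone over the polytope, and the degree of
  -- a point is its coordinate sum.
  CutInequalities : ∀ {n m} → Multigraph n m → Vec ℤ n × Vec ℤ m → Set
  CutInequalities G (y , t) = ∀ S → 0ℤ ℤ.≤ sumOn S y ℤ.+ cut G S t

  private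
    both≤0 : ∀ x → cutTerm inside inside x ℤ.≤ x ℤ.+ x
    both≤0 (+ k)    = ℤ.+≤+ z≤n
    both≤0 -[1+ k ] = ℤ.≤-refl

  -- Equality holds except for crossing sets, one containing only the first endpoint and the other
  -- only the second. There the claim is min (0 , 2 x) ≤ 2 x.
  cutTerm-submodular : ∀ a b a′ b′ x →
    cutTerm (a ∨ a′) (b ∨ b′) x ℤ.+ cutTerm (a ∧ a′) (b ∧ b′) x
    ℤ.≤ cutTerm a b x ℤ.+ cutTerm a′ b′ x
  cutTerm-submodular inside  inside  inside  inside  x = ℤ.≤-refl
  cutTerm-submodular inside  inside  inside  outside x = ℤ.≤-refl
  cutTerm-submodular inside  inside  outside inside  x = ℤ.≤-refl
  cutTerm-submodular inside  inside  outside outside x = ℤ.≤-refl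
  cutTerm-submodular inside  outside inside  inside  x = ℤ.≤-reflexive (ℤ.+-comm (cutTerm inside inside x) x)
  cutTerm-submodular inside  outside inside  outside x = ℤ.≤-refl
  cutTerm-submodular inside  outside outside inside  x = subst (ℤ._≤ x ℤ.+ x) (sym (ℤ.+-identityʳ _)) (both≤0 x)
  cutTerm-submodular inside  outside outside outside x = ℤ.≤-refl
  cutTerm-submodular outside inside  inside  inside  x = ℤ.≤-reflexive (ℤ.+-comm (cutTerm inside inside x) x)
  cutTerm-submodular outside inside  inside  outside x = subst (ℤ._≤ x ℤ.+ x) (sym (ℤ.+-identityʳ _)) (both≤0 x)
  cutTerm-submodular outside inside  outside inside  x = ℤ.≤-refl
  cutTerm-submodular outside inside  outside outside x = ℤ.≤-refl
  cutTerm-submodular outside outside inside  inside  x = ℤ.≤-reflexive (ℤ.+-comm (cutTerm inside inside x) 0ℤ)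
  cutTerm-submodular outside outside inside  outside x = ℤ.≤-reflexive (ℤ.+-comm x 0ℤ)
  cutTerm-submodular outside outside outside inside  x = ℤ.≤-reflexive (ℤ.+-comm x 0ℤ)
  cutTerm-submodular outside outside outside outside x = ℤ.≤-refl

  cut-submodular : ∀ {n m} (G : Multigraph n m) S T t →
    cut G (S ∪ T) t ℤ.+ cut G (S ∩ T) t ℤ.≤ cut G S t ℤ.+ cut G T t
  cut-submodular G S T []      = ℤ.≤-refl
  cut-submodular G S T (x ∷ t) =
    subst₂ ℤ._≤_ (sym (trans (cong₂ (λ a b → a ℤ.+ cut G₁ (S ∪ T) t ℤ.+ (b ℤ.+ cut G₁ (S ∩ T) t))
                          (cong₂ (λ a b → cutTerm a b x) (lookup-zipWith _∨_ u S T) (lookup-zipWith _∨_ v S T))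
                          (cong₂ (λ a b → cutTerm a b x) (lookup-zipWith _∧_ u S T) (lookup-zipWith _∧_ v S T)))
                        (+-interchange (cutTerm (lookup S u ∨ lookup T u) (lookup S v ∨ lookup T v) x) (cut G₁ (S ∪ T) t)
                                     (cutTerm (lookup S u ∧ lookup T u) (lookup S v ∧ lookup T v) x) (cut G₁ (S ∩ T) t))))
                 (+-interchange (cutTerm (lookup S u) (lookup S v) x) (cutTerm (lookup T u) (lookup T v) x) (cut G₁ S t) (cut G₁ T t))
      (ℤ.+-mono-≤ (cutTerm-submodular (lookup S u) (lookup S v) (lookup T u) (lookup T v) x) (cut-submodular G₁ S T t))
    where
    G₁ = deleteFirst G
    u = proj₁ (endpoints G Fin.zero)
    v = proj₂ (endpoints G Fin.zero)

  -- How the coordinate x of an edge, with |x| = k, changes the coordinates of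
  -- its endpoints: k copies of e_f and the two arrows contribute (i - k)(e_u - e_v)
  -- for some i ≤ 2 k, and k copies of ẽ_f contribute k (e_u + e_v).  The last two
  -- arguments undo this contribution.
  data Move : ℕ → ℤ → ℤ → ℤ → Set where
    arrows : ∀ {k i} → i ℕ.≤ 2 ℕ.* k → Move k (+ k) (+ k ℤ.- + i) (ℤ.- (+ k ℤ.- + i))
    tildes : ∀ {k} → Move (suc k) -[1+ k ] -[1+ k ] -[1+ k ]

  Nonnegative : ∀ {n} → Vec ℤ n → Set
  Nonnegative y = ∀ w → 0ℤ ℤ.≤ lookup y w

  -- Each edge claims degree `k` and its contribution is taken away from `y`. What is left after all
  -- edges is a point of a dilated standard simplex on the nodes.
  InDilate : ∀ {n m} → Multigraph n m → ℕ → Vec ℤ n × Vec ℤ m → Set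
  InDilate G j (y , [])    = Nonnegative y × total y ≡ + j
  InDilate G j (y , x ∷ t) = ∃[ k ] ∃[ l ] k ℕ.+ l ≡ j × ∃[ a ] ∃[ b ] Move k x a b ×
    InDilate (deleteFirst G) l (bump₂ (proj₁ (endpoints G Fin.zero)) (proj₂ (endpoints G Fin.zero)) a b y , t)

  -- Every generator has coordinate sum 1, so a move of degree `k` accounts for `k` of the total.
  inDilate-total : ∀ {n m} (G : Multigraph n m) {j} y t → InDilate G j (y , t) → total y ℤ.+ total t ≡ + j
  inDilate-total G y [] (_ , e) = trans (ℤ.+-identityʳ _) e
  inDilate-total G y (x ∷ t) (k , l , refl , a , b , mv , rest) =
    trans (sym (move mv)) (trans (cong (ℤ._+_ (+ k)) (trans (sym (cong (ℤ._+ total t) (total-bump₂ u v a b y)))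
      (inDilate-total (deleteFirst G) (bump₂ u v a b y) t rest))) (sym (ℤ.pos-+ k l)))
    where
    u = proj₁ (endpoints G Fin.zero)
    v = proj₂ (endpoints G Fin.zero)
    move : ∀ {k x a b} → Move k x a b → + k ℤ.+ (total y ℤ.+ (a ℤ.+ b) ℤ.+ total t) ≡ total y ℤ.+ (x ℤ.+ total t)
    move (arrows {k} {i} _) = lemma (+ k) (total y) (+ k ℤ.- + i) (total t)
      where
      lemma : ∀ k y c t → k ℤ.+ (y ℤ.+ (c ℤ.+ ℤ.- c) ℤ.+ t) ≡ y ℤ.+ (k ℤ.+ t)
      lemma = solve-∀
    move (tildes {k}) = lemma (+ suc k) (total y) (total t)
      where
      lemma : ∀ k y t → k ℤ.+ (y ℤ.+ (ℤ.- k ℤ.+ ℤ.- k) ℤ.+ t) ≡ y ℤ.+ (ℤ.- k ℤ.+ t)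
      lemma = solve-∀

  -- Eliminating the first edge from the cut inequalities.

  subsets-complete : ∀ {n} (S : Subset n) → S ∈ subsets n
  subsets-complete []            = here refl
  subsets-complete (outside ∷ S) = ∈-++⁺ˡ (∈-map⁺ (outside ∷_) (subsets-complete S))
  subsets-complete (inside ∷ S)  = ∈-++⁺ʳ (List.map (outside ∷_) (subsets _)) (∈-map⁺ (inside ∷_) (subsets-complete S))

  module _ {n m} (G : Multigraph n (suc m)) (y : Vec ℤ n) (t : Vec ℤ m) where
    private
      G₁ = deleteFirst G
      u = proj₁ (endpoints G Fin.zero)
      v = proj₂ (endpoints G Fin.zero)

      slack : Subset n → ℤ
      slack S = sumOn S y ℤ.+ cut G₁ S t

      Separates : Subset n → Set
      Separates S = lookup S u ≡ inside × lookup S v ≡ outside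

      separates? : ∀ S → Dec (Separates S)
      separates? S = lookup S u ≟ᵇ inside ×-dec lookup S v ≟ᵇ outside

      slack-submodular : ∀ S T → slack (S ∪ T) ℤ.+ slack (S ∩ T) ℤ.≤ slack S ℤ.+ slack T
      slack-submodular S T = subst₂ ℤ._≤_
        (+-interchange (sumOn (S ∪ T) y) (sumOn (S ∩ T) y) (cut G₁ (S ∪ T) t) (cut G₁ (S ∩ T) t))
        (trans (cong (ℤ._+ (cut G₁ S t ℤ.+ cut G₁ T t)) (sumOn-modular S T y)) (+-interchange (sumOn S y) (sumOn T y) (cut G₁ S t) (cut G₁ T t)))
        (ℤ.+-monoʳ-≤ (sumOn (S ∪ T) y ℤ.+ sumOn (S ∩ T) y) (cut-submodular G₁ S T t))

    cutInequalities-bump₂ : ∀ {a b} → (∀ S → 0ℤ ℤ.≤ sumOn S y ℤ.+ cut G₁ S t ℤ.+ (weight (lookup S u) a ℤ.+ weight (lookup S v) b)) →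
                            CutInequalities G₁ (bump₂ u v a b y , t)
    cutInequalities-bump₂ {a} {b} h S = subst (0ℤ ℤ.≤_)
      (trans (lemma (sumOn S y) (cut G₁ S t) (weight (lookup S u) a) (weight (lookup S v) b))
             (cong (ℤ._+ cut G₁ S t) (sym (sumOn-bump₂ S u v a b y)))) (h S)
      where
      lemma : ∀ s c p q → s ℤ.+ c ℤ.+ (p ℤ.+ q) ≡ s ℤ.+ q ℤ.+ p ℤ.+ c
      lemma = solve-∀

    -- For a negative coordinate `cutTerm` is linear in the sides, so the term of the edge is
    -- precisely what the forced move subtracts.
    cutInequalities-tildes : ∀ {k} → CutInequalities G (y , -[1+ k ] ∷ t) →
                             CutInequalities G₁ (bump₂ u v -[1+ k ] -[1+ k ] y , t)
    cutInequalities-tildes {k} h = cutInequalities-bump₂ λ S → subst (0ℤ ℤ.≤_)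
      (trans (lemma (sumOn S y) _ (cut G₁ S t)) (cong (ℤ._+_ (sumOn S y ℤ.+ cut G₁ S t)) (sides (lookup S u) (lookup S v)))) (h S)
      where
      lemma : ∀ s x c → s ℤ.+ (x ℤ.+ c) ≡ s ℤ.+ c ℤ.+ x
      lemma = solve-∀
      sides : ∀ a b → cutTerm a b -[1+ k ] ≡ weight a -[1+ k ] ℤ.+ weight b -[1+ k ]
      sides inside  inside  = refl
      sides inside  outside = refl
      sides outside inside  = refl
      sides outside outside = refl

    module _ {k : ℕ} (h : CutInequalities G (y , + k ∷ t)) where
      private
        h′ : ∀ S → 0ℤ ℤ.≤ slack S ℤ.+ cutTerm (lookup S u) (lookup S v) (+ k)
        h′ S = subst (0ℤ ℤ.≤_) (lemma (sumOn S y) _ (cut G₁ S t)) (h S)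
          where
          lemma : ∀ s x c → s ℤ.+ (x ℤ.+ c) ≡ s ℤ.+ c ℤ.+ x
          lemma = solve-∀

        balanced : ∀ S {s} → lookup S u ≡ s → lookup S v ≡ s → 0ℤ ℤ.≤ slack S
        balanced S {inside}  eu ev = subst (0ℤ ℤ.≤_)
          (trans (cong (ℤ._+_ (slack S)) (cong₂ (λ a b → cutTerm a b (+ k)) eu ev)) (ℤ.+-identityʳ _)) (h′ S)
        balanced S {outside} eu ev = subst (0ℤ ℤ.≤_)
          (trans (cong (ℤ._+_ (slack S)) (cong₂ (λ a b → cutTerm a b (+ k)) eu ev)) (ℤ.+-identityʳ _)) (h′ S)

        move-right : ∀ {a b} → 0ℤ ℤ.≤ a ℤ.+ b → ℤ.- a ℤ.≤ b
        move-right {a} {b} p = subst₂ ℤ._≤_ (ℤ.+-identityʳ _) (lemma a b) (ℤ.+-monoʳ-≤ (ℤ.- a) p)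
          where
          lemma : ∀ a b → ℤ.- a ℤ.+ (a ℤ.+ b) ≡ b
          lemma = solve-∀

        separated : ∀ S → Separates S → ℤ.- slack S ℤ.≤ + k
        separated S (eu , ev) = move-right (subst (λ c → 0ℤ ℤ.≤ slack S ℤ.+ c) (cong₂ (λ a b → cutTerm a b (+ k)) eu ev) (h′ S))

        candidates : List ℤ
        candidates = List.map (ℤ.-_ ∘ slack) (filter separates? (subsets n))

        c : ℤ
        -- The default is the lower bound that `Move` itself imposes. The maximum thus covers all
        -- lower bounds, and it exists even if no set separates the endpoints, as for a loop.
        c = Extrema.max (ℤ.- + k) candidates

        c-bounded : ∀ {x} → ℤ.- + k ℤ.≤ x → (∀ S → Separates S → ℤ.- slack S ℤ.≤ x) → c ℤ.≤ x
        c-bounded low sep with Extrema.argmax-sel (λ x → x) (ℤ.- + k) candidates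
        ... | inj₁ e = subst (ℤ._≤ _) (sym e) low
        ... | inj₂ i = let (S , S∈ , e) = ∈-map⁻ (ℤ.-_ ∘ slack) i
                       in subst (ℤ._≤ _) (sym e) (sep S (proj₂ (∈-filter⁻ separates? {xs = subsets n} S∈)))

        -k≤c : ℤ.- + k ℤ.≤ c
        -k≤c = Extrema.f[⊥]≤f[argmax] {f = λ x → x} (ℤ.- + k) candidates

        c≤k : c ℤ.≤ + k
        c≤k = c-bounded (ℤ.neg-≤-pos {k} {k}) separated

        lower : ∀ S → Separates S → ℤ.- slack S ℤ.≤ c
        lower S sep = All.lookup (Extrema.f[xs]≤f[argmax] {f = λ x → x} (ℤ.- + k) candidates)
          (∈-map⁺ (ℤ.-_ ∘ slack) (∈-filter⁺ separates? (subsets-complete S) sep))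

        upper : ∀ T → lookup T u ≡ outside → lookup T v ≡ inside → c ℤ.≤ slack T
        upper T eu ev = c-bounded
          (subst₂ ℤ._≤_ (ℤ.+-identityˡ _) (lemma (slack T) (+ k)) (ℤ.+-monoˡ-≤ (ℤ.- + k)
            (subst (λ c → 0ℤ ℤ.≤ slack T ℤ.+ c) (cong₂ (λ a b → cutTerm a b (+ k)) eu ev) (h′ T))))
          -- `S` contains only `u` and `T` only `v` of the two endpoints, so the union contains both
          -- and the intersection neither. Both of these have nonnegative slack, hence so has the
          -- sum for `S` and `T`.
          (λ S (su , sv) → move-right (ℤ.≤-trans (ℤ.+-mono-≤
            (balanced (S ∪ T) (trans (lookup-zipWith _∨_ u S T) (cong₂ _∨_ su eu))
                              (trans (lookup-zipWith _∨_ v S T) (cong₂ _∨_ sv ev)))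
            (balanced (S ∩ T) (trans (lookup-zipWith _∧_ u S T) (cong₂ _∧_ su eu))
                              (trans (lookup-zipWith _∧_ v S T) (cong₂ _∧_ sv ev))))
            (slack-submodular S T)))
          where
          lemma : ∀ x k → x ℤ.+ k ℤ.+ ℤ.- k ≡ x
          lemma = solve-∀

      -- c is the largest lower bound on the shift; by submodularity it satisfies
      -- all upper bounds.
      cutInequalities-arrows : ∃[ a ] ∃[ b ] Move k (+ k) a b × CutInequalities G₁ (bump₂ u v a b y , t)
      cutInequalities-arrows = c , ℤ.- c , move , cutInequalities-bump₂ shifted
        where
        -- `Move` shifts by k - i, which is to be `c`; the bounds -k ≤ c ≤ k say that i lies between
        -- 0 and 2k.
        i = ℤ.∣ + k ℤ.- c ∣
        +i≡ : + i ≡ + k ℤ.- c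
        +i≡ = ℤ.0≤i⇒+∣i∣≡i (ℤ.i≤j⇒0≤j-i c≤k)
        k-i≡c : + k ℤ.- + i ≡ c
        k-i≡c = trans (cong (λ x → + k ℤ.- x) +i≡) (lemma (+ k) c)
          where
          lemma : ∀ k c → k ℤ.- (k ℤ.- c) ≡ c
          lemma = solve-∀
        i≤2k : i ℕ.≤ 2 ℕ.* k
        i≤2k = ℤ.drop‿+≤+ (subst₂ ℤ._≤_ (sym +i≡) (trans (lemma (+ k)) (sym (ℤ.pos-* 2 k))) (ℤ.+-monoʳ-≤ (+ k) (ℤ.neg-mono-≤ -k≤c)))
          where
          lemma : ∀ k → k ℤ.+ ℤ.- (ℤ.- k) ≡ + 2 ℤ.* k
          lemma = solve-∀
        move : Move k (+ k) c (ℤ.- c)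
        move = subst (λ x → Move k (+ k) x (ℤ.- x)) k-i≡c (arrows i≤2k)
        shifted : ∀ S → 0ℤ ℤ.≤ slack S ℤ.+ (weight (lookup S u) c ℤ.+ weight (lookup S v) (ℤ.- c))
        shifted S with lookup S u in eu | lookup S v in ev
        ... | inside  | inside  = subst (0ℤ ℤ.≤_)
          (sym (trans (cong (ℤ._+_ (slack S)) (ℤ.+-inverseʳ c)) (ℤ.+-identityʳ _))) (balanced S eu ev)
        ... | outside | outside = subst (0ℤ ℤ.≤_) (sym (ℤ.+-identityʳ _)) (balanced S eu ev)
        ... | inside  | outside = subst₂ ℤ._≤_ (ℤ.+-inverseʳ (slack S)) (cong (ℤ._+_ (slack S)) (sym (ℤ.+-identityʳ c)))
          (ℤ.+-monoʳ-≤ (slack S) (lower S (eu , ev)))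
        ... | outside | inside  = subst (0ℤ ℤ.≤_) (cong (ℤ._+_ (slack S)) (sym (ℤ.+-identityˡ (ℤ.- c)))) (ℤ.i≤j⇒0≤j-i (upper S eu ev))

  -- Once no edges are left, the singletons give nonnegativity and the full set gives a nonnegative
  -- degree. Before that, the sign of the first coordinate decides between arrows and tildes.
  cutInequalities⇒inDilate : ∀ {n m} (G : Multigraph n m) y t → CutInequalities G (y , t) → ∃[ j ] InDilate G j (y , t)
  cutInequalities⇒inDilate G y [] h = ℤ.∣ total y ∣ ,
    (λ w → subst (0ℤ ℤ.≤_) (trans (ℤ.+-identityʳ _) (sumOn-singleton w y)) (h ⁅ w ⁆)) ,
    sym (ℤ.0≤i⇒+∣i∣≡i (subst (0ℤ ℤ.≤_) (ℤ.+-identityʳ _) (h full)))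
  cutInequalities⇒inDilate G y (+ k ∷ t) h =
    let (a , b , move , h′) = cutInequalities-arrows G y t h
        (l , rest) = cutInequalities⇒inDilate (deleteFirst G) _ t h′
    in k ℕ.+ l , k , l , refl , a , b , move , rest
  cutInequalities⇒inDilate G y (-[1+ k ] ∷ t) h =
    let (l , rest) = cutInequalities⇒inDilate (deleteFirst G) _ t (cutInequalities-tildes G y t h)
    in suc k ℕ.+ l , suc k , l , refl , -[1+ k ] , -[1+ k ] , tildes , rest

  -- Contraction of integer points along an edge.

  shift : ∀ {n} → Fin n → Fin n → ℤ → Vec ℤ n → Vec ℤ n
  shift u v a = bump₂ u v a (ℤ.- a)

  shift-0 : ∀ {n} (u v : Fin n) y → shift u v 0ℤ y ≡ y
  shift-0 = bump₂-0

  shift-shift : ∀ {n} (u v : Fin n) a b y → shift u v a (shift u v b y) ≡ shift u v (a ℤ.+ b) y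
  shift-shift u v a b y = trans (bump₂-bump₂ u v a (ℤ.- a) b (ℤ.- b) y)
    (cong (λ c → bump₂ u v (a ℤ.+ b) c y) (sym (ℤ.neg-distrib-+ a b)))

  shift-loop : ∀ {n} (u : Fin n) a y → shift u u a y ≡ y
  shift-loop u a y = trans (bump-bump u a (ℤ.- a) y) (trans (cong (λ b → bump u b y) (ℤ.+-inverseʳ a)) (bump-0 u y))

  lookup-bump : ∀ {n} (w : Fin n) a y → lookup (bump w a y) w ≡ lookup y w ℤ.+ a
  lookup-bump w a y = lookup∘updateAt w y

  lookup-bump′ : ∀ {n} (w x : Fin n) a y → w ≢ x → lookup (bump w a y) x ≡ lookup y x
  lookup-bump′ w x a y w≢x = lookup∘updateAt′ x w (w≢x ∘ sym) y

  removeAt-bump-punchOut : ∀ {n} (v : Fin (suc n)) {w} (v≢w : v ≢ w) a y →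
                           removeAt (bump w a y) v ≡ bump (punchOut v≢w) a (removeAt y v)
  removeAt-bump-punchOut Fin.zero {Fin.zero}  v≢w a y = contradiction refl v≢w
  removeAt-bump-punchOut Fin.zero {Fin.suc w} v≢w a (x ∷ y) = refl
  removeAt-bump-punchOut {suc n} (Fin.suc v) {Fin.zero}  v≢w a (x ∷ y@(_ ∷ _)) = refl
  removeAt-bump-punchOut {suc n} (Fin.suc v) {Fin.suc w} v≢w a (x ∷ y@(_ ∷ _)) =
    trans (removeAt-∷ (bump w a y)) (cong (x ∷_) (removeAt-bump-punchOut v (v≢w ∘ cong Fin.suc) a y))
    where
    removeAt-∷ : ∀ y → removeAt (x ∷ y) (Fin.suc v) ≡ x ∷ removeAt y v
    removeAt-∷ (_ ∷ _) = refl

  nonnegative-bump : ∀ {n} (w : Fin n) a y → Nonnegative y → 0ℤ ℤ.≤ lookup y w ℤ.+ a → Nonnegative (bump w a y)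
  nonnegative-bump w a y nn p x with w ≟ x
  ... | yes refl = subst (0ℤ ℤ.≤_) (sym (lookup-bump w a y)) p
  ... | no w≢x   = subst (0ℤ ℤ.≤_) (sym (lookup-bump′ w x a y w≢x)) (nn x)

  lookup-removeAt : ∀ {n} (v : Fin (suc n)) (y : Vec ℤ (suc n)) w → lookup (removeAt y v) w ≡ lookup y (punchIn v w)
  lookup-removeAt v y w = trans (sym (insertAt-punchIn (removeAt y v) v (lookup y v) w))
    (cong (λ z → lookup z (punchIn v w)) (insertAt-removeAt y v))

  total-insertAt : ∀ {n} (y : Vec ℤ n) v x → total (insertAt y v x) ≡ x ℤ.+ total y
  total-insertAt y       Fin.zero    x = refl
  total-insertAt (a ∷ y) (Fin.suc v) x = trans (cong (ℤ._+_ a) (total-insertAt y v x)) (lemma a x (total y))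
    where
    lemma : ∀ a x s → a ℤ.+ (x ℤ.+ s) ≡ x ℤ.+ (a ℤ.+ s)
    lemma = solve-∀

  total-removeAt : ∀ {n} (y : Vec ℤ (suc n)) v → lookup y v ≡ 0ℤ → total (removeAt y v) ≡ total y
  total-removeAt y v e = begin
    total (removeAt y v)                             ≡⟨ ℤ.+-identityˡ _ ⟨
    0ℤ ℤ.+ total (removeAt y v)                      ≡⟨ cong (ℤ._+ total (removeAt y v)) e ⟨
    lookup y v ℤ.+ total (removeAt y v)              ≡⟨ total-insertAt (removeAt y v) v (lookup y v) ⟨
    total (insertAt (removeAt y v) v (lookup y v))   ≡⟨ cong total (insertAt-removeAt y v) ⟩
    total y                                          ∎
    where open ≡-Reasoning

  total-shift : ∀ {n} (u v : Fin n) a y → total (shift u v a y) ≡ total y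
  total-shift u v a y = trans (total-bump₂ u v a (ℤ.- a) y)
    (trans (cong (ℤ._+_ (total y)) (ℤ.+-inverseʳ a)) (ℤ.+-identityʳ _))

  module _ {n} {u v : Fin (suc n)} (u≢v : u ≢ v) where

    lookup-shift : ∀ a y → lookup (shift u v a y) v ≡ lookup y v ℤ.- a
    lookup-shift a y = trans (lookup-bump′ u v a (bump v (ℤ.- a) y) u≢v) (lookup-bump v (ℤ.- a) y)

    private
      flatten : Vec ℤ (suc n) → Vec ℤ (suc n)
      flatten y = shift u v (lookup y v) y

      lookup-flatten : ∀ y → lookup (flatten y) v ≡ 0ℤ
      lookup-flatten y = trans (lookup-shift (lookup y v) y) (ℤ.+-inverseʳ (lookup y v))

    -- The linear map induced by `merge`: the coordinate at `v` is moved onto `u` and the zero left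
    -- behind is dropped. Its kernel is spanned by e_u - e_v.
    contract : Vec ℤ (suc n) → Vec ℤ n
    contract y = removeAt (flatten y) v

    contract-shift : ∀ a y → contract (shift u v a y) ≡ contract y
    contract-shift a y = cong (λ z → removeAt z v) (begin
      shift u v (lookup (shift u v a y) v) (shift u v a y)   ≡⟨ shift-shift u v _ a y ⟩
      shift u v (lookup (shift u v a y) v ℤ.+ a) y           ≡⟨ cong (λ b → shift u v (b ℤ.+ a) y) (lookup-shift a y) ⟩
      shift u v (lookup y v ℤ.- a ℤ.+ a) y                   ≡⟨ cong (λ b → shift u v b y) (cancel (lookup y v) a) ⟩
      shift u v (lookup y v) y                               ∎)
      where
      open ≡-Reasoning
      cancel : ∀ x a → x ℤ.- a ℤ.+ a ≡ x
      cancel = solve-∀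

    -- A flattened vector is zero at `v`, so its contraction determines it. Hence `y` and `z` have
    -- the same flattening, and each is a shift of it.
    contract-fibre : ∀ y z → contract y ≡ contract z → ∃[ a ] z ≡ shift u v a y
    contract-fibre y z e = ℤ.- lookup z v ℤ.+ lookup y v , (begin
      z                                                                ≡⟨ shift-0 u v z ⟨
      shift u v 0ℤ z                                                   ≡⟨ cong (λ b → shift u v b z) (ℤ.+-inverseˡ (lookup z v)) ⟨
      shift u v (ℤ.- lookup z v ℤ.+ lookup z v) z                      ≡⟨ shift-shift u v _ _ z ⟨
      shift u v (ℤ.- lookup z v) (flatten z)                           ≡⟨ cong (shift u v (ℤ.- lookup z v)) (insertAt-removeAt (flatten z) v) ⟨
      shift u v (ℤ.- lookup z v) (insertAt (contract z) v (lookup (flatten z) v))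
        ≡⟨ cong₂ (λ c x → shift u v (ℤ.- lookup z v) (insertAt c v x)) (sym e) (trans (lookup-flatten z) (sym (lookup-flatten y))) ⟩
      shift u v (ℤ.- lookup z v) (insertAt (contract y) v (lookup (flatten y) v))
        ≡⟨ cong (shift u v (ℤ.- lookup z v)) (insertAt-removeAt (flatten y) v) ⟩
      shift u v (ℤ.- lookup z v) (flatten y)                           ≡⟨ shift-shift u v _ _ y ⟩
      shift u v (ℤ.- lookup z v ℤ.+ lookup y v) y                      ∎)
      where open ≡-Reasoning

    -- A change at `v` is carried over to `u` by the flattening, in accordance with `merge`; any
    -- other change commutes with it.
    contract-bump : ∀ w a y → contract (bump w a y) ≡ bump (merge u≢v w) a (contract y)
    contract-bump w a y with v ≟ w
    ... | yes refl = trans (cong (λ z → removeAt z v) (begin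
      shift u v (lookup (bump v a y) v) (bump v a y)
        ≡⟨ cong (λ b → shift u v b (bump v a y)) (lookup-bump v a y) ⟩
      bump u (y-v ℤ.+ a) (bump v (ℤ.- (y-v ℤ.+ a)) (bump v a y))
        ≡⟨ cong (bump u (y-v ℤ.+ a)) (trans (bump-bump v _ a y) (cong (λ b → bump v b y) (cancel y-v a))) ⟩
      bump u (y-v ℤ.+ a) (bump v (ℤ.- y-v) y)
        ≡⟨ cong (λ b → bump u b (bump v (ℤ.- y-v) y)) (ℤ.+-comm y-v a) ⟩
      bump u (a ℤ.+ y-v) (bump v (ℤ.- y-v) y)
        ≡⟨ bump-bump u a y-v _ ⟨
      bump u a (flatten y) ∎)) (removeAt-bump-punchOut v (u≢v ∘ sym) a (flatten y))
      where
      open ≡-Reasoning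
      y-v = lookup y v
      cancel : ∀ x a → ℤ.- (x ℤ.+ a) ℤ.+ a ≡ ℤ.- x
      cancel = solve-∀
    ... | no v≢w = trans (cong (λ z → removeAt z v) (begin
      shift u v (lookup (bump w a y) v) (bump w a y)
        ≡⟨ cong (λ b → shift u v b (bump w a y)) (lookup-bump′ w v a y (v≢w ∘ sym)) ⟩
      bump u y-v (bump v (ℤ.- y-v) (bump w a y))   ≡⟨ cong (bump u y-v) (bump-comm v w _ a y) ⟩
      bump u y-v (bump w a (bump v (ℤ.- y-v) y))   ≡⟨ bump-comm u w y-v a _ ⟩
      bump w a (flatten y)                         ∎)) (removeAt-bump-punchOut v v≢w a (flatten y))
      where
      open ≡-Reasoning
      y-v = lookup y v

    contract-bump₂ : ∀ w x a b y → contract (bump₂ w x a b y) ≡ bump₂ (merge u≢v w) (merge u≢v x) a b (contract y)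
    contract-bump₂ w x a b y = trans (contract-bump w a (bump x b y)) (cong (bump (merge u≢v w) a) (contract-bump x b y))

    private
      section : Vec ℤ n → Vec ℤ (suc n)
      section q = insertAt q v 0ℤ

      contract-section : ∀ q → contract (section q) ≡ q
      contract-section q = trans (cong (λ z → removeAt z v) (trans
        (cong (λ b → shift u v b (section q)) (insertAt-lookup q v 0ℤ)) (shift-0 u v (section q)))) (removeAt-insertAt q v 0ℤ)

      nonnegative-section : ∀ q → Nonnegative q → Nonnegative (section q)
      nonnegative-section q nn w with v ≟ w
      ... | yes refl = ℤ.≤-reflexive (sym (insertAt-lookup q v 0ℤ))
      ... | no v≢w   = subst (0ℤ ℤ.≤_) (trans (cong (λ z → lookup z (punchOut v≢w)) (sym (removeAt-insertAt q v 0ℤ)))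
                         (removeAt-punchOut (section q) v≢w)) (nn (punchOut v≢w))

      nonnegative-contract : ∀ y → Nonnegative y → Nonnegative (contract y)
      nonnegative-contract y nn w = subst (0ℤ ℤ.≤_) (sym (lookup-removeAt v (flatten y) w))
        (nonnegative-bump u (lookup y v) (bump v (ℤ.- lookup y v) y)
          (nonnegative-bump v (ℤ.- lookup y v) y nn (ℤ.≤-reflexive (sym (ℤ.+-inverseʳ (lookup y v)))))
          (ℤ.+-mono-≤ (subst (0ℤ ℤ.≤_) (sym (lookup-bump′ v u (ℤ.- lookup y v) y (u≢v ∘ sym))) (nn u)) (nn v)) (punchIn v w))

    -- Moves pass through the contraction by `contract-bump₂`, so only the edgeless case matters:
    -- adding two nonnegative coordinates keeps the sign and the total.
    inDilate-contract : ∀ {m} (G : Multigraph (suc n) m) {j} y t →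
                        InDilate G j (y , t) → InDilate (mapNodes (merge u≢v) G) j (contract y , t)
    inDilate-contract G y [] (nn , e) = nonnegative-contract y nn ,
      trans (total-removeAt (flatten y) v (lookup-flatten y)) (trans (total-shift u v (lookup y v) y) e)
    inDilate-contract G y (x ∷ t) (k , l , e , a , b , move , rest) = k , l , e , a , b , move ,
      subst (λ q → InDilate (mapNodes (merge u≢v) (deleteFirst G)) l (q , t)) (contract-bump₂ _ _ a b y)
        (inDilate-contract (deleteFirst G) _ t rest)

    -- The edgeless remainder is lifted by inserting a zero at `v`; undoing the same moves upstairs
    -- then lifts the given point.
    inDilate-lift : ∀ {m} (G : Multigraph (suc n) m) {j} q t → InDilate (mapNodes (merge u≢v) G) j (q , t) →
                    ∃[ y ] InDilate G j (y , t) × contract y ≡ q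
    inDilate-lift G q [] (nn , e) = section q ,
      (nonnegative-section q nn , trans (total-insertAt q v 0ℤ) (trans (ℤ.+-identityˡ _) e)) , contract-section q
    inDilate-lift G q (x ∷ t) (k , l , e , a , b , move , rest) =
      let (y , y∈ , eq) = inDilate-lift (deleteFirst G) _ t rest
      in bump₂ w₁ w₂ (ℤ.- a) (ℤ.- b) y ,
         (k , l , e , a , b , move , subst (λ y → InDilate (deleteFirst G) l (y , t)) (sym (bump₂-inverse w₁ w₂ a b y)) y∈) ,
         trans (contract-bump₂ w₁ w₂ (ℤ.- a) (ℤ.- b) y)
           (trans (cong (bump₂ (merge u≢v w₁) (merge u≢v w₂) (ℤ.- a) (ℤ.- b)) eq)
                  (bump₂-inverse′ (merge u≢v w₁) (merge u≢v w₂) a b q))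
      where
      w₁ = proj₁ (endpoints G Fin.zero)
      w₂ = proj₂ (endpoints G Fin.zero)

-- Integer points as sums of generators.

open Multigraph
open GraphContraction
open LatticeCombinatorics

bump-++ˡ : ∀ {n m} (u : Fin n) a (y : Vec ℤ n) (t : Vec ℤ m) → bump (u ↑ˡ m) a (y ++ t) ≡ bump u a y ++ t
bump-++ˡ Fin.zero    a (x ∷ y) t = ≡.refl
bump-++ˡ (Fin.suc u) a (x ∷ y) t = cong (x ∷_) (bump-++ˡ u a y t)

bump-++ʳ : ∀ {n m} (f : Fin m) a (y : Vec ℤ n) (t : Vec ℤ m) → bump (n ↑ʳ f) a (y ++ t) ≡ y ++ bump f a t
bump-++ʳ f a []      t = ≡.refl
bump-++ʳ f a (x ∷ y) t = cong (x ∷_) (bump-++ʳ f a y t)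

-- The tail is built first, with head zero, and then the head is raised by unit steps, so that every
-- intermediate vector is reached from the base by increments.
nonnegative-induction : ∀ {n} (P : ℕ → Vec ℤ n → Set) → P 0 (replicate n 0ℤ) →
  (∀ {j y} w → P j y → P (suc j) (bump w 1ℤ y)) → ∀ {j} y → Nonnegative y → total y ≡ + j → P j y
nonnegative-induction P base step []      _  ≡.refl = base
nonnegative-induction P base step (x ∷ y) nn e with x | nn Fin.zero
... | + k | _ = subst (λ i → P i (+ k ∷ y)) (ℤ.+-injective (≡.trans (ℤ.pos-+ k l) (≡.trans (cong (ℤ._+_ (+ k)) +l≡) e)))
                  (raise k (nonnegative-induction (λ j y → P j (0ℤ ∷ y)) base (λ w → step (Fin.suc w)) y (nn ∘ Fin.suc) (≡.sym +l≡)))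
  where
  l = ℤ.∣ total y ∣
  +l≡ : + l ≡ total y
  +l≡ = ℤ.0≤i⇒+∣i∣≡i (total-nonneg y (nn ∘ Fin.suc))
  raise : ∀ k → P l (0ℤ ∷ y) → P (k ℕ.+ l) (+ k ∷ y)
  raise zero    p = p
  raise (suc k) p = subst (λ i → P (suc (k ℕ.+ l)) (+ i ∷ y)) (ℕ.+-comm k 1) (step Fin.zero (raise k p))

module Geometry {c ℓ₁ ℓ₂} (K : OrderedField c ℓ₁ ℓ₂) where
  open OrderedField K
  open Polytopes K
  open FieldArithmetic K
  open import Algebra.Properties.Semiring.Sum semiring
  open import Algebra.Properties.Ring ring using () renaming (-0#≈0# to -0≈0)
  open import Relation.Binary.Reasoning.Setoid setoid

  act : ∀ {n m} (G : Multigraph n m) → Generator G → Vec ℤ n × Vec ℤ m → Vec ℤ n × Vec ℤ m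
  act G (node u)  (y , t) = bump u 1ℤ y , t
  act G (edge f)  (y , t) = y , bump f 1ℤ t
  act G (tilde f) (y , t) = bump₂ (proj₁ (endpoints G f)) (proj₂ (endpoints G f)) 1ℤ 1ℤ y , bump f -1ℤ t
  act G (left f)  (y , t) = bump₂ (proj₁ (endpoints G f)) (proj₂ (endpoints G f)) 1ℤ -1ℤ y , bump f 1ℤ t
  act G (right f) (y , t) = bump₂ (proj₁ (endpoints G f)) (proj₂ (endpoints G f)) -1ℤ 1ℤ y , bump f 1ℤ t

  -- The semigroup generated by the generators, graded by the number of summands.
  data Generated {n m} (G : Multigraph n m) : ℕ → Vec ℤ n × Vec ℤ m → Set where
    origin : Generated G 0 (replicate n 0ℤ , replicate m 0ℤ)
    add    : ∀ {j p} g → Generated G j p → Generated G (suc j) (act G g p)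

  generated-deleteFirst : ∀ {n m} (G : Multigraph n (suc m)) {j y t} →
                          Generated (deleteFirst G) j (y , t) → Generated G j (y , 0ℤ ∷ t)
  generated-deleteFirst G origin                = origin
  generated-deleteFirst G (add (node u) p)  = add (node u) (generated-deleteFirst G p)
  generated-deleteFirst G (add (edge f) p)  = add (edge (Fin.suc f)) (generated-deleteFirst G p)
  generated-deleteFirst G (add (tilde f) p) = add (tilde (Fin.suc f)) (generated-deleteFirst G p)
  generated-deleteFirst G (add (left f) p)  = add (left (Fin.suc f)) (generated-deleteFirst G p)
  generated-deleteFirst G (add (right f) p) = add (right (Fin.suc f)) (generated-deleteFirst G p)

  module _ {n m} (G : Multigraph n (suc m)) {l : ℕ} {y : Vec ℤ n} {t : Vec ℤ m} (p : Generated G l (y , 0ℤ ∷ t)) where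
    private
      u = proj₁ (endpoints G Fin.zero)
      v = proj₂ (endpoints G Fin.zero)

      add-bump₂ : ∀ {k x x′ a b a″ b″} a′ b′ g → (∀ y → act G g (y , x ∷ t) ≡ (bump₂ u v a′ b′ y , x′ ∷ t)) →
                  a′ ℤ.+ a ≡ a″ → b′ ℤ.+ b ≡ b″ →
                  Generated G k (bump₂ u v a b y , x ∷ t) → Generated G (suc k) (bump₂ u v a″ b″ y , x′ ∷ t)
      add-bump₂ {a = a} {b} a′ b′ g e ≡.refl ≡.refl q = subst (Generated G _)
        (≡.trans (e _) (cong (_, _) (bump₂-bump₂ u v a′ b′ a b y))) (add g q)

    generated-tildes : ∀ k → Generated G (suc k ℕ.+ l) (bump₂ u v (+ suc k) (+ suc k) y , -[1+ k ] ∷ t)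
    generated-tildes zero    = add (tilde Fin.zero) p
    generated-tildes (suc k) = add-bump₂ 1ℤ 1ℤ (tilde Fin.zero)
      (λ y → cong (λ i → bump₂ u v 1ℤ 1ℤ y , -[1+ i ] ∷ t) (cong suc (ℕ.+-identityʳ k)))
      ≡.refl ≡.refl (generated-tildes k)

    -- `k` summands must produce (i - k)(e_u - e_v). A `left` lowers `i` by two and `k` by one; once
    -- `i` is 1 an `edge` is used, and once it is 0 every remaining summand is a `right`.
    generated-arrows : ∀ k i → i ℕ.≤ 2 ℕ.* k →
      Generated G (k ℕ.+ l) (bump₂ u v (ℤ.- (+ k ℤ.- + i)) (ℤ.- (ℤ.- (+ k ℤ.- + i))) y , + k ∷ t)
    generated-arrows zero    zero    _ = subst (λ y → Generated G l (y , 0ℤ ∷ t)) (≡.sym (bump₂-0 u v y)) p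
    generated-arrows (suc k) zero    _ = add-bump₂ -1ℤ 1ℤ (right Fin.zero)
      (λ y → cong (λ i → bump₂ u v -1ℤ 1ℤ y , + i ∷ t) (ℕ.+-comm k 1))
      (shiftˡ (+ k)) (shiftʳ (+ k)) (generated-arrows k 0 z≤n)
      where
      shiftˡ : ∀ k → -1ℤ ℤ.+ ℤ.- (k ℤ.- 0ℤ) ≡ ℤ.- (1ℤ ℤ.+ k ℤ.- 0ℤ)
      shiftˡ = solve-∀
      shiftʳ : ∀ k → 1ℤ ℤ.+ ℤ.- (ℤ.- (k ℤ.- 0ℤ)) ≡ ℤ.- (ℤ.- (1ℤ ℤ.+ k ℤ.- 0ℤ))
      shiftʳ = solve-∀
    generated-arrows (suc k) (suc zero) _ = add-bump₂ 0ℤ 0ℤ (edge Fin.zero)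
      (λ y → cong₂ (λ y′ i → y′ , + i ∷ t) (≡.sym (bump₂-0 u v y)) (ℕ.+-comm k 1))
      (shiftˡ (+ k)) (shiftʳ (+ k)) (generated-arrows k 0 z≤n)
      where
      shiftˡ : ∀ k → 0ℤ ℤ.+ ℤ.- (k ℤ.- 0ℤ) ≡ ℤ.- (1ℤ ℤ.+ k ℤ.- 1ℤ)
      shiftˡ = solve-∀
      shiftʳ : ∀ k → 0ℤ ℤ.+ ℤ.- (ℤ.- (k ℤ.- 0ℤ)) ≡ ℤ.- (ℤ.- (1ℤ ℤ.+ k ℤ.- 1ℤ))
      shiftʳ = solve-∀
    generated-arrows (suc k) (suc (suc i)) (s≤s i+1≤) = add-bump₂ 1ℤ -1ℤ (left Fin.zero)
      (λ y → cong (λ i → bump₂ u v 1ℤ -1ℤ y , + i ∷ t) (ℕ.+-comm k 1))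
      (shiftˡ (+ k) (+ i)) (shiftʳ (+ k) (+ i)) (generated-arrows k i (ℕ.≤-pred (subst (suc i ℕ.≤_) (ℕ.+-suc k (k ℕ.+ 0)) i+1≤)))
      where
      shiftˡ : ∀ k i → 1ℤ ℤ.+ ℤ.- (k ℤ.- i) ≡ ℤ.- (1ℤ ℤ.+ k ℤ.- (+ 2 ℤ.+ i))
      shiftˡ = solve-∀
      shiftʳ : ∀ k i → -1ℤ ℤ.+ ℤ.- (ℤ.- (k ℤ.- i)) ≡ ℤ.- (ℤ.- (1ℤ ℤ.+ k ℤ.- (+ 2 ℤ.+ i)))
      shiftʳ = solve-∀

  inDilate⇒generated : ∀ {n m} (G : Multigraph n m) {j} y t → InDilate G j (y , t) → Generated G j (y , t)
  inDilate⇒generated G y [] (nn , e) =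
    nonnegative-induction (λ j y → Generated G j (y , [])) origin (λ w → add (node w)) y nn e
  inDilate⇒generated G y (_ ∷ t) (k , l , ≡.refl , a , b , arrows {i = i} i≤2k , rest) =
    subst (λ y → Generated G _ (y , + k ∷ t)) (bump₂-inverse′ u v a b y)
      (generated-arrows G (generated-deleteFirst G (inDilate⇒generated (deleteFirst G) (bump₂ u v a b y) t rest)) k i i≤2k)
    where
    u = proj₁ (endpoints G Fin.zero)
    v = proj₂ (endpoints G Fin.zero)
  inDilate⇒generated G y (_ ∷ t) (suc k , l , ≡.refl , a , b , tildes , rest) =
    subst (λ y → Generated G _ (y , -[1+ k ] ∷ t)) (bump₂-inverse′ u v a b y)
      (generated-tildes G (generated-deleteFirst G (inDilate⇒generated (deleteFirst G) (bump₂ u v a b y) t rest)) k)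
    where
    u = proj₁ (endpoints G Fin.zero)
    v = proj₂ (endpoints G Fin.zero)

  point : ∀ {N} → Vec ℤ N → Point N
  point x i = fromℤ (lookup x i)

  point-bump⁺ : ∀ {N} w (x : Vec ℤ N) i → point (bump w 1ℤ x) i ≈ δ w i + point x i
  point-bump⁺ w x i with w ≟ i
  ... | yes ≡.refl = trans (reflexive (cong fromℤ (lookup∘updateAt w x)))
                       (trans (fromℤ-+ (lookup x w) 1ℤ) (trans (+-comm _ _) (+-congʳ (+-identityʳ 1#))))
  ... | no w≢i     = trans (reflexive (cong fromℤ (lookup∘updateAt′ i w (w≢i ∘ ≡.sym) x))) (sym (+-identityˡ _))

  point-bump⁻ : ∀ {N} w (x : Vec ℤ N) i → point (bump w -1ℤ x) i ≈ - δ w i + point x i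
  point-bump⁻ w x i with w ≟ i
  ... | yes ≡.refl = trans (reflexive (cong fromℤ (lookup∘updateAt w x)))
                       (trans (fromℤ-+ (lookup x w) -1ℤ) (trans (+-comm _ _) (+-congʳ (-‿cong (+-identityʳ 1#)))))
  ... | no w≢i     = trans (reflexive (cong fromℤ (lookup∘updateAt′ i w (w≢i ∘ ≡.sym) x)))
                       (trans (sym (+-identityˡ _)) (+-congʳ (sym -0≈0)))

  point-bumps : ∀ {n m} (u v : Fin n) (f : Fin m) {a b d} {A B D : Point (n ℕ.+ m)} →
    (∀ x i → point (bump (u ↑ˡ m) a x) i ≈ A i + point x i) →
    (∀ x i → point (bump (v ↑ˡ m) b x) i ≈ B i + point x i) →
    (∀ x i → point (bump (n ↑ʳ f) d x) i ≈ D i + point x i) →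
    ∀ y t i → point (bump₂ u v a b y ++ bump f d t) i ≈ A i + B i + D i + point (y ++ t) i
  point-bumps {n} {m} u v f {a} {b} {d} {A} {B} {D} pa pb pd y t i = begin
    point (bump₂ u v a b y ++ bump f d t) i            ≡⟨ cong (λ x → point x i) bumps ⟨
    point (bump (u ↑ˡ m) a (bump (v ↑ˡ m) b x)) i      ≈⟨ pa (bump (v ↑ˡ m) b x) i ⟩
    A i + point (bump (v ↑ˡ m) b x) i                  ≈⟨ +-congˡ (pb x i) ⟩
    A i + (B i + point x i)                            ≈⟨ +-congˡ (+-congˡ (pd (y ++ t) i)) ⟩
    A i + (B i + (D i + point (y ++ t) i))             ≈⟨ +-assoc (A i) (B i) _ ⟨
    A i + B i + (D i + point (y ++ t) i)               ≈⟨ +-assoc (A i + B i) (D i) _ ⟨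
    A i + B i + D i + point (y ++ t) i                 ∎
    where
    x = bump (n ↑ʳ f) d (y ++ t)
    bumps : bump (u ↑ˡ m) a (bump (v ↑ˡ m) b x) ≡ bump₂ u v a b y ++ bump f d t
    bumps = ≡.trans (cong (bump (u ↑ˡ m) a) (≡.trans (cong (bump (v ↑ˡ m) b) (bump-++ʳ f d y t)) (bump-++ˡ v b y (bump f d t))))
                    (bump-++ˡ u a (bump v b y) (bump f d t))

  point-act : ∀ {n m} (G : Multigraph n m) g y t i → let (y′ , t′) = act G g (y , t) in
              point (y′ ++ t′) i ≈ generator G g i + point (y ++ t) i
  point-act {n} {m} G (node u) y t i =
    trans (reflexive (cong (λ x → point x i) (≡.sym (bump-++ˡ u 1ℤ y t)))) (point-bump⁺ (u ↑ˡ m) (y ++ t) i)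
  point-act {n} {m} G (edge f) y t i =
    trans (reflexive (cong (λ x → point x i) (≡.sym (bump-++ʳ f 1ℤ y t)))) (point-bump⁺ (n ↑ʳ f) (y ++ t) i)
  point-act {n} {m} G (tilde f) y t i = point-bumps _ _ f (point-bump⁺ _) (point-bump⁺ _) (point-bump⁻ (n ↑ʳ f)) y t i
  point-act {n} {m} G (left f)  y t i = point-bumps _ _ f (point-bump⁺ _) (point-bump⁻ _) (point-bump⁺ (n ↑ʳ f)) y t i
  point-act {n} {m} G (right f) y t i = point-bumps _ _ f (point-bump⁻ _) (point-bump⁺ _) (point-bump⁺ (n ↑ʳ f)) y t i

-- The cut inequalities as linear functionals.

weightedSum : ∀ {N} → Vec ℕ N → Vec ℤ N → ℤ
weightedSum []       []      = 0ℤ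
weightedSum (a ∷ as) (x ∷ y) = + a ℤ.* x ℤ.+ weightedSum as y

weightedSum-++ : ∀ {n m} (as : Vec ℕ n) (bs : Vec ℕ m) y t →
                 weightedSum (as ++ bs) (y ++ t) ≡ weightedSum as y ℤ.+ weightedSum bs t
weightedSum-++ []       bs []      t = ≡.sym (ℤ.+-identityˡ _)
weightedSum-++ (a ∷ as) bs (x ∷ y) t =
  ≡.trans (cong (ℤ._+_ (+ a ℤ.* x)) (weightedSum-++ as bs y t)) (≡.sym (ℤ.+-assoc (+ a ℤ.* x) _ _))

weightedSum-ones : ∀ {N} (x : Vec ℤ N) → weightedSum (replicate N 1) x ≡ total x
weightedSum-ones []      = ≡.refl
weightedSum-ones (x ∷ y) = cong₂ ℤ._+_ (ℤ.*-identityˡ x) (weightedSum-ones y)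

total-++ : ∀ {n m} (y : Vec ℤ n) (t : Vec ℤ m) → total (y ++ t) ≡ total y ℤ.+ total t
total-++ []      t = ≡.sym (ℤ.+-identityˡ _)
total-++ (x ∷ y) t = ≡.trans (cong (ℤ._+_ x) (total-++ y t)) (≡.sym (ℤ.+-assoc x _ _))

sideWeight : Side → ℕ
sideWeight inside  = 1
sideWeight outside = 0

-- The linear function of x that attains the minimum cutTerm a b x.
cutWeight : Side → Side → ℤ → ℕ
cutWeight outside outside x        = 0
cutWeight outside inside  x        = 1
cutWeight inside  outside x        = 1
cutWeight inside  inside  (+ _)    = 0
cutWeight inside  inside  -[1+ _ ] = 2

cutWeights : ∀ {n m} → Multigraph n m → Subset n → Vec ℤ m → Vec ℕ m
cutWeights G S []      = []
cutWeights G S (x ∷ t) = cutWeight (lookup S (proj₁ (endpoints G Fin.zero))) (lookup S (proj₂ (endpoints G Fin.zero))) x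
                         ∷ cutWeights (deleteFirst G) S t

lookup-cutWeights : ∀ {n m} (G : Multigraph n m) S t f → lookup (cutWeights G S t) f ≡
  cutWeight (lookup S (proj₁ (endpoints G f))) (lookup S (proj₂ (endpoints G f))) (lookup t f)
lookup-cutWeights G S (x ∷ t) Fin.zero    = ≡.refl
lookup-cutWeights G S (x ∷ t) (Fin.suc f) = lookup-cutWeights (deleteFirst G) S t f

weightedSum-sides : ∀ {n} (S : Subset n) y → weightedSum (Vec.map sideWeight S) y ≡ sumOn S y
weightedSum-sides []            []      = ≡.refl
weightedSum-sides (inside ∷ S)  (x ∷ y) = cong₂ ℤ._+_ (ℤ.*-identityˡ x) (weightedSum-sides S y)
weightedSum-sides (outside ∷ S) (x ∷ y) = cong (ℤ._+_ 0ℤ) (weightedSum-sides S y)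

weightedSum-cut : ∀ {n m} (G : Multigraph n m) S t → weightedSum (cutWeights G S t) t ≡ cut G S t
weightedSum-cut G S []      = ≡.refl
weightedSum-cut G S (x ∷ t) = cong₂ ℤ._+_ (cutWeight-* (lookup S _) (lookup S _) x) (weightedSum-cut (deleteFirst G) S t)
  where
  cutWeight-* : ∀ a b x → + cutWeight a b x ℤ.* x ≡ cutTerm a b x
  cutWeight-* outside outside x        = ≡.refl
  cutWeight-* outside inside  x        = ℤ.*-identityˡ x
  cutWeight-* inside  outside x        = ℤ.*-identityˡ x
  cutWeight-* inside  inside  (+ k)    = ≡.refl
  cutWeight-* inside  inside  -[1+ k ] = ≡.trans (ℤ.suc-* 1ℤ -[1+ k ]) (cong (ℤ._+_ -[1+ k ]) (ℤ.*-identityˡ -[1+ k ]))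

-- This and the next two are the values of the functional on the generators of an edge. They are
-- nonnegative because `cutWeight` lies between the absolute difference and the sum of the two side
-- weights.
tilde-weight : ∀ a b x → 0ℤ ℤ.≤ + sideWeight a ℤ.+ + sideWeight b ℤ.+ ℤ.- + cutWeight a b x
tilde-weight outside outside x        = ℤ.+≤+ z≤n
tilde-weight outside inside  x        = ℤ.+≤+ z≤n
tilde-weight inside  outside x        = ℤ.+≤+ z≤n
tilde-weight inside  inside  (+ _)    = ℤ.+≤+ z≤n
tilde-weight inside  inside  -[1+ _ ] = ℤ.+≤+ z≤n

left-weight : ∀ a b x → 0ℤ ℤ.≤ + sideWeight a ℤ.+ ℤ.- + sideWeight b ℤ.+ + cutWeight a b x
left-weight outside outside x        = ℤ.+≤+ z≤n
left-weight outside inside  x        = ℤ.+≤+ z≤n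
left-weight inside  outside x        = ℤ.+≤+ z≤n
left-weight inside  inside  (+ _)    = ℤ.+≤+ z≤n
left-weight inside  inside  -[1+ _ ] = ℤ.+≤+ z≤n

right-weight : ∀ a b x → 0ℤ ℤ.≤ ℤ.- + sideWeight a ℤ.+ + sideWeight b ℤ.+ + cutWeight a b x
right-weight outside outside x        = ℤ.+≤+ z≤n
right-weight outside inside  x        = ℤ.+≤+ z≤n
right-weight inside  outside x        = ℤ.+≤+ z≤n
right-weight inside  inside  (+ _)    = ℤ.+≤+ z≤n
right-weight inside  inside  -[1+ _ ] = ℤ.+≤+ z≤n

-- Lattice points of the dilates, and the dimension.

module LatticeGeometry {c ℓ₁ ℓ₂} (K : OrderedField c ℓ₁ ℓ₂) where
  open OrderedField K
  open Polytopes K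
  open FieldArithmetic K
  open Geometry K
  open import Algebra.Properties.Semiring.Sum semiring
  open import Algebra.Properties.Monoid.Mult +-monoid using (×-congʳ) renaming (_×_ to _·_)
  open import Algebra.Properties.Semiring.Mult semiring using (×-assoc-*)
  open import Relation.Binary.Reasoning.Setoid setoid
  open IsTotalOrder isTotalOrder using (≤-respʳ-≈)

  private
    lookup-zeros : ∀ n m i → lookup (replicate n 0ℤ ++ replicate m 0ℤ) i ≡ 0ℤ
    lookup-zeros zero    m i           = lookup-replicate i 0ℤ
    lookup-zeros (suc n) m Fin.zero    = ≡.refl
    lookup-zeros (suc n) m (Fin.suc i) = lookup-zeros n m i

  generated⇒sum : ∀ {n m} (G : Multigraph n m) {j y t} → Generated G j (y , t) →
    Σ[ g ∈ (Fin j → Generator G) ] (∀ i → point (y ++ t) i ≈ sum (λ a → generator G (g a) i))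
  generated⇒sum {n} {m} G origin = (λ ()) , λ i → reflexive (cong fromℤ (lookup-zeros n m i))
  generated⇒sum {n} {m} G (add {p = y , t} g p) =
    let (gs , e) = generated⇒sum G p
    in (λ { Fin.zero → g ; (Fin.suc a) → gs a }) , λ i → trans (point-act G g y t i) (+-congˡ (e i))

  generator∈polytope : ∀ {n m} (G : Multigraph n m) g → CosmologicalPolytope G (generator G g)
  generator∈polytope G g = 1 , (λ _ → g) , (λ _ → 1#) , (λ _ → 0≤1) , +-identityʳ 1# ,
    λ i → sym (trans (+-identityʳ _) (*-identityˡ _))

  generated⇒dilate : ∀ {n m} (G : Multigraph (suc n) m) {j y t} → Generated G j (y , t) →
                     LatticePoints (Dilate j (CosmologicalPolytope G)) (y ++ t)
  -- The zeroth dilate is the origin only if the polytope has a point at all; a node supplies one.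
  generated⇒dilate G {zero} p = _ , generator∈polytope G (node Fin.zero) ,
    λ i → trans (proj₂ (generated⇒sum G p) i) (sym (zeroˡ _))
  generated⇒dilate G {suc j} {y} {t} p =
    let (g , e) = generated⇒sum G p
        -- The sum of `suc j` generators is `suc j` times their average, so all weights are the
        -- reciprocal `r`.
        (r , rinv , 0≤r) = reciprocal j
    in combination (λ _ → r) (generator G ∘ g) ,
       (suc j , g , (λ _ → r) , (λ _ → 0≤r) ,
        trans (sum-replicate (suc j)) (trans (trans (×-congʳ (suc j) (sym (*-identityˡ r))) (sym (×-assoc-* (suc j) 1# r))) rinv) ,
        λ _ → refl) ,
       λ i → begin
         point (y ++ t) i                                             ≈⟨ e i ⟩
         sum (λ a → generator G (g a) i)                              ≈⟨ *-identityˡ _ ⟨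
         1# * sum (λ a → generator G (g a) i)                         ≈⟨ *-congʳ rinv ⟨
         (suc j · 1#) * r * sum (λ a → generator G (g a) i)           ≈⟨ *-assoc _ r _ ⟩
         (suc j · 1#) * (r * sum (λ a → generator G (g a) i))         ≈⟨ *-congˡ (*-distribˡ-sum r (λ a → generator G (g a) i)) ⟩
         (suc j · 1#) * combination (λ _ → r) (generator G ∘ g) i     ∎

  ⟨⟩-weights : ∀ {N} (as : Vec ℕ N) (x : Vec ℤ N) →
               ⟨ (λ i → lookup as i · 1#) , point x ⟩ ≈ fromℤ (weightedSum as x)
  ⟨⟩-weights []       []      = refl
  ⟨⟩-weights (a ∷ as) (x ∷ y) = trans (+-cong (sym (fromℤ-· a x)) (⟨⟩-weights as y)) (sym (fromℤ-+ (+ a ℤ.* x) _))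

  ⟨⟩-generator : ∀ {n m} (G : Multigraph n m) → (Point (n ℕ.+ m)) → Generator G → Carrier
  ⟨⟩-generator {n} {m} G a (node u)  = a (u ↑ˡ m)
  ⟨⟩-generator {n} {m} G a (edge f)  = a (n ↑ʳ f)
  ⟨⟩-generator {n} {m} G a (tilde f) = a (proj₁ (endpoints G f) ↑ˡ m) + a (proj₂ (endpoints G f) ↑ˡ m) - a (n ↑ʳ f)
  ⟨⟩-generator {n} {m} G a (left f)  = a (proj₁ (endpoints G f) ↑ˡ m) - a (proj₂ (endpoints G f) ↑ˡ m) + a (n ↑ʳ f)
  ⟨⟩-generator {n} {m} G a (right f) = - a (proj₁ (endpoints G f) ↑ˡ m) + a (proj₂ (endpoints G f) ↑ˡ m) + a (n ↑ʳ f)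

  ⟨⟩-generator-≈ : ∀ {n m} (G : Multigraph n m) a g → ⟨ a , generator G g ⟩ ≈ ⟨⟩-generator G a g
  ⟨⟩-generator-≈ G a (node u)  = ⟨⟩-δ a _
  ⟨⟩-generator-≈ G a (edge f)  = ⟨⟩-δ a _
  ⟨⟩-generator-≈ {n} {m} G a (tilde f) = trans (⟨⟩-+ a (λ i → δ (u ↑ˡ m) i + δ (v ↑ˡ m) i) (λ i → - δ (n ↑ʳ f) i)) (+-cong
    (trans (⟨⟩-+ a (δ (u ↑ˡ m)) (δ (v ↑ˡ m))) (+-cong (⟨⟩-δ a _) (⟨⟩-δ a _)))
    (trans (⟨⟩-neg a (δ (n ↑ʳ f))) (-‿cong (⟨⟩-δ a _))))
    where
    u = proj₁ (endpoints G f)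
    v = proj₂ (endpoints G f)
  ⟨⟩-generator-≈ {n} {m} G a (left f) = trans (⟨⟩-+ a (λ i → δ (u ↑ˡ m) i - δ (v ↑ˡ m) i) (δ (n ↑ʳ f))) (+-cong
    (trans (⟨⟩-+ a (δ (u ↑ˡ m)) (λ i → - δ (v ↑ˡ m) i)) (+-cong (⟨⟩-δ a _) (trans (⟨⟩-neg a (δ (v ↑ˡ m))) (-‿cong (⟨⟩-δ a _)))))
    (⟨⟩-δ a _))
    where
    u = proj₁ (endpoints G f)
    v = proj₂ (endpoints G f)
  ⟨⟩-generator-≈ {n} {m} G a (right f) = trans (⟨⟩-+ a (λ i → - δ (u ↑ˡ m) i + δ (v ↑ˡ m) i) (δ (n ↑ʳ f))) (+-cong
    (trans (⟨⟩-+ a (λ i → - δ (u ↑ˡ m) i) (δ (v ↑ˡ m))) (+-cong (trans (⟨⟩-neg a (δ (u ↑ˡ m))) (-‿cong (⟨⟩-δ a _))) (⟨⟩-δ a _)))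
    (⟨⟩-δ a _))
    where
    u = proj₁ (endpoints G f)
    v = proj₂ (endpoints G f)

  -- Every generator lies in the hyperplane of coordinate sum `1#`.
  polytope-total : ∀ {n m} (G : Multigraph n m) {p} → CosmologicalPolytope G p → ⟨ (λ _ → 1#) , p ⟩ ≈ 1#
  polytope-total G {p} (k , g , w , _ , Σw≈1 , e) = begin
    ⟨ (λ _ → 1#) , p ⟩                                        ≈⟨ ⟨⟩-cong (λ _ → 1#) e ⟩
    ⟨ (λ _ → 1#) , combination w (generator G ∘ g) ⟩          ≈⟨ ⟨⟩-combination (λ _ → 1#) w (generator G ∘ g) ⟩
    sum (λ b → w b * ⟨ (λ _ → 1#) , generator G (g b) ⟩)      ≈⟨ sum-cong-≋ (λ b → trans (*-congˡ (trans (⟨⟩-generator-≈ G (λ _ → 1#) (g b)) (total-1 (g b))))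
                                                                                    (*-identityʳ (w b))) ⟩
    sum w                                                     ≈⟨ Σw≈1 ⟩
    1#                                                        ∎
    where
    total-1 : ∀ g → ⟨⟩-generator G (λ _ → 1#) g ≈ 1#
    total-1 (node u)  = refl
    total-1 (edge f)  = refl
    total-1 (tilde f) = trans (+-assoc 1# 1# (- 1#)) (trans (+-congˡ (-‿inverseʳ 1#)) (+-identityʳ 1#))
    total-1 (left f)  = trans (+-congʳ (-‿inverseʳ 1#)) (+-identityˡ 1#)
    total-1 (right f) = trans (+-congʳ (-‿inverseˡ 1#)) (+-identityˡ 1#)

  polytope-nonneg : ∀ {n m} (G : Multigraph n m) a → (∀ g → 0# ≤ ⟨⟩-generator G a g) →
                    ∀ {p} → CosmologicalPolytope G p → 0# ≤ ⟨ a , p ⟩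
  polytope-nonneg G a a≥0 {p} (k , g , w , w≥0 , _ , e) =
    ≤-respʳ-≈ (sym (trans (⟨⟩-cong a e) (⟨⟩-combination a w (generator G ∘ g))))
      (sum-nonneg _ (λ b → *-nonNeg (w≥0 b) (≤-respʳ-≈ (sym (⟨⟩-generator-≈ G a (g b))) (a≥0 (g b)))))

  dilate-total : ∀ {n m} (G : Multigraph n m) {j} (y : Vec ℤ n) (t : Vec ℤ m) →
                 LatticePoints (Dilate j (CosmologicalPolytope G)) (y ++ t) →
                 total y ℤ.+ total t ≡ + j
  dilate-total {n} {m} G {j} y t (p , p∈ , e) =
    ≡.trans (≡.sym (≡.trans (weightedSum-ones (y ++ t)) (total-++ y t))) (fromℤ-injective (begin
    fromℤ (weightedSum (replicate (n ℕ.+ m) 1) (y ++ t))                   ≈⟨ ⟨⟩-weights (replicate (n ℕ.+ m) 1) (y ++ t) ⟨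
    ⟨ (λ i → lookup (replicate (n ℕ.+ m) 1) i · 1#) , point (y ++ t) ⟩  ≈⟨ sum-cong-≋ (λ i → *-congʳ {point (y ++ t) i} (one i)) ⟩
    ⟨ (λ _ → 1#) , point (y ++ t) ⟩                                ≈⟨ ⟨⟩-cong (λ _ → 1#) e ⟩
    ⟨ (λ _ → 1#) , (λ i → (j · 1#) * p i) ⟩                        ≈⟨ ⟨⟩-scale (j · 1#) (λ _ → 1#) p ⟩
    (j · 1#) * ⟨ (λ _ → 1#) , p ⟩                                  ≈⟨ *-congˡ (polytope-total G p∈) ⟩
    (j · 1#) * 1#                                                  ≈⟨ *-identityʳ _ ⟩
    j · 1#                                                         ∎))
    where
    one : ∀ i → lookup (replicate (n ℕ.+ m) 1) i · 1# ≈ 1#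
    one i = trans (reflexive (cong (_· 1#) (lookup-replicate i 1))) (+-identityʳ 1#)

  -- `cut` is not linear in `t`, so the functional is chosen for the point at hand, where it attains
  -- `cut G S t`. It is nonnegative on all generators whatever the signs in `t`.
  dilate-cutInequalities : ∀ {n m} (G : Multigraph n m) {j} y t →
    LatticePoints (Dilate j (CosmologicalPolytope G)) (y ++ t) → CutInequalities G (y , t)
  dilate-cutInequalities {n} {m} G {j} y t (p , p∈ , e) S = subst (0ℤ ℤ.≤_)
    (≡.trans (weightedSum-++ (Vec.map sideWeight S) (cutWeights G S t) y t) (cong₂ ℤ._+_ (weightedSum-sides S y) (weightedSum-cut G S t)))
    (fromℤ-nonneg⁻ (≤-respʳ-≈ (trans (sym (trans (⟨⟩-cong a e) (⟨⟩-scale (j · 1#) a p))) (⟨⟩-weights as (y ++ t)))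
      (*-nonNeg (·1-nonneg j) (polytope-nonneg G a generators p∈))))
    where
    as = Vec.map sideWeight S ++ cutWeights G S t
    a : Point (n ℕ.+ m)
    a i = lookup as i · 1#
    node-weight : ∀ u → a (u ↑ˡ m) ≡ fromℤ (+ sideWeight (lookup S u))
    node-weight u = cong (_· 1#) (≡.trans (lookup-++ˡ (Vec.map sideWeight S) (cutWeights G S t) u) (lookup-map u sideWeight S))
    edge-weight : ∀ f → a (n ↑ʳ f) ≡ fromℤ (+ cutWeight (lookup S (proj₁ (endpoints G f))) (lookup S (proj₂ (endpoints G f))) (lookup t f))
    edge-weight f = cong (_· 1#) (≡.trans (lookup-++ʳ (Vec.map sideWeight S) (cutWeights G S t) f) (lookup-cutWeights G S t f))
    nonneg₃ : ∀ x y z {p q r} → 0ℤ ℤ.≤ x ℤ.+ y ℤ.+ z → fromℤ x ≈ p → fromℤ y ≈ q → fromℤ z ≈ r → 0# ≤ p + q + r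
    nonneg₃ x y z h ex ey ez = ≤-respʳ-≈
      (trans (fromℤ-+ (x ℤ.+ y) z) (+-cong (trans (fromℤ-+ x y) (+-cong ex ey)) ez)) (fromℤ-nonneg⁺ h)
    side : Fin n → ℤ
    side u = + sideWeight (lookup S u)
    side-≈ : ∀ u → fromℤ (side u) ≈ a (u ↑ˡ m)
    side-≈ u = reflexive (≡.sym (node-weight u))
    -side-≈ : ∀ u → fromℤ (ℤ.- side u) ≈ - a (u ↑ˡ m)
    -side-≈ u = trans (fromℤ-neg (side u)) (-‿cong (side-≈ u))
    cutAt : Fin m → ℤ
    cutAt f = + cutWeight (lookup S (proj₁ (endpoints G f))) (lookup S (proj₂ (endpoints G f))) (lookup t f)
    cutAt-≈ : ∀ f → fromℤ (cutAt f) ≈ a (n ↑ʳ f)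
    cutAt-≈ f = reflexive (≡.sym (edge-weight f))
    generators : ∀ g → 0# ≤ ⟨⟩-generator G a g
    generators (node u)  = ·1-nonneg (lookup as (u ↑ˡ m))
    generators (edge f)  = ·1-nonneg (lookup as (n ↑ʳ f))
    generators (tilde f) = nonneg₃ (side u) (side v) (ℤ.- cutAt f) (tilde-weight (lookup S u) (lookup S v) (lookup t f))
      (side-≈ u) (side-≈ v) (trans (fromℤ-neg (cutAt f)) (-‿cong (cutAt-≈ f)))
      where
      u = proj₁ (endpoints G f)
      v = proj₂ (endpoints G f)
    generators (left f) = nonneg₃ (side u) (ℤ.- side v) (cutAt f) (left-weight (lookup S u) (lookup S v) (lookup t f))
      (side-≈ u) (-side-≈ v) (cutAt-≈ f)
      where
      u = proj₁ (endpoints G f)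
      v = proj₂ (endpoints G f)
    generators (right f) = nonneg₃ (ℤ.- side u) (side v) (cutAt f) (right-weight (lookup S u) (lookup S v) (lookup t f))
      (-side-≈ u) (side-≈ v) (cutAt-≈ f)
      where
      u = proj₁ (endpoints G f)
      v = proj₂ (endpoints G f)

  -- The inequalities yield membership in some degree only; it equals `j` because both are the
  -- coordinate sum. Together with `inDilate⇒generated` this is the integer decomposition property
  -- of the polytope.
  dilate⇔inDilate : ∀ {n m} (G : Multigraph (suc n) m) {j} y t →
    LatticePoints (Dilate j (CosmologicalPolytope G)) (y ++ t) ⇔ InDilate G j (y , t)
  dilate⇔inDilate G {j} y t = mk⇔
    (λ x∈ → let (i , x∈′) = cutInequalities⇒inDilate G y t (dilate-cutInequalities G {j} y t x∈)
            in subst (λ k → InDilate G k (y , t))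
                 (ℤ.+-injective (≡.trans (≡.sym (inDilate-total G y t x∈′)) (dilate-total G {j} y t x∈))) x∈′)
    (generated⇒dilate G ∘ inDilate⇒generated G y t)

  -- This fact about integers is read off the polytope over K, which avoids a
  -- second induction on the edges.
  inDilate⇒cutInequalities : ∀ {n m} (G : Multigraph (suc n) m) {j} y t → InDilate G j (y , t) → CutInequalities G (y , t)
  inDilate⇒cutInequalities G {j} y t x∈ = dilate-cutInequalities G {j} y t (generated⇒dilate G (inDilate⇒generated G y t x∈))

  standardBasis : ∀ {n m} (G : Multigraph n m) → ∀ i → CosmologicalPolytope G (δ i)
  standardBasis {n} {m} G i = subst (λ i → CosmologicalPolytope G (δ i)) (join-splitAt n m i) (case (splitAt n i))
    where
    case : (s : Fin n ⊎ Fin m) → CosmologicalPolytope G (δ (join n m s))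
    case (inj₁ u) = generator∈polytope G (node u)
    case (inj₂ f) = generator∈polytope G (edge f)

  combination-δ : ∀ {N} (w : Point N) → combination w δ ≋ w
  combination-δ w i = trans (sum-cong-≋ (λ a → *-congˡ (reflexive (δ-sym a i)))) (⟨⟩-δ w i)
    where
    δ-sym : ∀ {N} (a i : Fin N) → δ a i ≡ δ i a
    δ-sym a i with a ≟ i | i ≟ a
    ... | yes _ | yes _ = ≡.refl
    ... | no _  | no _  = ≡.refl
    ... | yes e | no ¬e = contradiction (≡.sym e) ¬e
    ... | no ¬e | yes e = contradiction (≡.sym e) ¬e

  -- All standard basis vectors are generators. They are an affine basis of the hyperplane of
  -- coordinate sum `1#`, which contains the polytope.
  polytope-dimension : ∀ {n m} (G : Multigraph (suc n) m) → HasDimension (CosmologicalPolytope G) (n ℕ.+ m)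
  polytope-dimension G = δ , standardBasis G ,
    (λ w _ e i → trans (sym (combination-δ w i)) (e i)) ,
    (λ x x∈ → x , trans (sum-cong-≋ (λ i → sym (*-identityˡ (x i)))) (polytope-total G x∈) , (λ i → sym (combination-δ x i)))

-- Counting the lattice points by deletion and contraction.

open EhrhartSeries using (deletionWeight; latticeCount; latticeCount-step; compositions; latticeCount-1-z)

module Counting {c ℓ₁ ℓ₂} (K : OrderedField c ℓ₁ ℓ₂) where
  open Polytopes K
  open Cardinality K
  open LatticeGeometry K
  open ≡ using (refl; sym; trans)

  -- Along the line the slack of `S` rises, falls or stays, depending on which of `u` and `v` lie in
  -- `S`. A rising slack is controlled at the near end `y`, a falling one at the far end.
  inDilate-convex : ∀ {n m} (G : Multigraph n m) u v {l i k} y t → i ℕ.≤ k →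
    InDilate G l (y , t) → InDilate G l (shift u v (+ k) y , t) → InDilate G l (shift u v (+ i) y , t)
  inDilate-convex {suc n} G u v {l} {i} {k} y t i≤k y∈ y+k∈ =
    let (j , y+i∈) = cutInequalities⇒inDilate G (shift u v (+ i) y) t inequalities
    in subst (λ j → InDilate G j (shift u v (+ i) y , t)) (ℤ.+-injective (trans (sym (inDilate-total G (shift u v (+ i) y) t y+i∈))
         (trans (cong (ℤ._+ total t) (total-shift u v (+ i) y)) (inDilate-total G y t y∈)))) y+i∈
    where
    slack : Subset (suc n) → ℤ
    slack S = sumOn S y ℤ.+ cut G S t
    slack-shift : ∀ S a → sumOn S (shift u v a y) ℤ.+ cut G S t ≡
                          slack S ℤ.+ (weight (lookup S u) a ℤ.+ weight (lookup S v) (ℤ.- a))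
    slack-shift S a = trans (cong (ℤ._+ cut G S t) (sumOn-bump₂ S u v a (ℤ.- a) y)) (lemma (sumOn S y) _ _ (cut G S t))
      where
      lemma : ∀ s q p c → s ℤ.+ q ℤ.+ p ℤ.+ c ≡ s ℤ.+ c ℤ.+ (p ℤ.+ q)
      lemma = solve-∀
    between : ∀ a b s → 0ℤ ℤ.≤ s → 0ℤ ℤ.≤ s ℤ.+ (weight a (+ k) ℤ.+ weight b (ℤ.- + k)) →
              0ℤ ℤ.≤ s ℤ.+ (weight a (+ i) ℤ.+ weight b (ℤ.- + i))
    between inside  inside  s p q = subst (0ℤ ℤ.≤_) (trans (sym (ℤ.+-identityʳ s)) (cong (ℤ._+_ s) (sym (ℤ.+-inverseʳ (+ i))))) p
    between inside  outside s p q = ℤ.+-mono-≤ p (ℤ.+≤+ z≤n)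
    between outside inside  s p q = ℤ.≤-trans q (ℤ.+-monoʳ-≤ s (ℤ.+-monoʳ-≤ 0ℤ (ℤ.neg-mono-≤ (ℤ.+≤+ i≤k))))
    between outside outside s p q = q
    inequalities : CutInequalities G (shift u v (+ i) y , t)
    inequalities S = subst (0ℤ ℤ.≤_) (sym (slack-shift S (+ i))) (between (lookup S u) (lookup S v) (slack S)
      (inDilate⇒cutInequalities G y t y∈ S)
      (subst (0ℤ ℤ.≤_) (slack-shift S (+ k)) (inDilate⇒cutInequalities G (shift u v (+ k) y) t y+k∈ S)))

  card-compositions : ∀ n j → HasCardinality {A = Vec ℤ n} (λ y → Nonnegative y × total y ≡ + j) (compositions n j)
  card-compositions zero    zero    = card-cong (λ { [] _ → (λ ()) , refl }) (λ { [] _ → refl }) (card-singleton [])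
  card-compositions zero    (suc j) = card-∅ (λ { [] (_ , ()) })
  card-compositions (suc n) j = card-cong assemble split (card-antidiagonal disjoint card j)
    where
    Q : ℕ → ℕ → Vec ℤ (suc n) → Set
    Q k l (x ∷ y) = x ≡ + k × Nonnegative y × total y ≡ + l
    disjoint : ∀ {k l k′ l′} y → Q k l y → Q k′ l′ y → k ≡ k′
    disjoint (x ∷ y) (refl , _) (e , _) = ℤ.+-injective e
    card : ∀ k l → HasCardinality (Q k l) (1 ℕ.* compositions n l ℕ.+ 0 ℕ.* 0)
    card k l = subst (HasCardinality (Q k l)) (sym (trans (ℕ.+-identityʳ _) (ℕ.*-identityˡ _)))
      (card-image (+ k ∷_) (λ _ _ → Vec.∷-injectiveʳ) (λ y y∈ → refl , y∈) (λ { (x ∷ y) (e , y∈) → y , y∈ , cong (_∷ y) e })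
        (card-compositions n l))
    assemble : ∀ y → (∃[ k ] ∃[ l ] k ℕ.+ l ≡ j × Q k l y) → Nonnegative y × total y ≡ + j
    assemble (x ∷ y) (k , l , refl , refl , nn , e) =
      (λ { Fin.zero → ℤ.+≤+ z≤n ; (Fin.suc w) → nn w }) , trans (cong (ℤ._+_ (+ k)) e) (sym (ℤ.pos-+ k l))
    split : ∀ y → Nonnegative y × total y ≡ + j → ∃[ k ] ∃[ l ] k ℕ.+ l ≡ j × Q k l y
    split (x ∷ y) (nn , e) =
      k , l , ℤ.+-injective (trans (ℤ.pos-+ k l) (trans (cong₂ ℤ._+_ +k≡ +l≡) e)) , sym +k≡ , nn ∘ Fin.suc , sym +l≡
      where
      k = ℤ.∣ x ∣
      l = ℤ.∣ total y ∣
      +k≡ : + k ≡ x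
      +k≡ = ℤ.0≤i⇒+∣i∣≡i (nn Fin.zero)
      +l≡ : + l ≡ total y
      +l≡ = ℤ.0≤i⇒+∣i∣≡i (total-nonneg y (nn ∘ Fin.suc))

  module _ {n m} (G : Multigraph n (suc m)) where
    private
      u = proj₁ (endpoints G Fin.zero)
      v = proj₂ (endpoints G Fin.zero)
      G₁ = deleteFirst G

    -- The part of the dilate in which the first edge claims degree `k`. Slabs of different `k` are
    -- disjoint since `k` is the absolute value of `x`.
    Slab : ℕ → ℕ → Vec ℤ n × Vec ℤ (suc m) → Set
    Slab k l (y , x ∷ t) = ∃[ a ] ∃[ b ] Move k x a b × InDilate G₁ l (bump₂ u v a b y , t)

    Thickened : ℕ → ℕ → Vec ℤ n × Vec ℤ m → Set
    Thickened w l (y , t) = ∃[ i ] i ℕ.≤ w × InDilate G₁ l (shift u v (ℤ.- + i) y , t)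

    private
      slab-disjoint : ∀ {k l k′ l′} p → Slab k l p → Slab k′ l′ p → k ≡ k′
      slab-disjoint (y , x ∷ t) (_ , _ , mv , _) (_ , _ , mv′ , _) = trans (sym (move-abs mv)) (move-abs mv′)
        where
        move-abs : ∀ {k x a b} → Move k x a b → ℤ.∣ x ∣ ≡ k
        move-abs (arrows _) = refl
        move-abs tildes     = refl

      -- The two halves of a slab by the sign of `x`. Translating by `k` turns the shifts from -k to
      -- k allowed by `Move` into the shifts from 0 to 2k of `Thickened`.
      Arrows Tildes : ℕ → ℕ → Vec ℤ n × Vec ℤ (suc m) → Set
      Arrows k l (y , x ∷ t) = x ≡ + k × Thickened (2 ℕ.* k) l (shift u v (+ k) y , t)
      Tildes k l (y , x ∷ t) = x ≡ -[1+ k ] × InDilate G₁ l (bump₂ u v -[1+ k ] -[1+ k ] y , t)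

      shift-inverse : ∀ a y → shift u v a (shift u v (ℤ.- a) y) ≡ y
      shift-inverse a y = trans (shift-shift u v a (ℤ.- a) y) (trans (cong (λ b → shift u v b y) (ℤ.+-inverseʳ a)) (shift-0 u v y))

      card-arrows : ∀ k l {s} → HasCardinality (Thickened (2 ℕ.* k) l) s → HasCardinality (Arrows k l) s
      card-arrows k l = card-image (λ { (y , t) → shift u v (ℤ.- + k) y , + k ∷ t })
        (λ { {y , t} {z , s} _ _ e → let (e₁ , e₂) = Product.,-injective e in
          cong₂ _,_ (trans (sym (shift-inverse (+ k) y)) (trans (cong (shift u v (+ k)) e₁) (shift-inverse (+ k) z)))
                    (Vec.∷-injectiveʳ e₂) })
        (λ { (y , t) h → refl , subst (λ y → Thickened (2 ℕ.* k) l (y , t)) (sym (shift-inverse (+ k) y)) h })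
        (λ { (y , x ∷ t) (e , h) → (shift u v (+ k) y , t) , h ,
          cong₂ _,_ (sym (trans (shift-shift u v (ℤ.- + k) (+ k) y) (trans (cong (λ b → shift u v b y) (ℤ.+-inverseˡ (+ k))) (shift-0 u v y))))
                    (cong (_∷ t) e) })

      card-tildes : ∀ k l {s} → HasCardinality (InDilate G₁ l) s → HasCardinality (Tildes k l) s
      card-tildes k l = card-image (λ { (y , t) → bump₂ u v (+ suc k) (+ suc k) y , -[1+ k ] ∷ t })
        (λ { {y , t} {z , s} _ _ e → let (e₁ , e₂) = Product.,-injective e in
          cong₂ _,_ (trans (sym (bump₂-inverse′ u v (+ suc k) (+ suc k) y))
                      (trans (cong (bump₂ u v -[1+ k ] -[1+ k ]) e₁) (bump₂-inverse′ u v (+ suc k) (+ suc k) z)))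
                    (Vec.∷-injectiveʳ e₂) })
        (λ { (y , t) h → refl , subst (λ y → InDilate G₁ l (y , t)) (sym (bump₂-inverse′ u v (+ suc k) (+ suc k) y)) h })
        (λ { (y , x ∷ t) (e , h) → (bump₂ u v -[1+ k ] -[1+ k ] y , t) , h ,
          cong₂ _,_ (sym (bump₂-inverse u v (+ suc k) (+ suc k) y)) (cong (_∷ t) e) })

      shift-arrows : ∀ k i y → shift u v (ℤ.- + i) (shift u v (+ k) y) ≡ shift u v (+ k ℤ.- + i) y
      shift-arrows k i y = trans (shift-shift u v (ℤ.- + i) (+ k) y) (cong (λ a → shift u v a y) (ℤ.+-comm (ℤ.- + i) (+ k)))

      arrows⇒slab : ∀ k l p → Arrows k l p → Slab k l p
      arrows⇒slab k l (y , x ∷ t) (refl , i , i≤2k , h) =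
        _ , _ , arrows i≤2k , subst (λ y → InDilate G₁ l (y , t)) (shift-arrows k i y) h

      -- For `k` zero there are only arrows. For positive `k` the tildes add a second, unthickened
      -- copy of the `a` points, which accounts for `deletionWeight`; `s` is the gain from
      -- thickening.
      card-slab : ∀ k l {a s} → HasCardinality (InDilate G₁ l) a → HasCardinality (Thickened (2 ℕ.* k) l) (a ℕ.+ s) →
                  HasCardinality (Slab k l) (deletionWeight k ℕ.* a ℕ.+ s)
      card-slab zero l {a} {s} cardA cardT = subst (HasCardinality _) (cong (ℕ._+ s) (sym (ℕ.*-identityˡ a)))
        (card-cong (arrows⇒slab 0 l)
          (λ { (y , x ∷ t) (_ , _ , arrows {i = i} i≤ , h) →
                 refl , i , i≤ , subst (λ y → InDilate G₁ l (y , t)) (sym (shift-arrows 0 i y)) h })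
          (card-arrows 0 l cardT))
      card-slab (suc k) l {a} {s} cardA cardT = subst (HasCardinality _)
        (trans (sym (ℕ.+-assoc a a s)) (cong (λ b → a ℕ.+ b ℕ.+ s) (sym (ℕ.+-identityʳ a))))
        (card-cong
          (λ { p (inj₂ h) → arrows⇒slab (suc k) l p h ; (y , x ∷ t) (inj₁ (refl , h)) → _ , _ , tildes , h })
          (λ { (y , x ∷ t) (_ , _ , arrows {i = i} i≤ , h) →
                 inj₂ (refl , i , i≤ , subst (λ y → InDilate G₁ l (y , t)) (sym (shift-arrows (suc k) i y)) h)
             ; (y , x ∷ t) (_ , _ , tildes , h) → inj₁ (refl , h) })
          (card-⊎ (λ { (y , x ∷ t) (refl , _) (() , _) }) (card-tildes k l cardA) (card-arrows (suc k) l cardT)))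

    card-first-edge : ∀ {a : ℕ → ℕ} {s : ℕ → ℕ → ℕ} → (∀ l → HasCardinality (InDilate G₁ l) (a l)) →
      (∀ k l → HasCardinality (Thickened (2 ℕ.* k) l) (a l ℕ.+ s k l)) →
      ∀ j → HasCardinality (InDilate G j) (antidiagonalSum (λ k l → deletionWeight k ℕ.* a l ℕ.+ s k l) j)
    card-first-edge cardA cardT j = card-cong (λ { (y , x ∷ t) h → h }) (λ { (y , x ∷ t) h → h })
      (card-antidiagonal slab-disjoint (λ k l → card-slab k l (cardA l) (cardT k l)) j)

    -- For a loop e_u - e_v vanishes, so thickening gains nothing. The summand `0 * 0` fits the form
    -- of `latticeCount-step`.
    card-thickened-loop : u ≡ v → ∀ w l {a} → HasCardinality (InDilate G₁ l) a → HasCardinality (Thickened w l) (a ℕ.+ 0 ℕ.* 0)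
    card-thickened-loop e w l {a} cardA = subst (HasCardinality _) (sym (ℕ.+-identityʳ a)) (card-cong {P = InDilate G₁ l} {Q = Thickened w l}
      (λ { (y , t) h → 0 , z≤n , subst (λ y → InDilate G₁ l (y , t)) (sym (trivial 0ℤ y)) h })
      (λ { (y , t) (i , _ , h) → subst (λ y → InDilate G₁ l (y , t)) (trivial (ℤ.- + i) y) h }) cardA)
      where
      trivial : ∀ a y → shift u v a y ≡ y
      trivial a y = subst (λ v → shift u v a y ≡ y) e (shift-loop u a y)

  -- The count along lines, with the lines parallel to e_u - e_v and `contract` as projection; the
  -- points of the contracted graph are the lines that meet the set.
  card-thickened : ∀ {n m} (G : Multigraph (suc n) (suc m))
    (u≢v : proj₁ (endpoints G Fin.zero) ≢ proj₂ (endpoints G Fin.zero)) w l {a b} →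
    HasCardinality (InDilate (deleteFirst G) l) a → HasCardinality (InDilate (contractFirst G u≢v) l) b →
    HasCardinality (Thickened G w l) (a ℕ.+ w ℕ.* b)
  card-thickened {n} {m} G u≢v w l cardA cardB = card-cong (λ { (y , t) h → h }) (λ { (y , t) h → h })
    (Line.card-thicken cardA
      (λ { {y , t} i≤k p q → inDilate-convex (deleteFirst G) u v y t i≤k p q })
      cardB
      (λ { (q , t) h → let (y , y∈ , e) = inDilate-lift u≢v (deleteFirst G) q t h in (y , t) , y∈ , cong (_, t) e })
      (λ { (y , t) h → inDilate-contract u≢v (deleteFirst G) y t h }) w)
    where
    u = proj₁ (endpoints G Fin.zero)
    v = proj₂ (endpoints G Fin.zero)
    shift′ : ℤ → Vec ℤ (suc n) × Vec ℤ m → Vec ℤ (suc n) × Vec ℤ m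
    shift′ a (y , t) = shift u v a y , t
    project : Vec ℤ (suc n) × Vec ℤ m → Vec ℤ n × Vec ℤ m
    project (y , t) = contract u≢v y , t
    -- Negated, because `shift u v a` subtracts `a` at `v`.
    height : Vec ℤ (suc n) × Vec ℤ m → ℤ
    height (y , t) = ℤ.- lookup y v
    height-shift : ∀ a p → height (shift′ a p) ≡ height p ℤ.+ a
    height-shift a (y , t) = trans (cong ℤ.-_ (lookup-shift u≢v a y)) (lemma (lookup y v) a)
      where
      lemma : ∀ x a → ℤ.- (x ℤ.- a) ≡ ℤ.- x ℤ.+ a
      lemma = solve-∀
    same-line : ∀ p q → project p ≡ project q → ∃[ a ] q ≡ shift′ a p
    same-line (y , t) (z , s) e =
      let (e₁ , e₂) = Product.,-injective e
          (a , z≡) = contract-fibre u≢v y z e₁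
      in a , cong₂ _,_ z≡ (sym e₂)
    module Line = Lines K (Product.≡-dec (Vec.≡-dec ℤ._≟_) (Vec.≡-dec ℤ._≟_)) (Product.≡-dec (Vec.≡-dec ℤ._≟_) (Vec.≡-dec ℤ._≟_))
      shift′ project height
      (λ (y , t) → cong (_, t) (shift-0 u v y)) (λ a b (y , t) → cong (_, t) (shift-shift u v a b y))
      height-shift (λ a (y , t) → cong (_, t) (contract-shift u≢v a y)) same-line

  mutual
    card-inDilate : ∀ {n m} (G : Multigraph n m) j → HasCardinality (InDilate G j) (latticeCount G j)
    card-inDilate {n} {zero}  G j = card-image (_, []) (λ _ _ → Product.,-injectiveˡ) (λ y h → h) (λ { (y , []) h → y , h , refl })
      (card-compositions n j)
    card-inDilate {n} {suc m} G = card-inDilate-step G (proj₁ (endpoints G Fin.zero) ≟ proj₂ (endpoints G Fin.zero))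

    card-inDilate-step : ∀ {n m} (G : Multigraph n (suc m)) dec j → HasCardinality (InDilate G j) (latticeCount-step G dec j)
    card-inDilate-step G (yes e) = card-first-edge G (card-inDilate (deleteFirst G))
      (λ k l → card-thickened-loop G e (2 ℕ.* k) l (card-inDilate (deleteFirst G) l))
    card-inDilate-step {zero}  G (no u≢v) = contradiction (proj₁ (endpoints G Fin.zero)) λ ()
    card-inDilate-step {suc n} G (no u≢v) = card-first-edge G (card-inDilate (deleteFirst G))
      (λ k l → card-thickened G u≢v (2 ℕ.* k) l (card-inDilate (deleteFirst G) l) (card-inDilate (contractFirst G u≢v) l))

  card-latticePoints : ∀ {n m} (G : Multigraph (suc n) m) j →
    HasCardinality (LatticePoints (Dilate j (CosmologicalPolytope G))) (latticeCount G j)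
  card-latticePoints {n} {m} G j = card-image (λ { (y , t) → y ++ t })
    (λ { {y , t} {z , s} _ _ e → let (e₁ , e₂) = Vec.++-injective y z e in cong₂ _,_ e₁ e₂ })
    (λ { (y , t) h → Equivalence.from (dilate⇔inDilate G y t) h })
    (λ x h → let (y , t , e) = Vec.splitAt (suc n) x in
      (y , t) , Equivalence.to (dilate⇔inDilate G {j} y t) (subst (LatticePoints (Dilate j (CosmologicalPolytope G))) e h) , e)
    (card-inDilate G j)

mainTheorem11 : ∀ {c ℓ₁ ℓ₂} (K : OrderedField c ℓ₁ ℓ₂) {n m : ℕ} .{{_ : NonZero n}} (G : Multigraph n m) →
    let open PowerSeries
        open Polytopes K
    in IsHStarPolynomial (CosmologicalPolytope G)
         (∑[ H ∈ acyclicSubsets G ] ((const (+ 2) ⊛ z) ^ ∣ H ∣ ⊛ (const (+ 1) ⊕ z) ^ (m ∸ ∣ H ∣)))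
-- With `suc n` nodes the dimension is n + m, so the exponent `suc d` is the number of nodes plus
-- edges, as in `latticeCount-1-z`.
mainTheorem11 K {suc n} {m} G = n ℕ.+ m , LatticeGeometry.polytope-dimension K G ,
  latticeCount G , Counting.card-latticePoints K G , latticeCount-1-z G
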